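{- Let $n$ be a prime and let $X_n$ be the $2$-dimensional simplicial complex on vertex set $\mathbb{Z}_n$ with full $1$-skeleton whose $2$-faces are exactly the $3$-term arithmetic progressions $\{a,a+d,a+2d\}$ in $\mathbb{Z}_n$ with difference $d\notin\{0,\pm1\}$. Let $G_n=\mathbb{Z}_n^*/\{\pm1\}$ and let $H_n$ be the subgroup of $G_n$ generated by (the class of) $2$. Then $\mathrm{rank}_{\mathbb{Q}}(X_n)=|X_n|-(n-1)\cdot([G_n:H_n]-1)$, where $|X_n|$ is the number of $2$-faces. In particular, $X_n$ is acyclic over $\mathbb{Q}$ if and only if $\mathbb{Z}_n^*$ is generated by $\{\pm1,2\}$.
   Context: $\mathrm{rank}_{\mathbb{Q}}(X_n)$ is the rank over $\mathbb{Q}$ of the set of columns of the $2$-dimensional boundary matrix $\partial_2$ (with $\partial(v_0,v_1,v_2)=(v_1,v_2)-(v_0,v_2)+(v_0,v_1)$, arbitrary fixed orientations) corresponding to the $2$-faces of $X_n$. A set of faces is acyclic if its rank equals its cardinality. -}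

module Defs where

open import Data.Nat using (ℕ; zero; suc; _<_; _<?_; _^_; _∸_)
open import Data.Nat.Divisibility using (_∣_; _∣?_)
open import Data.Integer as ℤ using (ℤ; +_; -_; ∣_∣)
open import Data.Fin using (Fin; toℕ; _≟_)
open import Data.Fin.Properties using (any?; all?)
open import Data.Rational as ℚ using (ℚ; 0ℚ; 1ℚ)
open import Data.List using (List; []; _∷_; filter; length; foldr; cartesianProduct; allFin)
open import Data.List.Relation.Unary.All using (All)
open import Data.List.Relation.Unary.Unique.Propositional using (Unique)
open import Data.Product using (Σ; ∃; _×_; _,_)
open import Data.Sum using (_⊎_)
open import Relation.Nullary using (¬_; Dec; does; ¬?)
open import Relation.Nullary.Decidable using (_×-dec_; _⊎-dec_; _→-dec_)
open import Relation.Binary.PropositionalEquality using (_≡_; _≢_)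
open import Data.Bool using (if_then_else_; _∧_)

_≡_[mod_] : ℤ → ℤ → ℕ → Set
a ≡ b [mod n ] = n ∣ ∣ a ℤ.- b ∣

_≡?_[mod_] : (a b : ℤ) (n : ℕ) → Dec (a ≡ b [mod n ])
a ≡? b [mod n ] = n ∣? ∣ a ℤ.- b ∣

⟦_⟧ : {n : ℕ} → Fin n → ℤ
⟦ x ⟧ = + toℕ x

-- The complex X_n.  Vertices are Fin n (= ℤ_n).  A 2-face is recorded
-- as its vertex triple (i , j , k) listed in increasing order
-- (toℕ i < toℕ j < toℕ k); this also fixes its orientation.

Triple : ℕ → Set
Triple n = Fin n × Fin n × Fin n

Mem3 : ℕ → ℤ → ℤ → ℤ → ℤ → Set
Mem3 n x p q r = (x ≡ p [mod n ]) ⊎ (x ≡ q [mod n ]) ⊎ (x ≡ r [mod n ])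

mem3? : ∀ n x p q r → Dec (Mem3 n x p q r)
mem3? n x p q r = (x ≡? p [mod n ]) ⊎-dec ((x ≡? q [mod n ]) ⊎-dec (x ≡? r [mod n ]))

SameSet : ℕ → ℤ → ℤ → ℤ → ℤ → ℤ → ℤ → Set
SameSet n i j k p q r =
  (Mem3 n i p q r × Mem3 n j p q r × Mem3 n k p q r) ×
  (Mem3 n p i j k × Mem3 n q i j k × Mem3 n r i j k)

sameSet? : ∀ n i j k p q r → Dec (SameSet n i j k p q r)
sameSet? n i j k p q r =
  (mem3? n i p q r ×-dec (mem3? n j p q r ×-dec mem3? n k p q r)) ×-dec
  (mem3? n p i j k ×-dec (mem3? n q i j k ×-dec mem3? n r i j k))

GoodDiff : ℕ → ℤ → Set
GoodDiff n d = ¬ (d ≡ + 0 [mod n ]) × ¬ (d ≡ + 1 [mod n ]) × ¬ (d ≡ - (+ 1) [mod n ])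

goodDiff? : ∀ n d → Dec (GoodDiff n d)
goodDiff? n d = ¬? (d ≡? + 0 [mod n ]) ×-dec (¬? (d ≡? + 1 [mod n ]) ×-dec ¬? (d ≡? - (+ 1) [mod n ]))

IsAP : (n : ℕ) → Fin n → Fin n → Fin n → Set
IsAP n i j k = ∃ λ (a : Fin n) → ∃ λ (d : Fin n) →
  GoodDiff n ⟦ d ⟧ ×
  SameSet n ⟦ i ⟧ ⟦ j ⟧ ⟦ k ⟧ ⟦ a ⟧ (⟦ a ⟧ ℤ.+ ⟦ d ⟧) (⟦ a ⟧ ℤ.+ (+ 2) ℤ.* ⟦ d ⟧)

isAP? : ∀ n i j k → Dec (IsAP n i j k)
isAP? n i j k = any? λ a → any? λ d →
  goodDiff? n ⟦ d ⟧ ×-dec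
  sameSet? n ⟦ i ⟧ ⟦ j ⟧ ⟦ k ⟧ ⟦ a ⟧ (⟦ a ⟧ ℤ.+ ⟦ d ⟧) (⟦ a ⟧ ℤ.+ (+ 2) ℤ.* ⟦ d ⟧)

IsFace : (n : ℕ) → Triple n → Set
IsFace n (i , j , k) = toℕ i < toℕ j × toℕ j < toℕ k × IsAP n i j k

isFace? : ∀ n (t : Triple n) → Dec (IsFace n t)
isFace? n (i , j , k) = (toℕ i <? toℕ j) ×-dec ((toℕ j <? toℕ k) ×-dec isAP? n i j k)

allTriples : (n : ℕ) → List (Triple n)
allTriples n = cartesianProduct (allFin n) (cartesianProduct (allFin n) (allFin n))

faces : (n : ℕ) → List (Triple n)
faces n = filter (isFace? n) (allTriples n)

numFaces : ℕ → ℕ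
numFaces n = length (faces n)

-- Boundary matrix ∂₂ over ℚ.  The column of the oriented face (i,j,k)
-- (i<j<k) is the vector indexed by edges (u,v) (u<v) given by
-- ∂(i,j,k) = (j,k) - (i,k) + (i,j).  Vectors are functions on pairs
-- (u,v); entries with ¬(u<v) are always 0.

∂₂ : {n : ℕ} → Triple n → Fin n → Fin n → ℚ
∂₂ (i , j , k) u v =
  if does (u ≟ j) ∧ does (v ≟ k) then 1ℚ
  else if does (u ≟ i) ∧ does (v ≟ k) then ℚ.- 1ℚ
  else if does (u ≟ i) ∧ does (v ≟ j) then 1ℚ
  else 0ℚ

sumList : {A : Set} → List A → (A → ℚ) → ℚ
sumList S f = foldr (λ t acc → f t ℚ.+ acc) 0ℚ S

Acyclic : (n : ℕ) → List (Triple n) → Set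
Acyclic n S =
  Unique S × All (IsFace n) S ×
  ((c : Triple n → ℚ) →
     (∀ u v → sumList S (λ t → c t ℚ.* ∂₂ t u v) ≡ 0ℚ) →
     All (λ t → c t ≡ 0ℚ) S)

RankIs : (n : ℕ) → ℕ → Set
RankIs n r =
  (Σ (List (Triple n)) λ S → Acyclic n S × length S ≡ r) ×
  ((S : List (Triple n)) → Acyclic n S → length S Data.Nat.≤ r)

-- G_n = ℤ_n^* / {±1},  H_n = ⟨ [2] ⟩ ≤ G_n.
-- For units x, y the classes [x],[y] ∈ G_n lie in the same coset of H_n
-- iff [y] = [x]·[2]^k for some k, i.e. y ≡ ± x·2^k (mod n).  Since
-- |G_n| < n, exponents k < n suffice.

SameCoset : (n : ℕ) → Fin n → Fin n → Set
SameCoset n x y = ∃ λ (k : Fin n) →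
  (⟦ y ⟧ ≡ ⟦ x ⟧ ℤ.* (+ (2 ^ toℕ k)) [mod n ]) ⊎
  (⟦ y ⟧ ≡ ℤ.- (⟦ x ⟧ ℤ.* (+ (2 ^ toℕ k))) [mod n ])

sameCoset? : ∀ n x y → Dec (SameCoset n x y)
sameCoset? n x y = any? λ k →
  (⟦ y ⟧ ≡? ⟦ x ⟧ ℤ.* (+ (2 ^ toℕ k)) [mod n ]) ⊎-dec
  (⟦ y ⟧ ≡? ℤ.- (⟦ x ⟧ ℤ.* (+ (2 ^ toℕ k))) [mod n ])

-- units of ℤ_n for n prime: the nonzero residues
IsUnit : (n : ℕ) → Fin n → Set
IsUnit n x = ¬ (toℕ x ≡ 0)

isUnit? : ∀ n x → Dec (IsUnit n x)
isUnit? n x = ¬? (toℕ x Data.Nat.≟ 0)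

MinRep : (n : ℕ) → Fin n → Set
MinRep n x = IsUnit n x × ((y : Fin n) → toℕ y < toℕ x → IsUnit n y → ¬ SameCoset n x y)

minRep? : ∀ n x → Dec (MinRep n x)
minRep? n x = isUnit? n x ×-dec
  all? (λ y → (toℕ y <? toℕ x) →-dec (isUnit? n y →-dec ¬? (sameCoset? n x y)))

index : ℕ → ℕ
index n = length (filter (minRep? n) (allFin n))

GeneratedByPM1And2 : ℕ → Set
GeneratedByPM1And2 n = (x : Fin n) → IsUnit n x → ∃ λ (k : ℕ) →
  (⟦ x ⟧ ≡ + (2 ^ k) [mod n ]) ⊎ (⟦ x ⟧ ≡ ℤ.- (+ (2 ^ k)) [mod n ])

{-# OPTIONS --safe #-}
module Submission where

-- Write F (b , d) for the coefficient of the oriented face (b - d , b , b + d); F is odd in d, and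
-- vanishes for d ∈ {0 , ±1}.  The edge (y - d , y + d) lies in the three progressions with middle
-- terms y and y ± d, so F is a cycle iff F (y , d) = F (y - d , 2d) + F (y + d , 2d) for all y and d.
--
-- Hence F (· , d) is determined by F (· , 2ᵏ d), cosets of ⟨±1 , 2⟩ do not interact, and F = 0 on the
-- coset of 1.  Summing over y, the total of F (· , d) is twice that of F (· , 2d), so it is 0.  On
-- any other coset, with representative d, every function f of total 0 occurs as F (· , d): if
-- f (x + d) - f (x - d) = h (x), take for F (· , e) the function of total 0 with
-- F (x + e , e) - F (x - e , e) = h (x); these satisfy the relation because
-- (Sᵉ - S⁻ᵉ)(Sᵉ + S⁻ᵉ) = S²ᵉ - S⁻²ᵉ for the shift S.  Explicitly they are combinations of translates of
-- the sawtooth wave x ↦ ((x - e) / 2e mod n).  So the cycle space has dimension (n - 1)(index - 1),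
-- and discarding the faces with middle vertex b ≠ 0 and difference a representative d ≠ 1 leaves a
-- basis of the column space.

open import Defs

open import Data.Nat as ℕ using (ℕ; zero; suc)
import Data.Nat.Properties as ℕ
import Data.Nat.DivMod as ℕ
import Data.Nat.Divisibility as ℕ
open import Data.Nat.GCD using (module Bézout)
open import Data.Nat.Coprimality using (coprime-Bézout; prime⇒coprime)
open import Data.Nat.Primality using (Prime; prime⇒irreducible; euclidsLemma; ¬prime[0]; ¬prime[1])
import Data.Integer as ℤ
open import Data.Integer.Properties as ℤ using (pos-+; pos-*)
open import Data.Integer.DivMod using (n%ℕd<d; a≡a%ℕn+[a/ℕn]*n)
open import Data.Integer.Divisibility.Signed
  using (_∣_; divides; ∣ᵤ⇒∣; ∣⇒∣ᵤ; _∣?_; ∣m∣n⇒∣m+n; ∣n⇒∣m*n)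
open import Data.Integer.Tactic.RingSolver using (solve-∀)
import Data.Rational as ℚ
import Data.Rational.Properties as ℚ
open import Data.Rational.Solver using (module +-*-Solver)
open +-*-Solver using (solve; _:+_; _:*_; :-_; _:-_; _:=_; con)
import Algebra.Properties.Group ℚ.+-0-group as ℚ-group
open import Data.Fin as Fin using (Fin; toℕ; fromℕ<; punchOut; _<_)
open import Data.Fin.Properties as Fin using (toℕ<n; toℕ-fromℕ<; toℕ-injective; punchOut-injective; pigeonhole)
open import Data.Fin.Induction using (<-wellFounded)
open import Induction.WellFounded using (Acc; acc)
open import Data.List
  using (List; []; _∷_; _++_; map; length; filter; tabulate; allFin; cartesianProduct)
open import Data.List.Properties using (length-++; length-map; length-tabulate; filter-accept; filter-reject)
open import Data.List.Membership.Propositional using (_∈_; _∉_)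
open import Data.List.Membership.Propositional.Properties
  using (∈-++⁺ˡ; ∈-++⁺ʳ; ∈-++⁻; ∈-map⁺; ∈-map⁻; ∈-filter⁺; ∈-filter⁻;
         ∈-cartesianProduct⁺; ∈-cartesianProduct⁻; ∈-allFin; ∈-tabulate⁺; ∈-tabulate⁻)
open import Data.List.Membership.Propositional.Properties.WithK using (unique∧set⇒bag)
import Data.List.Membership.DecPropositional as DecMembership
open import Data.List.Relation.Unary.Any using (here; there)
open import Data.List.Relation.Unary.All as All using (All; []; _∷_)
import Data.List.Relation.Unary.All.Properties as All
open import Data.List.Relation.Unary.AllPairs using ([]; _∷_)
open import Data.List.Relation.Unary.Unique.Propositional using (Unique)
import Data.List.Relation.Unary.Unique.Propositional.Properties as Unique
open import Data.List.Relation.Binary.BagAndSetEquality using (∼bag⇒↭)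
open import Data.List.Relation.Binary.Permutation.Propositional.Properties using (↭-length)
open import Data.Product using (Σ; ∃; _×_; _,_; proj₁; proj₂)
open import Data.Product.Properties using (≡-dec)
open import Data.Sum using (_⊎_; inj₁; inj₂; [_,_]′)
open import Data.Sum.Properties using (inj₁-injective; inj₂-injective) renaming (≡-dec to ⊎-≡-dec)
open import Function using (_∘_)
open import Function.Bundles using (_⇔_; mk⇔)
open import Relation.Nullary using (¬_; Dec; yes; no; contradiction; ¬?)
open import Relation.Nullary.Decidable using (map′; _×-dec_; does-≡)
open import Relation.Binary.Definitions using (DecidableEquality; tri<; tri≈; tri>)
open import Relation.Binary.PropositionalEquality
open ≡-Reasoning

-- Faces are stored sorted by `toℕ`, an order that has nothing to do with arithmetic modulo `n`.
-- Coefficients are therefore extended to alternating functions of three vertices: sorting then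
-- costs only a sign, and a progression can be evaluated at its middle term in whatever order its
-- vertices are stored. The rank is the largest length of an acyclic list, and its two bounds come
-- from the two halves of the overview. The explicit cycles, each nonzero at its own pivot face and
-- zero at the other pivots, bound every acyclic list by counting unknowns and equations. The faces
-- that are not pivots attain the bound because a cycle avoiding all pivots is 0. The cycle attached
-- to `(b₀ , d₀)` takes, at difference `d₀`, the value `2n` at `b₀` and `-2n` at 0. The middle
-- vertex 0 thus absorbs the condition of total 0, and `b₀` runs over the nonzero vertices. Both 2
-- and 3 have to be invertible: 2 for the midpoint of an edge, 3 for a triple to have at most one
-- middle term. Hence the general argument assumes `n` greater than 3.

module _ where

  open import Data.Rational using (ℚ; 0ℚ; 1ℚ; _+_; _*_; -_; _-_; 1/_; ≢-nonZero)

  -- Finite sums and linear systems over ℚ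

  module _ {A : Set} where

    sum-cong : ∀ {f g : A → ℚ} xs → (∀ {x} → x ∈ xs → f x ≡ g x) →
               sumList xs f ≡ sumList xs g
    sum-cong []       eq = refl
    sum-cong (x ∷ xs) eq = cong₂ _+_ (eq (here refl)) (sum-cong xs (λ p → eq (there p)))

    sum-zero : ∀ {f : A → ℚ} xs → (∀ {x} → x ∈ xs → f x ≡ 0ℚ) → sumList xs f ≡ 0ℚ
    sum-zero []       eq = refl
    sum-zero (x ∷ xs) eq =
      trans (cong₂ _+_ (eq (here refl)) (sum-zero xs (λ p → eq (there p)))) (ℚ.+-identityˡ 0ℚ)

    sum-+ : ∀ (f g : A → ℚ) xs →
            sumList xs (λ x → f x + g x) ≡ sumList xs f + sumList xs g
    sum-+ f g []       = refl
    sum-+ f g (x ∷ xs) = trans (cong (f x + g x +_) (sum-+ f g xs))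
      (solve 4 (λ a b c d → (a :+ b) :+ (c :+ d) := (a :+ c) :+ (b :+ d)) refl
        (f x) (g x) (sumList xs f) (sumList xs g))

    sum-*ˡ : ∀ a (f : A → ℚ) xs → sumList xs (λ x → a * f x) ≡ a * sumList xs f
    sum-*ˡ a f []       = sym (ℚ.*-zeroʳ a)
    sum-*ˡ a f (x ∷ xs) =
      trans (cong (a * f x +_) (sum-*ˡ a f xs)) (sym (ℚ.*-distribˡ-+ a (f x) _))

    sum-linear : ∀ a b (f g : A → ℚ) xs →
      sumList xs (λ x → a * f x + b * g x) ≡ a * sumList xs f + b * sumList xs g
    sum-linear a b f g xs = trans (sum-+ (λ x → a * f x) (λ x → b * g x) xs)
      (cong₂ _+_ (sum-*ˡ a f xs) (sum-*ˡ b g xs))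

    sum-neg : ∀ (f : A → ℚ) xs → sumList xs (λ x → - f x) ≡ - sumList xs f
    sum-neg f []       = refl
    sum-neg f (x ∷ xs) = trans (cong (- f x +_) (sum-neg f xs)) (sym (ℚ.neg-distrib-+ (f x) _))

    sum-−+ : ∀ (f g h : A → ℚ) xs →
      sumList xs (λ x → f x - g x + h x) ≡ sumList xs f - sumList xs g + sumList xs h
    sum-−+ f g h xs = trans (sum-+ (λ x → f x - g x) h xs) (cong (_+ sumList xs h)
      (trans (sum-+ f (λ x → - g x) xs) (cong (sumList xs f +_) (sum-neg g xs))))

    sum-++ : ∀ (f : A → ℚ) xs ys → sumList (xs ++ ys) f ≡ sumList xs f + sumList ys f
    sum-++ f []       ys = sym (ℚ.+-identityˡ _)
    sum-++ f (x ∷ xs) ys = trans (cong (f x +_) (sum-++ f xs ys)) (sym (ℚ.+-assoc (f x) _ _))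

    sum-map : ∀ {B : Set} (h : B → A) (f : A → ℚ) xs →
              sumList (map h xs) f ≡ sumList xs (λ x → f (h x))
    sum-map h f []       = refl
    sum-map h f (x ∷ xs) = cong (f (h x) +_) (sum-map h f xs)

    sum-single : ∀ {f : A → ℚ} {xs a} → Unique xs → a ∈ xs →
                 (∀ {x} → x ∈ xs → x ≢ a → f x ≡ 0ℚ) → sumList xs f ≡ f a
    sum-single {f} {_ ∷ xs} (x∉ ∷ _) (here refl) off =
      trans (cong (f _ +_) (sum-zero xs λ p → off (there p) λ eq → All.lookup x∉ p (sym eq)))
            (ℚ.+-identityʳ _)
    sum-single {f} {x ∷ xs} (x∉ ∷ u) (there q) off =
      trans (cong₂ _+_ (off (here refl) (All.lookup x∉ q)) (sum-single u q (λ p → off (there p))))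
            (ℚ.+-identityˡ _)

  sum-swap : ∀ {A B : Set} (f : A → B → ℚ) xs ys →
             sumList xs (λ x → sumList ys (f x)) ≡ sumList ys (λ y → sumList xs (λ x → f x y))
  sum-swap f []       ys = sym (sum-zero ys (λ _ → refl))
  sum-swap f (x ∷ xs) ys =
    trans (cong (sumList ys (f x) +_) (sum-swap f xs ys)) (sym (sum-+ (f x) _ ys))

  𝟙 : ∀ {P : Set} → Dec P → ℚ
  𝟙 (yes _) = 1ℚ
  𝟙 (no  _) = 0ℚ

  𝟙-yes : ∀ {P : Set} (d : Dec P) → P → 𝟙 d ≡ 1ℚ
  𝟙-yes (yes _) p = refl
  𝟙-yes (no ¬p) p = contradiction p ¬p

  𝟙-no : ∀ {P : Set} (d : Dec P) → ¬ P → 𝟙 d ≡ 0ℚ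
  𝟙-no (yes p) ¬p = contradiction p ¬p
  𝟙-no (no _)  ¬p = refl

  *-≢0 : ∀ {p q} → p ≢ 0ℚ → q ≢ 0ℚ → p * q ≢ 0ℚ
  *-≢0 {p} {q} p≢0 q≢0 eq = q≢0 (begin
    q              ≡⟨ sym (ℚ.*-identityˡ q) ⟩
    1ℚ * q         ≡⟨ cong (_* q) (sym (ℚ.*-inverseˡ p)) ⟩
    1/ p * p * q   ≡⟨ ℚ.*-assoc (1/ p) p q ⟩
    1/ p * (p * q) ≡⟨ cong (1/ p *_) eq ⟩
    1/ p * 0ℚ      ≡⟨ ℚ.*-zeroʳ (1/ p) ⟩
    0ℚ             ∎)
    where instance _ = ≢-nonZero p≢0

  x*y≡0⇒y≡0 : ∀ {p q} → p ≢ 0ℚ → p * q ≡ 0ℚ → q ≡ 0ℚ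
  x*y≡0⇒y≡0 {p} {q} p≢0 eq with q ℚ.≟ 0ℚ
  ... | yes q≡0 = q≡0
  ... | no  q≢0 = contradiction eq (*-≢0 p≢0 q≢0)

  module _ {U : Set} (_≟_ : DecidableEquality U) where

    -- The last component carries proofs about the chosen equation and the remaining ones back to
    -- the original list, so that the position of the chosen one need not be recorded.
    pivot : ∀ (u : U) (es : List (U → ℚ)) →
      All (λ e → e u ≡ 0ℚ) es ⊎
      (Σ (U → ℚ) λ e → Σ (List (U → ℚ)) λ es′ →
         e u ≢ 0ℚ × length es ≡ suc (length es′) ×
         (∀ {P : (U → ℚ) → Set} → P e → All P es′ → All P es))
    pivot u [] = inj₁ []
    pivot u (e ∷ es) with e u ℚ.≟ 0ℚ
    ... | no  eu≢0 = inj₂ (e , es , eu≢0 , refl , _∷_)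
    ... | yes eu≡0 with pivot u es
    ...   | inj₁ all0 = inj₁ (eu≡0 ∷ all0)
    ...   | inj₂ (e′ , es′ , ne , len , build) =
      inj₂ (e′ , e ∷ es′ , ne , cong suc len , λ { p (q ∷ qs) → q ∷ build p qs })

    update : U → ℚ → (U → ℚ) → U → ℚ
    update u a x v with v ≟ u
    ... | yes _ = a
    ... | no  _ = x v

    update-≡ : ∀ u a x → update u a x u ≡ a
    update-≡ u a x with u ≟ u
    ... | yes _ = refl
    ... | no ne = contradiction refl ne

    update-≢ : ∀ u a x {v} → v ≢ u → update u a x v ≡ x v
    update-≢ u a x {v} ne with v ≟ u
    ... | yes eq = contradiction eq ne
    ... | no  _  = refl

    sum-update : ∀ u a x (e : U → ℚ) us → All (u ≢_) us →
      sumList (u ∷ us) (λ v → update u a x v * e v) ≡ a * e u + sumList us (λ v → x v * e v)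
    sum-update u a x e us u∉ =
      cong₂ _+_ (cong (_* e u) (update-≡ u a x))
        (sum-cong us λ p → cong (_* e _) (update-≢ u a x λ eq → All.lookup u∉ p (sym eq)))

    -- Fraction-free Gaussian elimination of the first unknown.
    homogeneous : ∀ us → Unique us → (es : List (U → ℚ)) → length es ℕ.< length us →
      Σ (U → ℚ) λ x →
        All (λ e → sumList us (λ v → x v * e v) ≡ 0ℚ) es × ∃ λ u → u ∈ us × x u ≢ 0ℚ
    homogeneous (u ∷ us) (u∉ ∷ uniq) es lt with pivot u es
    ... | inj₁ all0 =
          update u 1ℚ (λ _ → 0ℚ)
        , All.map (λ {e} eu≡0 → begin
            _ ≡⟨ sum-update u 1ℚ (λ _ → 0ℚ) e us u∉ ⟩
            1ℚ * e u + sumList us (λ v → 0ℚ * e v)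
              ≡⟨ cong₂ _+_ (cong (1ℚ *_) eu≡0) (sum-zero us (λ {v} _ → ℚ.*-zeroˡ (e v))) ⟩
            0ℚ ∎) all0
        , u , here refl , λ eq → contradiction (trans (sym (update-≡ u 1ℚ (λ _ → 0ℚ))) eq) λ ()
    ... | inj₂ (e₀ , es′ , a≢0 , len , build) = x
        , build row₀ (rows es′ sol)
        , w , there w∈ , λ eq → *-≢0 a≢0 xw≢0
            (trans (sym (update-≢ u _ _ (λ w≡u → All.lookup u∉ w∈ (sym w≡u)))) eq)
      where
      a = e₀ u
      eliminate : (U → ℚ) → U → ℚ
      eliminate e v = a * e v - e u * e₀ v
      rec = homogeneous us uniq (map eliminate es′)
        (subst (ℕ._< length us) (sym (length-map eliminate es′))
          (ℕ.≤-pred (subst (ℕ._< suc (length us)) len lt)))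
      x′ = proj₁ rec
      sol = proj₁ (proj₂ rec)
      w = proj₁ (proj₂ (proj₂ rec))
      w∈ = proj₁ (proj₂ (proj₂ (proj₂ rec)))
      xw≢0 = proj₂ (proj₂ (proj₂ (proj₂ rec)))
      s₀ = sumList us (λ v → x′ v * e₀ v)
      -- Scaling the smaller solution by `a` clears the denominator; row `e₀` then forces the value
      -- `- s₀` at `u`, and every other row becomes its eliminated version.
      x = update u (- s₀) (λ v → a * x′ v)
      eval : ∀ e → sumList (u ∷ us) (λ v → x v * e v) ≡
                   - s₀ * e u + a * sumList us (λ v → x′ v * e v)
      eval e = trans (sum-update u (- s₀) _ e us u∉) (cong (- s₀ * e u +_)
        (trans (sum-cong us (λ {v} _ → ℚ.*-assoc a (x′ v) (e v))) (sum-*ˡ a _ us)))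
      row₀ : sumList (u ∷ us) (λ v → x v * e₀ v) ≡ 0ℚ
      row₀ = trans (eval e₀) (solve 2 (λ s a → :- s :* a :+ a :* s := con 0ℚ) refl s₀ a)
      eval-eliminate : ∀ e → sumList us (λ v → x′ v * eliminate e v) ≡
                             - s₀ * e u + a * sumList us (λ v → x′ v * e v)
      eval-eliminate e = begin
        sumList us (λ v → x′ v * eliminate e v)
          ≡⟨ sum-cong us (λ {v} _ → solve 5 (λ X a E b E₀ →
               X :* (a :* E :- b :* E₀) := (:- b) :* (X :* E₀) :+ a :* (X :* E)) refl
               (x′ v) a (e v) (e u) (e₀ v)) ⟩
        sumList us (λ v → - e u * (x′ v * e₀ v) + a * (x′ v * e v))
          ≡⟨ sum-linear (- e u) a (λ v → x′ v * e₀ v) (λ v → x′ v * e v) us ⟩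
        - e u * s₀ + a * s₁
          ≡⟨ cong (_+ a * s₁) (solve 2 (λ b s → (:- b) :* s := (:- s) :* b) refl (e u) s₀) ⟩
        - s₀ * e u + a * s₁ ∎
        where s₁ = sumList us (λ v → x′ v * e v)
      rows : ∀ es → All (λ e → sumList us (λ v → x′ v * e v) ≡ 0ℚ) (map eliminate es) →
             All (λ e → sumList (u ∷ us) (λ v → x v * e v) ≡ 0ℚ) es
      rows []       []       = []
      rows (e ∷ es) (p ∷ ps) = trans (eval e) (trans (sym (eval-eliminate e)) p) ∷ rows es ps

  -- Chains as alternating functions

  x≡-x⇒x≡0 : ∀ q → q ≡ - q → q ≡ 0ℚ
  x≡-x⇒x≡0 q eq = x*y≡0⇒y≡0 {1ℚ + 1ℚ} (λ ()) (begin
    (1ℚ + 1ℚ) * q ≡⟨ solve 1 (λ q → (con 1ℚ :+ con 1ℚ) :* q := q :+ q) refl q ⟩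
    q + q         ≡⟨ cong (q +_) eq ⟩
    q + - q       ≡⟨ ℚ.+-inverseʳ q ⟩
    0ℚ            ∎)

  𝟙-cong : ∀ {P Q : Set} (d : Dec P) (e : Dec Q) → (P → Q) → (Q → P) → 𝟙 d ≡ 𝟙 e
  𝟙-cong (yes p) e f g = sym (𝟙-yes e (f p))
  𝟙-cong (no ¬p) e f g = sym (𝟙-no e (λ q → ¬p (g q)))

  module Chains (n : ℕ) where

    open import Data.Fin using (_≟_)

    _≟ₜ_ : DecidableEquality (Triple n)
    _≟ₜ_ = ≡-dec _≟_ (≡-dec _≟_ _≟_)

    Sorted : Triple n → Set
    Sorted (i , j , k) = i < j × j < k

    Function₃ : Set
    Function₃ = Fin n → Fin n → Fin n → ℚ

    abstract
      vertices : List (Fin n)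
      vertices = allFin n

      vertices-unique : Unique vertices
      vertices-unique = Unique.allFin⁺ n

      ∈-vertices : ∀ x → x ∈ vertices
      ∈-vertices = ∈-allFin

    Σ[_] : (Fin n → ℚ) → ℚ
    Σ[ f ] = sumList vertices f

    Σ-single : ∀ {f} a → (∀ x → x ≢ a → f x ≡ 0ℚ) → Σ[ f ] ≡ f a
    Σ-single a off = sum-single vertices-unique (∈-vertices a) (λ {x} _ → off x)

    -- The three edges of a sorted triple are distinct, so the order of the tests in `∂₂` is
    -- immaterial and the cascade is a signed sum of indicators. The decisions are arguments so that
    -- any decision procedures can stand in for those inside `∂₂`.
    ∂₂-sorted : ∀ {i j k} → Sorted (i , j , k) → ∀ u v →
      (a : Dec (u ≡ j × v ≡ k)) (b : Dec (u ≡ i × v ≡ k)) (c : Dec (u ≡ i × v ≡ j)) →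
      ∂₂ (i , j , k) u v ≡ 𝟙 a - 𝟙 b + 𝟙 c
    ∂₂-sorted {i} {j} {k} (i<j , j<k) u v a b c
      rewrite does-≡ ((u ≟ j) ×-dec (v ≟ k)) a
            | does-≡ ((u ≟ i) ×-dec (v ≟ k)) b
            | does-≡ ((u ≟ i) ×-dec (v ≟ j)) c
      with a | b | c
    ... | yes (refl , refl) | yes (refl , _) | _ = contradiction i<j (Fin.<-irrefl refl)
    ... | yes (refl , refl) | _ | yes (_ , refl) = contradiction j<k (Fin.<-irrefl refl)
    ... | yes _ | no _ | no _ = refl
    ... | no _ | yes (_ , refl) | yes (_ , refl) = contradiction j<k (Fin.<-irrefl refl)
    ... | no _ | yes _ | no _  = refl
    ... | no _ | no _  | yes _ = refl
    ... | no _ | no _  | no _  = refl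

    δ : Triple n → Triple n → ℚ
    δ s t = 𝟙 (s ≟ₜ t)

    boundaryTerm : (Triple n → ℚ) → Fin n → Fin n → Fin n → ℚ
    boundaryTerm g u v w = g (w , u , v) - g (u , w , v) + g (u , v , w)

    -- The third vertex `w` of a face containing the edge `(u , v)` comes before, between or after
    -- its ends, with signs +, -, +. For each position only one `w` can give `s` itself.
    ∂₂-sum : ∀ {s} → Sorted s → ∀ u v →
      ∂₂ s u v ≡ Σ[ boundaryTerm (δ s) u v ]
    ∂₂-sum {s@(i , j , k)} i<j<k u v = sym (begin
      Σ[ (λ w → δ s (w , u , v) - δ s (u , w , v) + δ s (u , v , w)) ]
        ≡⟨ sum-−+ (λ w → δ s (w , u , v)) (λ w → δ s (u , w , v)) (λ w → δ s (u , v , w)) vertices ⟩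
      Σ[ (λ w → δ s (w , u , v)) ] - Σ[ (λ w → δ s (u , w , v)) ]
        + Σ[ (λ w → δ s (u , v , w)) ]
        ≡⟨ cong₂ _+_ (cong₂ _-_
             (Σ-single i λ w w≢i → 𝟙-no (s ≟ₜ (w , u , v)) λ { refl → w≢i refl })
             (Σ-single j λ w w≢j → 𝟙-no (s ≟ₜ (u , w , v)) λ { refl → w≢j refl }))
             (Σ-single k λ w w≢k → 𝟙-no (s ≟ₜ (u , v , w)) λ { refl → w≢k refl }) ⟩
      δ s (i , u , v) - δ s (u , j , v) + δ s (u , v , k)
        ≡⟨ cong₂ _+_ (cong₂ _-_
             (𝟙-cong (s ≟ₜ (i , u , v)) a (λ { refl → refl , refl }) (λ { (refl , refl) → refl }))
             (𝟙-cong (s ≟ₜ (u , j , v)) b (λ { refl → refl , refl }) (λ { (refl , refl) → refl })))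
             (𝟙-cong (s ≟ₜ (u , v , k)) c (λ { refl → refl , refl }) (λ { (refl , refl) → refl })) ⟩
      𝟙 a - 𝟙 b + 𝟙 c
        ≡⟨ sym (∂₂-sorted i<j<k u v a b c) ⟩
      ∂₂ s u v ∎)
      where
      a = (u ≟ j) ×-dec (v ≟ k)
      b = (u ≟ i) ×-dec (v ≟ k)
      c = (u ≟ i) ×-dec (v ≟ j)

    boundary : List (Triple n) → (Triple n → ℚ) → Fin n → Fin n → ℚ
    boundary S c u v = sumList S (λ t → c t * ∂₂ t u v)

    -- The restriction of `c` to a repetition-free `S`, extended by 0. Written as a sum over `S`, it
    -- can be exchanged with the sum over third vertices.
    coef : List (Triple n) → (Triple n → ℚ) → Triple n → ℚ
    coef S c t = sumList S (λ s → c s * δ s t)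

    coef-∈ : ∀ {S c t} → Unique S → t ∈ S → coef S c t ≡ c t
    coef-∈ {S} {c} {t} u t∈ = trans
      (sum-single {f = λ s → c s * δ s t} u t∈ λ {s} _ s≢t → trans (cong (c s *_) (𝟙-no (s ≟ₜ t) s≢t)) (ℚ.*-zeroʳ (c s)))
      (trans (cong (c t *_) (𝟙-yes (t ≟ₜ t) refl)) (ℚ.*-identityʳ (c t)))

    coef-∉ : ∀ {S c t} → t ∉ S → coef S c t ≡ 0ℚ
    coef-∉ {S} {c} {t} t∉ = sum-zero S λ {s} s∈ →
      trans (cong (c s *_) (𝟙-no (s ≟ₜ t) λ { refl → t∉ s∈ })) (ℚ.*-zeroʳ (c s))

    boundary-coef : ∀ {S} → All Sorted S → ∀ c u v →
      boundary S c u v ≡ Σ[ boundaryTerm (coef S c) u v ]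
    boundary-coef {S} sorted c u v = begin
      sumList S (λ s → c s * ∂₂ s u v)
        ≡⟨ sum-cong S (λ {s} s∈ → trans (cong (c s *_) (∂₂-sum (All.lookup sorted s∈) u v))
                                        (sym (sum-*ˡ (c s) (boundaryTerm (δ s) u v) vertices))) ⟩
      sumList S (λ s → Σ[ (λ w → c s * boundaryTerm (δ s) u v w) ])
        ≡⟨ sum-swap (λ s w → c s * boundaryTerm (δ s) u v w) S vertices ⟩
      Σ[ (λ w → sumList S (λ s → c s * boundaryTerm (δ s) u v w)) ]
        ≡⟨ sum-cong vertices (λ {w} _ → distribute w) ⟩
      Σ[ boundaryTerm (coef S c) u v ] ∎
      where
      distribute : ∀ w → sumList S (λ s → c s * boundaryTerm (δ s) u v w) ≡
                         boundaryTerm (coef S c) u v w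
      distribute w = begin
        sumList S (λ s → c s * boundaryTerm (δ s) u v w)
          ≡⟨ sum-cong S (λ {s} _ → solve 4 (λ c x y z → c :* (x :- y :+ z) := c :* x :+ :- (c :* y) :+ c :* z)
               refl (c s) (δ s (w , u , v)) (δ s (u , w , v)) (δ s (u , v , w))) ⟩
        sumList S (λ s → α s + - β s + γ s)
          ≡⟨ sum-−+ α β γ S ⟩
        boundaryTerm (coef S c) u v w ∎
        where
        α β γ : Triple n → ℚ
        α s = c s * δ s (w , u , v)
        β s = c s * δ s (u , w , v)
        γ s = c s * δ s (u , v , w)

    record Alternating (c : Function₃) : Set where
      field
        rotate : ∀ x y z → c y z x ≡ c x y z
        swap   : ∀ x y z → c y x z ≡ - c x y z

      reverse : ∀ x y z → c z y x ≡ - c x y z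
      reverse x y z = trans (swap y z x) (cong -_ (rotate x y z))

      degenerate : ∀ x z → c x x z ≡ 0ℚ
      degenerate x z = x≡-x⇒x≡0 (c x x z) (swap x x z)

    -- The moves that sort a triple are kept as data because two things are transported along them:
    -- the sign of an alternating function, and the property of being a progression.
    data _↝_ (s : Triple n) : Triple n → Set where
      done : s ↝ s
      rot  : ∀ {x y z} → s ↝ (x , y , z) → s ↝ (y , z , x)
      swp  : ∀ {x y z} → s ↝ (x , y , z) → s ↝ (y , x , z)

    sort : ∀ x y z → x ≢ y → y ≢ z → x ≢ z → ∃ λ t → Sorted t × (x , y , z) ↝ t
    sort x y z x≢y y≢z x≢z with Fin.<-cmp x y | Fin.<-cmp y z | Fin.<-cmp x z
    ... | tri≈ _ x≡y _ | _ | _ = contradiction x≡y x≢y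
    ... | _ | tri≈ _ y≡z _ | _ = contradiction y≡z y≢z
    ... | _ | _ | tri≈ _ x≡z _ = contradiction x≡z x≢z
    ... | tri< x<y _ _ | tri< y<z _ _ | _ = _ , (x<y , y<z) , done
    ... | tri< x<y _ _ | tri> _ _ z<y | tri< x<z _ _ = _ , (x<z , z<y) , rot (swp done)
    ... | tri< x<y _ _ | tri> _ _ z<y | tri> _ _ z<x = _ , (z<x , x<y) , rot (rot done)
    ... | tri> _ _ y<x | tri< y<z _ _ | tri< x<z _ _ = _ , (y<x , x<z) , swp done
    ... | tri> _ _ y<x | tri< y<z _ _ | tri> _ _ z<x = _ , (y<z , z<x) , rot done
    ... | tri> _ _ y<x | tri> _ _ z<y | _ = _ , (z<y , y<x) , swp (rot done)

    -- The sign is chosen before c, so that two chains can be compared after sorting.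
    ↝-sign : ∀ {x y z x′ y′ z′} → (x , y , z) ↝ (x′ , y′ , z′) →
      (∀ {c} → Alternating c → c x′ y′ z′ ≡ c x y z) ⊎
      (∀ {c} → Alternating c → c x′ y′ z′ ≡ - c x y z)
    ↝-sign done = inj₁ λ _ → refl
    ↝-sign (rot p) with ↝-sign p
    ... | inj₁ f = inj₁ λ a → trans (Alternating.rotate a _ _ _) (f a)
    ... | inj₂ f = inj₂ λ a → trans (Alternating.rotate a _ _ _) (f a)
    ↝-sign (swp p) with ↝-sign p
    ... | inj₁ f = inj₂ λ a → trans (Alternating.swap a _ _ _) (cong -_ (f a))
    ... | inj₂ f = inj₁ λ {c} a → trans (Alternating.swap a _ _ _)
          (trans (cong -_ (f a)) (ℚ-group.⁻¹-involutive (c _ _ _)))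

    ↝-zero : ∀ {x y z x′ y′ z′ c} → Alternating c → (x , y , z) ↝ (x′ , y′ , z′) →
             c x′ y′ z′ ≡ 0ℚ → c x y z ≡ 0ℚ
    ↝-zero {c = c} a p eq with ↝-sign p
    ... | inj₁ f = trans (sym (f a)) eq
    ... | inj₂ f = trans (sym (ℚ-group.⁻¹-involutive (c _ _ _))) (cong -_ (trans (sym (f a)) eq))

    -- A repeated vertex forces both functions to be 0. Distinct vertices can be sorted, and the
    -- sign picked up on the way is the same for both functions.
    alternating-ext : ∀ {c c′} → Alternating c → Alternating c′ →
      (∀ x y z → x < y → y < z → c x y z ≡ c′ x y z) → ∀ x y z → c x y z ≡ c′ x y z
    alternating-ext {c} {c′} a a′ eq x y z with x ≟ y | y ≟ z | x ≟ z
    ... | yes refl | _ | _ = trans (Alternating.degenerate a x z) (sym (Alternating.degenerate a′ x z))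
    ... | no _ | yes refl | _ = trans (vanish a) (sym (vanish a′))
      where
      vanish : ∀ {c} → Alternating c → c x y y ≡ 0ℚ
      vanish a = trans (sym (Alternating.rotate a x y y)) (Alternating.degenerate a y x)
    ... | no _ | no _ | yes refl = trans (vanish a) (sym (vanish a′))
      where
      vanish : ∀ {c} → Alternating c → c x y x ≡ 0ℚ
      vanish a = trans (Alternating.rotate a x x y) (Alternating.degenerate a x y)
    ... | no x≢y | no y≢z | no x≢z with sort x y z x≢y y≢z x≢z
    ...   | (i , j , k) , (i<j , j<k) , p with ↝-sign p
    ...     | inj₁ f = trans (sym (f a)) (trans (eq i j k i<j j<k) (f a′))
    ...     | inj₂ f = ℚ.neg-injective (trans (sym (f a)) (trans (eq i j k i<j j<k) (f a′)))

    alt : (Triple n → ℚ) → Function₃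
    alt g x y z = g (x , y , z) + g (y , z , x) + g (z , x , y)
                - (g (y , x , z) + g (x , z , y) + g (z , y , x))

    alt-alternating : ∀ g → Alternating (alt g)
    alt-alternating g = record
      { rotate = λ x y z → solve 6 (λ a b c d e f →
          b :+ c :+ a :- (f :+ d :+ e) := a :+ b :+ c :- (d :+ e :+ f)) refl
          (g (x , y , z)) (g (y , z , x)) (g (z , x , y)) (g (y , x , z)) (g (x , z , y)) (g (z , y , x))
      ; swap = λ x y z → solve 6 (λ a b c d e f →
          d :+ e :+ f :- (a :+ b :+ c) := :- (a :+ b :+ c :- (d :+ e :+ f))) refl
          (g (x , y , z)) (g (y , z , x)) (g (z , x , y)) (g (y , x , z)) (g (x , z , y)) (g (z , y , x))
      }

    alt-boundaryTerm : ∀ g u v w → alt g u v w ≡ boundaryTerm g u v w - boundaryTerm g v u w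
    alt-boundaryTerm g u v w = solve 6 (λ a b c d e f →
        a :+ b :+ c :- (d :+ e :+ f) := (c :- e :+ a) :- (f :- b :+ d)) refl
        (g (u , v , w)) (g (v , w , u)) (g (w , u , v)) (g (v , u , w)) (g (u , w , v)) (g (w , v , u))

    -- The other five orderings of a sorted triple are unsorted, so a single term of `alt` survives.
    alt-sorted : ∀ g → (∀ t → ¬ Sorted t → g t ≡ 0ℚ) →
                 ∀ {i j k} → i < j → j < k → alt g i j k ≡ g (i , j , k)
    alt-sorted g supp {i} {j} {k} i<j j<k
      rewrite supp (j , k , i) (λ (_ , k<i) → Fin.<-asym k<i (Fin.<-trans i<j j<k))
            | supp (k , i , j) (λ (k<i , _) → Fin.<-asym k<i (Fin.<-trans i<j j<k))
            | supp (j , i , k) (λ (j<i , _) → Fin.<-asym j<i i<j)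
            | supp (i , k , j) (λ (_ , k<j) → Fin.<-asym k<j j<k)
            | supp (k , j , i) (λ (k<j , _) → Fin.<-asym k<j j<k) =
      solve 1 (λ x → x :+ con 0ℚ :+ con 0ℚ :- (con 0ℚ :+ con 0ℚ :+ con 0ℚ) := x) refl (g (i , j , k))

    module _ {S : List (Triple n)} (sorted : All Sorted S) (c : Triple n → ℚ) where

      coef-unsorted : ∀ t → ¬ Sorted t → coef S c t ≡ 0ℚ
      coef-unsorted t ¬s = coef-∉ {c = c} (λ t∈ → ¬s (All.lookup sorted t∈))

      -- Of the six terms of `alt`, three form the boundary at `(u , v)` and three that at
      -- `(v , u)`. By `boundary-unsorted` at most one of the two boundaries is nonzero, so cycles
      -- can be recognised on the alternating side.
      alt-boundary : ∀ u v →
        Σ[ alt (coef S c) u v ] ≡ boundary S c u v - boundary S c v u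
      alt-boundary u v = begin
        Σ[ alt (coef S c) u v ]
          ≡⟨ sum-cong vertices (λ {w} _ → alt-boundaryTerm (coef S c) u v w) ⟩
        Σ[ (λ w → boundaryTerm (coef S c) u v w - boundaryTerm (coef S c) v u w) ]
          ≡⟨ trans (sum-+ (boundaryTerm (coef S c) u v) (λ w → - boundaryTerm (coef S c) v u w) vertices)
               (cong (Σ[ boundaryTerm (coef S c) u v ] +_) (sum-neg (boundaryTerm (coef S c) v u) vertices)) ⟩
        Σ[ boundaryTerm (coef S c) u v ] - Σ[ boundaryTerm (coef S c) v u ]
          ≡⟨ sym (cong₂ _-_ (boundary-coef sorted c u v) (boundary-coef sorted c v u)) ⟩
        boundary S c u v - boundary S c v u ∎

      boundary-unsorted : ∀ u v → ¬ (u < v) → boundary S c u v ≡ 0ℚ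
      boundary-unsorted u v u≮v = trans (boundary-coef sorted c u v) (sum-zero vertices λ {w} _ →
        trans (cong₂ _+_ (cong₂ _-_
          (coef-unsorted (w , u , v) λ (_ , u<v) → u≮v u<v)
          (coef-unsorted (u , w , v) λ (u<w , w<v) → u≮v (Fin.<-trans u<w w<v)))
          (coef-unsorted (u , v , w) λ (u<v , _) → u≮v u<v)) refl)

      cycle : (∀ u v → Σ[ alt (coef S c) u v ] ≡ 0ℚ) → ∀ u v → boundary S c u v ≡ 0ℚ
      cycle eq u v with Fin.<-cmp u v
      ... | tri< _ _ u≯v = begin
          boundary S c u v                      ≡⟨ sym (ℚ.+-identityʳ _) ⟩
          boundary S c u v - 0ℚ                 ≡⟨ cong (λ z → boundary S c u v - z) (sym (boundary-unsorted v u u≯v)) ⟩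
          boundary S c u v - boundary S c v u   ≡⟨ sym (alt-boundary u v) ⟩
          Σ[ alt (coef S c) u v ]               ≡⟨ eq u v ⟩
          0ℚ                                    ∎
      ... | tri≈ u≮v _ _ = boundary-unsorted u v u≮v
      ... | tri> u≮v _ _ = boundary-unsorted u v u≮v

      cycle⁻¹ : (∀ u v → boundary S c u v ≡ 0ℚ) → ∀ u v → Σ[ alt (coef S c) u v ] ≡ 0ℚ
      cycle⁻¹ eq u v = trans (alt-boundary u v) (cong₂ _-_ (eq u v) (eq v u))

open import Data.Rational using (ℚ; 0ℚ; 1ℚ)

-- Bounding the size of an independent set by a triangular family of relations

length-cartesianProduct : ∀ {A B : Set} (xs : List A) (ys : List B) →
  length (cartesianProduct xs ys) ≡ length xs ℕ.* length ys
length-cartesianProduct []       ys = refl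
length-cartesianProduct (x ∷ xs) ys =
  trans (length-++ (map (x ,_) ys)) (cong₂ ℕ._+_ (length-map (x ,_) ys) (length-cartesianProduct xs ys))

Unique-map : ∀ {A B : Set} (f : A → B) {xs} → Unique xs →
  (∀ {x y} → x ∈ xs → y ∈ xs → f x ≡ f y → x ≡ y) → Unique (map f xs)
Unique-map f []       inj = []
Unique-map f (x∉ ∷ u) inj =
  All.map⁺ (All.tabulate λ y∈ eq → All.lookup x∉ y∈ (inj (here refl) (there y∈) eq))
  ∷ Unique-map f u (λ p q → inj (there p) (there q))

module Triangular {T Q I : Set} (_≟_ : DecidableEquality T) (_≟ᵠ_ : DecidableEquality Q)
  (column : T → I → ℚ) {faces : List T} (faces-unique : Unique faces)
  {params : List Q} (params-unique : Unique params)
  (pivotOf : Q → T) (pivot∈ : ∀ {p} → p ∈ params → pivotOf p ∈ faces)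
  (ζ : Q → T → ℚ)
  (ζ-cycle : ∀ {p} → p ∈ params → ∀ i → sumList faces (λ s → ζ p s ℚ.* column s i) ≡ 0ℚ)
  (ζ-diagonal : ∀ {p} → p ∈ params → ζ p (pivotOf p) ≢ 0ℚ)
  (ζ-off-diagonal : ∀ {p p′} → p ∈ params → p′ ∈ params → p ≢ p′ → ζ p (pivotOf p′) ≡ 0ℚ)
  where

  -- A longer `S` would give more unknowns, one for each element of `S` and of `params`, than
  -- equations, one for each face. A nontrivial solution makes a combination of `S` equal on every
  -- face to a combination of the cycles `ζ`. Its boundary is 0, so independence kills the
  -- coefficients on `S`; evaluating what is left at the pivot of `p` isolates the coefficient of
  -- `p` and kills it too.
  independent-length : ∀ {S} → Unique S → (∀ {t} → t ∈ S → t ∈ faces) →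
    (∀ c → (∀ i → sumList S (λ t → c t ℚ.* column t i) ≡ 0ℚ) → All (λ t → c t ≡ 0ℚ) S) →
    length S ℕ.+ length params ℕ.≤ length faces
  independent-length {S} S-unique S⊆ independent
    with length S ℕ.+ length params ℕ.≤? length faces
  ... | yes le = le
  ... | no  nle = contradiction xu≡0 xu≢0
    where
    U = T ⊎ Q

    unknowns : List U
    unknowns = map inj₁ S ++ map inj₂ params

    unknowns-unique : Unique unknowns
    unknowns-unique = Unique.++⁺ (Unique.map⁺ inj₁-injective S-unique) (Unique.map⁺ inj₂-injective params-unique)
      λ (p , q) → disjoint (proj₂ (proj₂ (∈-map⁻ inj₁ p))) (proj₂ (proj₂ (∈-map⁻ inj₂ q)))
      where
      disjoint : ∀ {u} {t : T} {p : Q} → u ≡ inj₁ t → ¬ (u ≡ inj₂ p)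
      disjoint refl ()

    equation : T → U → ℚ
    equation s (inj₁ t) = 𝟙 (t ≟ s)
    equation s (inj₂ p) = ζ p s

    fewer : length (map equation faces) ℕ.< length unknowns
    fewer = subst₂ ℕ._<_ (sym (length-map equation faces))
      (sym (trans (length-++ (map inj₁ S)) (cong₂ ℕ._+_ (length-map inj₁ S) (length-map inj₂ params))))
      (ℕ.≰⇒> nle)

    solution = homogeneous (⊎-≡-dec _≟_ _≟ᵠ_) unknowns unknowns-unique (map equation faces) fewer

    x : U → ℚ
    x = proj₁ solution

    onS : T → ℚ
    onS s = sumList S (λ t → x (inj₁ t) ℚ.* 𝟙 (t ≟ s))

    onP : T → ℚ
    onP s = sumList params (λ p → x (inj₂ p) ℚ.* ζ p s)

    solves : ∀ {s} → s ∈ faces → onS s ℚ.+ onP s ≡ 0ℚ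
    solves {s} s∈ = begin
      onS s ℚ.+ onP s
        ≡⟨ sym (cong₂ ℚ._+_ (sum-map inj₁ e S) (sum-map inj₂ e params)) ⟩
      sumList (map inj₁ S) e ℚ.+ sumList (map inj₂ params) e
        ≡⟨ sym (sum-++ e (map inj₁ S) (map inj₂ params)) ⟩
      sumList unknowns e
        ≡⟨ All.lookup (proj₁ (proj₂ solution)) (∈-map⁺ equation s∈) ⟩
      0ℚ ∎
      where
      e : U → ℚ
      e v = x v ℚ.* equation s v

    onS≡ : ∀ {s} → s ∈ faces → onS s ≡ ℚ.- onP s
    onS≡ {s} s∈ = ℚ-group.inverseˡ-unique (onS s) (onP s) (solves s∈)

    closed : ∀ i → sumList S (λ t → x (inj₁ t) ℚ.* column t i) ≡ 0ℚ
    closed i = begin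
      sumList S (λ t → x (inj₁ t) ℚ.* column t i)
        ≡⟨ sum-cong S (λ {t} t∈ → sym (trans
             (sum-single {f = λ s → x (inj₁ t) ℚ.* 𝟙 (t ≟ s) ℚ.* column s i} faces-unique (S⊆ t∈) λ {s} _ s≢t →
               trans (cong (λ d → x (inj₁ t) ℚ.* d ℚ.* column s i) (𝟙-no (t ≟ s) (s≢t ∘ sym)))
                 (solve 2 (λ a b → a :* con 0ℚ :* b := con 0ℚ) refl (x (inj₁ t)) (column s i)))
             (trans (cong (λ d → x (inj₁ t) ℚ.* d ℚ.* column t i) (𝟙-yes (t ≟ t) refl))
               (cong (ℚ._* column t i) (ℚ.*-identityʳ (x (inj₁ t))))))) ⟩
      sumList S (λ t → sumList faces (λ s → x (inj₁ t) ℚ.* 𝟙 (t ≟ s) ℚ.* column s i))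
        ≡⟨ sum-swap (λ t s → x (inj₁ t) ℚ.* 𝟙 (t ≟ s) ℚ.* column s i) S faces ⟩
      sumList faces (λ s → sumList S (λ t → x (inj₁ t) ℚ.* 𝟙 (t ≟ s) ℚ.* column s i))
        ≡⟨ sum-cong faces (λ {s} s∈ → trans (sum-*ʳ (λ t → x (inj₁ t) ℚ.* 𝟙 (t ≟ s)) (column s i) S)
             (trans (cong (ℚ._* column s i) (onS≡ s∈)) (negate s))) ⟩
      sumList faces (λ s → ℚ.- sumList params (λ p → x (inj₂ p) ℚ.* (ζ p s ℚ.* column s i)))
        ≡⟨ trans (sum-neg (λ s → sumList params (λ p → x (inj₂ p) ℚ.* (ζ p s ℚ.* column s i))) faces) (cong ℚ.-_ (sum-swap (λ s p → x (inj₂ p) ℚ.* (ζ p s ℚ.* column s i)) faces params)) ⟩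
      ℚ.- sumList params (λ p → sumList faces (λ s → x (inj₂ p) ℚ.* (ζ p s ℚ.* column s i)))
        ≡⟨ cong ℚ.-_ (sum-zero params (λ {p} p∈ → trans
             (sum-*ˡ (x (inj₂ p)) (λ s → ζ p s ℚ.* column s i) faces)
             (trans (cong (x (inj₂ p) ℚ.*_) (ζ-cycle p∈ i)) (ℚ.*-zeroʳ (x (inj₂ p)))))) ⟩
      0ℚ ∎
      where
      sum-*ʳ : ∀ {A : Set} (f : A → ℚ) a xs → sumList xs (λ y → f y ℚ.* a) ≡ sumList xs f ℚ.* a
      sum-*ʳ f a xs = trans (sum-cong xs (λ {y} _ → ℚ.*-comm (f y) a))
        (trans (sum-*ˡ a f xs) (ℚ.*-comm a (sumList xs f)))
      negate : ∀ s → ℚ.- onP s ℚ.* column s i ≡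
        ℚ.- sumList params (λ p → x (inj₂ p) ℚ.* (ζ p s ℚ.* column s i))
      negate s = trans (sym (ℚ.neg-distribˡ-* (onP s) (column s i)))
        (cong ℚ.-_ (trans (sym (sum-*ʳ (λ p → x (inj₂ p) ℚ.* ζ p s) (column s i) params))
          (sum-cong params λ {p} _ → ℚ.*-assoc (x (inj₂ p)) (ζ p s) (column s i))))

    S-zero : All (λ t → x (inj₁ t) ≡ 0ℚ) S
    S-zero = independent (x ∘ inj₁) closed

    params-zero : ∀ {p} → p ∈ params → x (inj₂ p) ≡ 0ℚ
    params-zero {p} p∈ = x*y≡0⇒y≡0 (ζ-diagonal p∈) (begin
      ζ p s ℚ.* x (inj₂ p)
        ≡⟨ ℚ.*-comm (ζ p s) (x (inj₂ p)) ⟩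
      x (inj₂ p) ℚ.* ζ p s
        ≡⟨ sym (sum-single {f = λ q → x (inj₂ q) ℚ.* ζ q s} params-unique p∈ λ {q} q∈ q≢p →
             trans (cong (x (inj₂ q) ℚ.*_) (ζ-off-diagonal q∈ p∈ q≢p)) (ℚ.*-zeroʳ (x (inj₂ q)))) ⟩
      onP s
        ≡⟨ sym (ℚ.+-identityˡ (onP s)) ⟩
      0ℚ ℚ.+ onP s
        ≡⟨ cong (ℚ._+ onP s) (sym (sum-zero S λ {t} t∈ →
             trans (cong (ℚ._* 𝟙 (t ≟ s)) (All.lookup S-zero t∈)) (ℚ.*-zeroˡ (𝟙 (t ≟ s))))) ⟩
      onS s ℚ.+ onP s
        ≡⟨ solves (pivot∈ p∈) ⟩
      0ℚ ∎)
      where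
      s = pivotOf p

    xu≢0 = proj₂ (proj₂ (proj₂ (proj₂ solution)))

    zeroes : ∀ {u} → u ∈ unknowns → x u ≡ 0ℚ
    zeroes u∈ with ∈-++⁻ (map inj₁ S) u∈
    ... | inj₁ p with ∈-map⁻ inj₁ p
    ...   | t , t∈ , refl = All.lookup S-zero t∈
    zeroes u∈ | inj₂ q with ∈-map⁻ inj₂ q
    ...   | p , p∈ , refl = params-zero p∈

    xu≡0 = zeroes (proj₁ (proj₂ (proj₂ (proj₂ solution))))

  -- The faces that remain when the pivots are removed

  open DecMembership _≟_ using (_∈?_)

  pivots : List T
  pivots = map pivotOf params

  nonpivots : List T
  nonpivots = filter (λ t → ¬? (t ∈? pivots)) faces

  private
    nonpivot? = λ t → ¬? (t ∈? pivots)

  nonpivots-unique : Unique nonpivots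
  nonpivots-unique = Unique.filter⁺ nonpivot? faces-unique

  nonpivots⊆ : ∀ {t} → t ∈ nonpivots → t ∈ faces
  nonpivots⊆ t∈ = proj₁ (∈-filter⁻ nonpivot? {xs = faces} t∈)

  nonpivots-∉ : ∀ {t} → t ∈ nonpivots → t ∉ pivots
  nonpivots-∉ t∈ = proj₂ (∈-filter⁻ nonpivot? {xs = faces} t∈)

  -- If two parameters shared a pivot, the same entry of `ζ` would be both diagonal, hence nonzero,
  -- and off-diagonal, hence zero.
  pivots-unique : Unique pivots
  pivots-unique = Unique-map pivotOf params-unique injective
    where
    injective : ∀ {p q} → p ∈ params → q ∈ params → pivotOf p ≡ pivotOf q → p ≡ q
    injective {p} {q} p∈ q∈ eq with p ≟ᵠ q
    ... | yes p≡q = p≡q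
    ... | no  p≢q = contradiction
      (subst (λ t → ζ p t ≡ 0ℚ) (sym eq) (ζ-off-diagonal p∈ q∈ p≢q)) (ζ-diagonal p∈)

  nonpivots-length : length nonpivots ℕ.+ length params ≡ length faces
  nonpivots-length = begin
    length nonpivots ℕ.+ length params
      ≡⟨ cong (length nonpivots ℕ.+_) (sym (length-map pivotOf params)) ⟩
    length nonpivots ℕ.+ length pivots
      ≡⟨ sym (length-++ nonpivots) ⟩
    length (nonpivots ++ pivots)
      ≡⟨ ↭-length (∼bag⇒↭ (unique∧set⇒bag
           (Unique.++⁺ nonpivots-unique pivots-unique λ (p , q) → nonpivots-∉ p q)
           faces-unique (mk⇔ into from))) ⟩
    length faces ∎
    where
    into : ∀ {t} → t ∈ nonpivots ++ pivots → t ∈ faces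
    into t∈ with ∈-++⁻ nonpivots t∈
    ... | inj₁ p = nonpivots⊆ p
    ... | inj₂ q with ∈-map⁻ pivotOf q
    ...   | p , p∈ , refl = pivot∈ p∈
    from : ∀ {t} → t ∈ faces → t ∈ nonpivots ++ pivots
    from {t} t∈ with t ∈? pivots
    ... | yes p = ∈-++⁺ʳ nonpivots p
    ... | no ¬p = ∈-++⁺ˡ (∈-filter⁺ nonpivot? t∈ ¬p)

module _ where

  open import Data.Integer using (ℤ; +_; -_; _+_; _*_; _-_; ∣_∣; _%ℕ_; _/ℕ_)

  -- Arithmetic modulo a prime

  pow : ℕ → ℤ
  pow k = + (2 ℕ.^ k)

  pow-suc : ∀ k → pow (suc k) ≡ + 2 * pow k
  pow-suc k = pos-* 2 (2 ℕ.^ k)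

  pow-+ : ∀ j k → pow (j ℕ.+ k) ≡ pow j * pow k
  pow-+ j k = trans (cong +_ (ℕ.^-distribˡ-+-* 2 j k)) (pos-* (2 ℕ.^ j) (2 ℕ.^ k))

  parity : ∀ k → (∃ λ q → k ≡ q ℕ.+ q) ⊎ (∃ λ q → k ≡ suc (q ℕ.+ q))
  parity zero = inj₁ (0 , refl)
  parity (suc k) with parity k
  ... | inj₁ (q , eq) = inj₂ (q , cong suc eq)
  ... | inj₂ (q , eq) = inj₁ (suc q , cong suc (trans eq (sym (ℕ.+-suc q q))))

  module Residues (m : ℕ) (pr : Prime (suc (suc m))) (3<n : 3 ℕ.< suc (suc m)) where

    n : ℕ
    n = suc (suc m)

    D : ℤ → Set
    D e = + n ∣ e

    abstract
      D? : ∀ e → Dec (D e)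
      D? e = + n ∣? e

    D-lin : ∀ p {a e} → D a → e ≡ p * a → D e
    D-lin p da refl = ∣n⇒∣m*n p da

    D-lin₂ : ∀ p q {a b e} → D a → D b → e ≡ p * a + q * b → D e
    D-lin₂ p q da db refl = ∣m∣n⇒∣m+n (∣n⇒∣m*n p da) (∣n⇒∣m*n q db)

    D-lin₃ : ∀ p q r {a b c e} → D a → D b → D c → e ≡ p * a + q * b + r * c → D e
    D-lin₃ p q r da db dc refl = ∣m∣n⇒∣m+n (D-lin₂ p q da db refl) (∣n⇒∣m*n r dc)

    D-0 : D (+ 0)
    D-0 = divides (+ 0) refl

    D-prime : ∀ a b → D (a * b) → D a ⊎ D b
    D-prime a b d = [ (λ x → inj₁ (∣ᵤ⇒∣ x)) , (λ x → inj₂ (∣ᵤ⇒∣ x)) ]′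
      (euclidsLemma ∣ a ∣ ∣ b ∣ pr (subst (n ℕ.∣_) (ℤ.abs-* a b) (∣⇒∣ᵤ d)))

    D-cancel : ∀ a {b} → ¬ D a → D (a * b) → D b
    D-cancel a {b} ¬da d = [ (λ da → contradiction da ¬da) , (λ db → db) ]′ (D-prime a b d)

    ¬D-small : ∀ k → suc k ℕ.< n → ¬ D (+ suc k)
    ¬D-small k lt d = ℕ.<⇒≱ lt (ℕ.∣⇒≤ (∣⇒∣ᵤ d))

    ¬D-1 : ¬ D (+ 1)
    ¬D-1 = ¬D-small 0 (ℕ.≤-trans (ℕ.s≤s (ℕ.s≤s ℕ.z≤n)) 3<n)

    ¬D-2 : ¬ D (+ 2)
    ¬D-2 = ¬D-small 1 (ℕ.≤-trans (ℕ.s≤s (ℕ.s≤s (ℕ.s≤s ℕ.z≤n))) 3<n)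

    ¬D-3 : ¬ D (+ 3)
    ¬D-3 = ¬D-small 2 3<n

    abstract
      ρ : ℤ → Fin n
      ρ e = fromℕ< (n%ℕd<d e n)

      ⟦ρ⟧ : ∀ e → D (⟦ ρ e ⟧ - e)
      ⟦ρ⟧ e = divides (- (e /ℕ n)) (begin
        ⟦ ρ e ⟧ - e ≡⟨ cong (λ r → + r - e) (toℕ-fromℕ< (n%ℕd<d e n)) ⟩
        + (e %ℕ n) - e ≡⟨ cong (λ z → + (e %ℕ n) - z) (a≡a%ℕn+[a/ℕn]*n e n) ⟩
        + (e %ℕ n) - (+ (e %ℕ n) + (e /ℕ n) * + n) ≡⟨ lemma (+ (e %ℕ n)) (e /ℕ n) (+ n) ⟩
        - (e /ℕ n) * + n ∎)
        where
        lemma : ∀ r q d → r - (r + q * d) ≡ - q * d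
        lemma = solve-∀

    ⟦⟧-injective : ∀ {x y : Fin n} → D (⟦ x ⟧ - ⟦ y ⟧) → x ≡ y
    ⟦⟧-injective {x} {y} d with ∣ ⟦ x ⟧ - ⟦ y ⟧ ∣ in eq | ∣⇒∣ᵤ d
    ... | zero  | _ =
      toℕ-injective (ℤ.+-injective (ℤ.i-j≡0⇒i≡j ⟦ x ⟧ ⟦ y ⟧ (ℤ.∣i∣≡0⇒i≡0 eq)))
    ... | suc k | n∣ = contradiction (ℕ.∣⇒≤ n∣) (ℕ.<⇒≱ (subst (ℕ._< n) eq small))
      where
      small : ∣ ⟦ x ⟧ - ⟦ y ⟧ ∣ ℕ.< n
      small = ℕ.≤-<-trans
        (subst (λ z → ∣ z ∣ ℕ.≤ toℕ x ℕ.⊔ toℕ y) (sym (ℤ.m-n≡m⊖n (toℕ x) (toℕ y)))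
               (ℤ.∣m⊝n∣≤m⊔n (toℕ x) (toℕ y)))
        (ℕ.⊔-lub (toℕ<n x) (toℕ<n y))

    ρ-cong : ∀ {a b} → D (a - b) → ρ a ≡ ρ b
    ρ-cong {a} {b} d = ⟦⟧-injective
      (subst D (lemma ⟦ ρ a ⟧ ⟦ ρ b ⟧ a b)
        (∣m∣n⇒∣m+n (⟦ρ⟧ a) (D-lin₂ (+ 1) (- + 1) d (⟦ρ⟧ b) refl)))
      where
      lemma : ∀ x y a b → x - a + (+ 1 * (a - b) + (- + 1) * (y - b)) ≡ x - y
      lemma = solve-∀

    ρ-D : ∀ {a b} → ρ a ≡ ρ b → D (a - b)
    ρ-D {a} {b} eq = D-lin₂ (- + 1) (+ 1) (⟦ρ⟧ a) (⟦ρ⟧ b)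
      (trans (lemma a b ⟦ ρ a ⟧) (cong (λ r → (- + 1) * (⟦ ρ a ⟧ - a) + + 1 * (⟦ r ⟧ - b)) eq))
      where
      lemma : ∀ a b x → a - b ≡ (- + 1) * (x - a) + + 1 * (x - b)
      lemma = solve-∀

    ρ-⟦⟧ : ∀ x → ρ ⟦ x ⟧ ≡ x
    ρ-⟦⟧ x = ⟦⟧-injective (⟦ρ⟧ ⟦ x ⟧)

    ρ-≡ : ∀ {a x} → D (a - ⟦ x ⟧) → ρ a ≡ x
    ρ-≡ {a} {x} d = trans (ρ-cong {a} {⟦ x ⟧} d) (ρ-⟦⟧ x)

    D-nonzero : ∀ {x : Fin n} → ¬ D ⟦ x ⟧ → ¬ (toℕ x ≡ 0)
    D-nonzero ¬d eq = ¬d (subst (λ k → D (+ k)) (sym eq) D-0)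

    nonzero-D : ∀ {x : Fin n} → ¬ (toℕ x ≡ 0) → ¬ D ⟦ x ⟧
    nonzero-D {x} ne d with toℕ x in eq
    ... | zero  = ne refl
    ... | suc k = ¬D-small k (subst (ℕ._< n) eq (toℕ<n x)) d

    inverse : ∀ e → ¬ D e → ∃ λ t → D (e * t - + 1)
    inverse e ¬de = step bez
      where
      r = ρ e
      ¬dr : ¬ D ⟦ r ⟧
      ¬dr d = ¬de (D-lin₂ (+ 1) (- + 1) d (⟦ρ⟧ e) (lemma ⟦ r ⟧ e))
        where
        lemma : ∀ x e → e ≡ + 1 * x + (- + 1) * (x - e)
        lemma = solve-∀
      bez = coprime-Bézout (prime⇒coprime pr {{ℕ.≢-nonZero (D-nonzero ¬dr)}} (toℕ<n r))
      lift : ∀ {a b c d} → 1 ℕ.+ a ℕ.* b ≡ c ℕ.* d → + 1 + + a * + b ≡ + c * + d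
      lift {a} {b} {c} {d} eq = begin
        + 1 + + a * + b    ≡⟨ cong (λ z → + 1 + z) (sym (pos-* a b)) ⟩
        + 1 + + (a ℕ.* b)  ≡⟨ sym (pos-+ 1 (a ℕ.* b)) ⟩
        + (1 ℕ.+ a ℕ.* b)  ≡⟨ cong +_ eq ⟩
        + (c ℕ.* d)        ≡⟨ pos-* c d ⟩
        + c * + d          ∎
      D-n : D (+ n)
      D-n = divides (+ 1) (sym (ℤ.*-identityˡ (+ n)))
      step : Bézout.Identity.Identity 1 n (toℕ r) → ∃ λ t → D (e * t - + 1)
      step (Bézout.+- x y eq) = - + y , subst D (sym (begin
          e * - + y - + 1 ≡⟨ lem₁ e (+ y) ⟦ r ⟧ ⟩
          + y * (⟦ r ⟧ - e) + - (+ 1 + + y * ⟦ r ⟧)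
            ≡⟨ cong (λ z → + y * (⟦ r ⟧ - e) + - z) (lift {y} {toℕ r} {x} {n} eq) ⟩
          + y * (⟦ r ⟧ - e) + - (+ x * + n)
            ≡⟨ cong (λ z → + y * (⟦ r ⟧ - e) + z) (ℤ.neg-distribˡ-* (+ x) (+ n)) ⟩
          + y * (⟦ r ⟧ - e) + - + x * + n ∎))
        (∣m∣n⇒∣m+n (∣n⇒∣m*n (+ y) (⟦ρ⟧ e)) (∣n⇒∣m*n (- + x) D-n))
        where
        lem₁ : ∀ e y r → e * - y - + 1 ≡ y * (r - e) + - (+ 1 + y * r)
        lem₁ = solve-∀
      step (Bézout.-+ x y eq) = + y , subst D (sym (begin
          e * + y - + 1 ≡⟨ lem₁ e (+ y) ⟦ r ⟧ ⟩
          - + y * (⟦ r ⟧ - e) + (+ y * ⟦ r ⟧ - + 1)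
            ≡⟨ cong (λ z → - + y * (⟦ r ⟧ - e) + (z - + 1)) (sym (lift {x} {n} {y} {toℕ r} eq)) ⟩
          - + y * (⟦ r ⟧ - e) + (+ 1 + + x * + n - + 1)
            ≡⟨ cong (λ z → - + y * (⟦ r ⟧ - e) + z) (lem₂ (+ x * + n)) ⟩
          - + y * (⟦ r ⟧ - e) + + x * + n ∎))
        (∣m∣n⇒∣m+n (∣n⇒∣m*n (- + y) (⟦ρ⟧ e)) (∣n⇒∣m*n (+ x) D-n))
        where
        lem₁ : ∀ e y r → e * y - + 1 ≡ - y * (r - e) + (y * r - + 1)
        lem₁ = solve-∀
        lem₂ : ∀ z → + 1 + z - + 1 ≡ z
        lem₂ = solve-∀

    ¬D-pow : ∀ k → ¬ D (pow k)
    ¬D-pow zero    = ¬D-1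
    ¬D-pow (suc k) d =
      ¬D-pow k (D-cancel (+ 2) ¬D-2 (subst D (pow-suc k) d))

    -- Pigeonhole on the `n` powers with exponents below `n`: none of them is 0 modulo `n`, so
    -- `punchOut` fits them into `n - 1` values. The bound on the period matters later: exponents
    -- reduced modulo it lie in `Fin n`, as `SameCoset` demands.
    findOrder : ∃ λ p → p ℕ.< suc m × D (pow (suc p) - + 1)
    findOrder = step (pigeonhole (ℕ.n<1+n (suc m)) (λ i → punchOut (nz i)))
      where
      nz : (i : Fin n) → Fin.zero ≢ ρ (pow (toℕ i))
      nz i eq = ¬D-pow (toℕ i) (subst D (ℤ.+-identityʳ _) (ρ-D {pow (toℕ i)} {+ 0} (trans (sym eq) (sym (ρ-⟦⟧ Fin.zero)))))
      step : (∃ λ i → ∃ λ j → i Fin.< j × punchOut (nz i) ≡ punchOut (nz j)) →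
             ∃ λ p → p ℕ.< suc m × D (pow (suc p) - + 1)
      step (i , j , i<j , eq) with ℕ.m≤n⇒∃[o]m+o≡n i<j
      ... | p , e = p , p<  , D-cancel (pow (toℕ i)) (¬D-pow (toℕ i)) (subst D (begin
          pow (toℕ j) - pow (toℕ i) ≡⟨ cong (λ k → pow k - pow (toℕ i)) (sym e′) ⟩
          pow (toℕ i ℕ.+ suc p) - pow (toℕ i) ≡⟨ cong (_- pow (toℕ i)) (pow-+ (toℕ i) (suc p)) ⟩
          pow (toℕ i) * pow (suc p) - pow (toℕ i) ≡⟨ lem (pow (toℕ i)) (pow (suc p)) ⟩
          pow (toℕ i) * (pow (suc p) - + 1) ∎)
          (ρ-D (sym (punchOut-injective (nz i) (nz j) eq))))
        where
        lem : ∀ a b → a * b - a ≡ a * (b - + 1)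
        lem = solve-∀
        e′ : toℕ i ℕ.+ suc p ≡ toℕ j
        e′ = trans (ℕ.+-suc (toℕ i) p) e
        p< : p ℕ.< suc m
        p< = ℕ.≤-pred (ℕ.≤-<-trans (subst (suc p ℕ.≤_) e′ (ℕ.m≤n+m (suc p) (toℕ i))) (toℕ<n j))

    abstract
      order : ∃ λ p → p ℕ.< suc m × D (pow (suc p) - + 1)
      order = findOrder

    odd : ∃ λ q → n ≡ suc (q ℕ.+ q)
    odd with parity n
    ... | inj₂ q = q
    ... | inj₁ (q , eq) with prime⇒irreducible pr {2} (ℕ.divides q (trans eq (double q)))
      where
      double : ∀ q → q ℕ.+ q ≡ q ℕ.* 2
      double q = trans (cong (q ℕ.+_) (sym (ℕ.+-identityʳ q))) (ℕ.*-comm 2 q)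
    ...   | inj₂ refl = contradiction 3<n λ { (ℕ.s≤s (ℕ.s≤s ())) }

    -- Cosets of the subgroup generated by -1 and 2

    infix 4 _~_

    -- `SameCoset` on all integers and with an unbounded exponent, so that exponents can simply be
    -- added. `~⇒SameCoset` recovers the bound by reducing the exponent modulo the period of 2.
    record _~_ (x y : ℤ) : Set where
      constructor via
      field
        exponent : ℕ
        relation : D (y - x * pow exponent) ⊎ D (y - - (x * pow exponent))

    private
      -- With the sign as a factor `σ`, one ring identity serves all combinations of signs.
      Signed : ℤ → ℕ → ℤ → Set
      Signed x k y = ∃ λ σ → (σ ≡ + 1 ⊎ σ ≡ - + 1) × D (y - σ * (x * pow k))

      from : ∀ {x k y} → D (y - x * pow k) ⊎ D (y - - (x * pow k)) → Signed x k y
      from {x} {k} {y} (inj₁ d) = + 1 , inj₁ refl , subst D (lem y (x * pow k)) d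
        where
        lem : ∀ y z → y - z ≡ y - + 1 * z
        lem = solve-∀
      from {x} {k} {y} (inj₂ d) = - + 1 , inj₂ refl , subst D (lem y (x * pow k)) d
        where
        lem : ∀ y z → y - - z ≡ y - - + 1 * z
        lem = solve-∀

      to : ∀ {x k y} → Signed x k y → D (y - x * pow k) ⊎ D (y - - (x * pow k))
      to {x} {k} {y} (_ , inj₁ refl , d) = inj₁ (subst D (lem y (x * pow k)) d)
        where
        lem : ∀ y z → y - + 1 * z ≡ y - z
        lem = solve-∀
      to {x} {k} {y} (_ , inj₂ refl , d) = inj₂ (subst D (lem y (x * pow k)) d)
        where
        lem : ∀ y z → y - - + 1 * z ≡ y - - z
        lem = solve-∀

      sign-* : ∀ {σ τ} → (σ ≡ + 1 ⊎ σ ≡ - + 1) → (τ ≡ + 1 ⊎ τ ≡ - + 1) →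
               σ * τ ≡ + 1 ⊎ σ * τ ≡ - + 1
      sign-* (inj₁ refl) (inj₁ refl) = inj₁ refl
      sign-* (inj₁ refl) (inj₂ refl) = inj₂ refl
      sign-* (inj₂ refl) (inj₁ refl) = inj₂ refl
      sign-* (inj₂ refl) (inj₂ refl) = inj₁ refl

      sign-sq : ∀ {σ} → (σ ≡ + 1 ⊎ σ ≡ - + 1) → σ * σ ≡ + 1
      sign-sq (inj₁ refl) = refl
      sign-sq (inj₂ refl) = refl

    ~-reflexive : ∀ {x y} → D (y - x) → x ~ y
    ~-reflexive {x} {y} d = via 0 (inj₁ (subst D (lem y x) d))
      where
      lem : ∀ y x → y - x ≡ y - x * + 1
      lem = solve-∀

    ~-refl : ∀ {x} → x ~ x
    ~-refl {x} = ~-reflexive (subst D (sym (ℤ.+-inverseʳ x)) D-0)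

    ~-double : ∀ x → x ~ (+ 2) * x
    ~-double x = via 1 (inj₁ (subst D (lem x) D-0))
      where
      lem : ∀ x → + 0 ≡ (+ 2) * x - x * + 2
      lem = solve-∀

    ~-neg : ∀ x → x ~ - x
    ~-neg x = via 0 (inj₂ (subst D (lem x) D-0))
      where
      lem : ∀ x → + 0 ≡ - x - - (x * + 1)
      lem = solve-∀

    ~-trans : ∀ {x y z} → x ~ y → y ~ z → x ~ z
    ~-trans {x} {y} {z} (via j xy) (via k yz) with from {x} {j} {y} xy | from {y} {k} {z} yz
    ... | σ , s , d | τ , t , d′ = via (j ℕ.+ k) (to {x} {j ℕ.+ k} {z} (τ * σ , sign-* t s ,
      D-lin₂ (τ * pow k) (+ 1) d d′
        (trans (cong (λ p → z - τ * σ * (x * p)) (pow-+ j k)) (lem x y z σ τ (pow j) (pow k)))))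
      where
      lem : ∀ x y z σ τ p q →
        z - τ * σ * (x * (p * q)) ≡ τ * q * (y - σ * (x * p)) + + 1 * (z - τ * (y * q))
      lem = solve-∀

    D-pow-order : ∀ k → D (pow (k ℕ.* suc (proj₁ order)) - + 1)
    D-pow-order zero    = D-0
    D-pow-order (suc k) = D-lin₂ (pow (k ℕ.* p)) (+ 1) (proj₂ (proj₂ order)) (D-pow-order k)
      (trans (cong (_- + 1) (pow-+ p (k ℕ.* p))) (lem (pow p) (pow (k ℕ.* p))))
      where
      p = suc (proj₁ order)
      lem : ∀ a b → a * b - + 1 ≡ b * (a - + 1) + + 1 * (b - + 1)
      lem = solve-∀

    -- If `suc p` is a period of 2, then `2^(k * p)` inverts `2^k`, because the product is
    -- `2^(k * suc p)`. The sign is its own inverse.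
    ~-sym : ∀ {x y} → x ~ y → y ~ x
    ~-sym {x} {y} (via k xy) with from {x} {k} {y} xy
    ... | σ , s , d = via (k ℕ.* p) (to {y} {k ℕ.* p} {x} (σ , s ,
      D-lin₂ (- σ * pow (k ℕ.* p)) (- x) d (D-pow-order k) (begin
        x - σ * (y * pow (k ℕ.* p))
          ≡⟨ lem x y σ (pow k) (pow (k ℕ.* p)) ⟩
        - σ * pow (k ℕ.* p) * (y - σ * (x * pow k)) + (x - σ * σ * x * (pow k * pow (k ℕ.* p)))
          ≡⟨ cong₂ (λ s q → - σ * pow (k ℕ.* p) * (y - σ * (x * pow k)) + (x - s * x * q))
               (sign-sq s) (trans (sym (pow-+ k (k ℕ.* p))) (cong pow (sym (ℕ.*-suc k p)))) ⟩
        - σ * pow (k ℕ.* p) * (y - σ * (x * pow k)) + (x - + 1 * x * pow (k ℕ.* suc p))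
          ≡⟨ cong (λ z → - σ * pow (k ℕ.* p) * (y - σ * (x * pow k)) + z) (lem′ x (pow (k ℕ.* suc p))) ⟩
        - σ * pow (k ℕ.* p) * (y - σ * (x * pow k)) + - x * (pow (k ℕ.* suc p) - + 1) ∎)))
      where
      p = proj₁ order
      lem : ∀ x y σ a b →
        x - σ * (y * b) ≡ - σ * b * (y - σ * (x * a)) + (x - σ * σ * x * (a * b))
      lem = solve-∀
      lem′ : ∀ x q → x - + 1 * x * q ≡ - x * (q - + 1)
      lem′ = solve-∀

    ~-D : ∀ {x y} → x ~ y → D y → D x
    ~-D {x} {y} (via k xy) dy with from {x} {k} {y} xy
    ... | σ , s , d = D-cancel (pow k) (¬D-pow k) (D-lin₂ σ (- σ) dy d (begin
        pow k * x                          ≡⟨ cong (pow k *_) (sym (ℤ.*-identityˡ x)) ⟩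
        pow k * (+ 1 * x)                  ≡⟨ cong (λ t → pow k * (t * x)) (sym (sign-sq s)) ⟩
        pow k * (σ * σ * x)                ≡⟨ lem x y σ (pow k) ⟩
        σ * y + - σ * (y - σ * (x * pow k)) ∎))
      where
      lem : ∀ x y σ a → a * (σ * σ * x) ≡ σ * y + - σ * (y - σ * (x * a))
      lem = solve-∀

    SameCoset⇒~ : ∀ {x y} → SameCoset n x y → ⟦ x ⟧ ~ ⟦ y ⟧
    SameCoset⇒~ (k , inj₁ d) = via (toℕ k) (inj₁ (∣ᵤ⇒∣ d))
    SameCoset⇒~ (k , inj₂ d) = via (toℕ k) (inj₂ (∣ᵤ⇒∣ d))

    ~⇒SameCoset : ∀ {x y} → ⟦ x ⟧ ~ ⟦ y ⟧ → SameCoset n x y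
    ~⇒SameCoset {x} {y} (via k xy) with from {⟦ x ⟧} {k} {⟦ y ⟧} xy
    ... | σ , s , d = fromℕ< r<n , [ (λ e → inj₁ (∣⇒∣ᵤ e)) , (λ e → inj₂ (∣⇒∣ᵤ e)) ]′
        (subst (λ r → D (⟦ y ⟧ - ⟦ x ⟧ * pow r) ⊎ D (⟦ y ⟧ - - (⟦ x ⟧ * pow r)))
          (sym (toℕ-fromℕ< r<n))
          (to {⟦ x ⟧} {r} {⟦ y ⟧} (σ , s ,
            D-lin₂ (+ 1) (σ * ⟦ x ⟧ * pow r) d (D-pow-order (k ℕ./ p))
              (trans (lem ⟦ x ⟧ ⟦ y ⟧ σ (pow r) (pow (k ℕ./ p ℕ.* p)))
                (cong (λ q → + 1 * (⟦ y ⟧ - σ * (⟦ x ⟧ * q)) + σ * ⟦ x ⟧ * pow r * (pow (k ℕ./ p ℕ.* p) - + 1))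
                  (trans (sym (pow-+ r (k ℕ./ p ℕ.* p))) (cong pow (sym (ℕ.m≡m%n+[m/n]*n k p)))))))))
      where
      p = suc (proj₁ order)
      r = k ℕ.% p
      r<n : r ℕ.< n
      r<n = ℕ.<-trans (ℕ.m%n<n k p) (ℕ.s≤s (proj₁ (proj₂ order)))
      lem : ∀ x y σ a b →
        y - σ * (x * a) ≡ + 1 * (y - σ * (x * (a * b))) + σ * x * a * (b - + 1)
      lem = solve-∀

  -- Faces as three-term progressions

  module Progressions (m : ℕ) (pr : Prime (suc (suc m))) (3<n : 3 ℕ.< suc (suc m)) where

    open Residues m pr 3<n

    Good : ℤ → Set
    Good d = ¬ D d × ¬ D (d - + 1) × ¬ D (d + + 1)

    Good-cong : ∀ {a b} → D (a - b) → Good a → Good b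
    Good-cong {a} {b} d (a₀ , a₁ , a₂) =
        (λ e → a₀ (D-lin₂ (+ 1) (+ 1) d e (lem₀ a b)))
      , (λ e → a₁ (D-lin₂ (+ 1) (+ 1) d e (lem₁ a b)))
      , (λ e → a₂ (D-lin₂ (+ 1) (+ 1) d e (lem₂ a b)))
      where
      lem₀ : ∀ a b → a ≡ + 1 * (a - b) + + 1 * b
      lem₀ = solve-∀
      lem₁ : ∀ a b → a - + 1 ≡ + 1 * (a - b) + + 1 * (b - + 1)
      lem₁ = solve-∀
      lem₂ : ∀ a b → a + + 1 ≡ + 1 * (a - b) + + 1 * (b + + 1)
      lem₂ = solve-∀

    Good-neg : ∀ {a} → Good a → Good (- a)
    Good-neg {a} (a₀ , a₁ , a₂) =
        (λ e → a₀ (D-lin (- + 1) e (lem₀ a)))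
      , (λ e → a₂ (D-lin (- + 1) e (lem₁ a)))
      , (λ e → a₁ (D-lin (- + 1) e (lem₂ a)))
      where
      lem₀ : ∀ a → a ≡ - + 1 * - a
      lem₀ = solve-∀
      lem₁ : ∀ a → a + + 1 ≡ - + 1 * (- a - + 1)
      lem₁ = solve-∀
      lem₂ : ∀ a → a - + 1 ≡ - + 1 * (- a + + 1)
      lem₂ = solve-∀

    Good⇒GoodDiff : ∀ {d} → Good d → GoodDiff n d
    Good⇒GoodDiff {d} (a₀ , a₁ , a₂) =
      (λ e → a₀ (subst D (lem d) (∣ᵤ⇒∣ e))) , (λ e → a₁ (∣ᵤ⇒∣ e)) , (λ e → a₂ (∣ᵤ⇒∣ e))
      where
      lem : ∀ d → d - + 0 ≡ d
      lem = solve-∀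

    GoodDiff⇒Good : ∀ {d} → GoodDiff n d → Good d
    GoodDiff⇒Good {d} (a₀ , a₁ , a₂) =
      (λ e → a₀ (∣⇒∣ᵤ (subst D (lem d) e))) , (λ e → a₁ (∣⇒∣ᵤ e)) , (λ e → a₂ (∣⇒∣ᵤ e))
      where
      lem : ∀ d → d ≡ d - + 0
      lem = solve-∀

    record Mid (x y z : Fin n) : Set where
      constructor middle
      field
        shape : D (⟦ x ⟧ + ⟦ z ⟧ - + 2 * ⟦ y ⟧)
        good  : Good (⟦ y ⟧ - ⟦ x ⟧)

    Mid-reverse : ∀ {x y z} → Mid x y z → Mid z y x
    Mid-reverse {x} {y} {z} (middle d g) = middle
      (D-lin (+ 1) d (lem ⟦ x ⟧ ⟦ y ⟧ ⟦ z ⟧))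
      (Good-cong (D-lin (+ 1) d (lem′ ⟦ x ⟧ ⟦ y ⟧ ⟦ z ⟧)) (Good-neg g))
      where
      lem : ∀ x y z → z + x - + 2 * y ≡ + 1 * (x + z - + 2 * y)
      lem = solve-∀
      lem′ : ∀ x y z → - (y - x) - (y - z) ≡ + 1 * (x + z - + 2 * y)
      lem′ = solve-∀

    AP3 : Fin n → Fin n → Fin n → Set
    AP3 x y z = Mid x y z ⊎ Mid y z x ⊎ Mid z x y

    AP3-rotate : ∀ {x y z} → AP3 x y z → AP3 y z x
    AP3-rotate (inj₁ p)        = inj₂ (inj₂ p)
    AP3-rotate (inj₂ (inj₁ p)) = inj₁ p
    AP3-rotate (inj₂ (inj₂ p)) = inj₂ (inj₁ p)

    AP3-swap : ∀ {x y z} → AP3 x y z → AP3 y x z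
    AP3-swap (inj₁ p)        = inj₂ (inj₂ (Mid-reverse p))
    AP3-swap (inj₂ (inj₁ p)) = inj₂ (inj₁ (Mid-reverse p))
    AP3-swap (inj₂ (inj₂ p)) = inj₁ (Mid-reverse p)

    -- The two relations differ by `3 (z - y)`, and 3 is invertible because `n` is a prime greater
    -- than 3.
    unique-middle : ∀ {x y z : Fin n} → y ≢ z →
      D (⟦ x ⟧ + ⟦ z ⟧ - + 2 * ⟦ y ⟧) → ¬ D (⟦ y ⟧ + ⟦ x ⟧ - + 2 * ⟦ z ⟧)
    unique-middle {x} {y} {z} y≢z d e = y≢z (sym (⟦⟧-injective (D-cancel (+ 3) ¬D-3
      (D-lin₂ (+ 1) (- + 1) d e (lem ⟦ x ⟧ ⟦ y ⟧ ⟦ z ⟧)))))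
      where
      lem : ∀ x y z → + 3 * (z - y) ≡ + 1 * (x + z - + 2 * y) + - + 1 * (y + x - + 2 * z)
      lem = solve-∀

    mid : ∀ {x y z a d} → Good d → D (⟦ x ⟧ - a) → D (⟦ y ⟧ - (a + d)) →
          D (⟦ z ⟧ - (a + + 2 * d)) → Mid x y z
    mid {x} {y} {z} {a} {d} g dx dy dz = middle
      (D-lin₃ (+ 1) (+ 1) (- + 2) dx dz dy (lem ⟦ x ⟧ ⟦ y ⟧ ⟦ z ⟧ a d))
      (Good-cong (D-lin₂ (+ 1) (- + 1) dx dy (lem′ ⟦ x ⟧ ⟦ y ⟧ a d)) g)
      where
      lem : ∀ x y z a d → x + z - + 2 * y ≡
        + 1 * (x - a) + + 1 * (z - (a + + 2 * d)) + - + 2 * (y - (a + d))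
      lem = solve-∀
      lem′ : ∀ x y a d → d - (y - x) ≡ + 1 * (x - a) + - + 1 * (y - (a + d))
      lem′ = solve-∀

    clash : ∀ {x y : Fin n} p {A : Set} → x ≢ y → D (⟦ x ⟧ - p) → D (⟦ y ⟧ - p) → A
    clash {x} {y} p x≢y dx dy = contradiction
      (⟦⟧-injective (D-lin₂ (+ 1) (- + 1) dx dy (lem ⟦ x ⟧ ⟦ y ⟧ p))) x≢y
      where
      lem : ∀ x y p → x - y ≡ + 1 * (x - p) + - + 1 * (y - p)
      lem = solve-∀

    -- Each vertex coincides with one of the three terms. Two vertices at the same term would be
    -- equal, which leaves the six bijections; `Mid-reverse` handles those that traverse the
    -- progression backwards.
    IsAP⇒AP3 : ∀ {i j k} → i ≢ j → j ≢ k → i ≢ k → IsAP n i j k → AP3 i j k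
    IsAP⇒AP3 {i} {j} {k} i≢j j≢k i≢k (a , d , good , (i∈ , j∈ , k∈) , _) =
      locate (signed i i∈) (signed j j∈) (signed k k∈)
      where
      A = ⟦ a ⟧
      E = ⟦ d ⟧
      g = GoodDiff⇒Good {E} good
      mid′ : ∀ {x y z} → D (⟦ x ⟧ - A) → D (⟦ y ⟧ - (A + E)) → D (⟦ z ⟧ - (A + + 2 * E)) → Mid x y z
      mid′ = mid {a = A} {E} g
      In : Fin n → Set
      In x = D (⟦ x ⟧ - A) ⊎ D (⟦ x ⟧ - (A + E)) ⊎ D (⟦ x ⟧ - (A + + 2 * E))
      signed : ∀ x → Mem3 n ⟦ x ⟧ A (A + E) (A + + 2 * E) → In x
      signed x (inj₁ p)        = inj₁ (∣ᵤ⇒∣ p)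
      signed x (inj₂ (inj₁ p)) = inj₂ (inj₁ (∣ᵤ⇒∣ p))
      signed x (inj₂ (inj₂ p)) = inj₂ (inj₂ (∣ᵤ⇒∣ p))
      locate : In i → In j → In k → AP3 i j k
      locate (inj₁ p) (inj₁ q) _ = clash A i≢j p q
      locate (inj₂ (inj₁ p)) (inj₂ (inj₁ q)) _ = clash (A + E) i≢j p q
      locate (inj₂ (inj₂ p)) (inj₂ (inj₂ q)) _ = clash (A + + 2 * E) i≢j p q
      locate (inj₁ p) _ (inj₁ r) = clash A i≢k p r
      locate (inj₂ (inj₁ p)) _ (inj₂ (inj₁ r)) = clash (A + E) i≢k p r
      locate (inj₂ (inj₂ p)) _ (inj₂ (inj₂ r)) = clash (A + + 2 * E) i≢k p r
      locate _ (inj₁ q) (inj₁ r) = clash A j≢k q r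
      locate _ (inj₂ (inj₁ q)) (inj₂ (inj₁ r)) = clash (A + E) j≢k q r
      locate _ (inj₂ (inj₂ q)) (inj₂ (inj₂ r)) = clash (A + + 2 * E) j≢k q r
      locate (inj₁ p) (inj₂ (inj₁ q)) (inj₂ (inj₂ r)) = inj₁ (mid′ p q r)
      locate (inj₂ (inj₂ p)) (inj₂ (inj₁ q)) (inj₁ r) = inj₁ (Mid-reverse (mid′ r q p))
      locate (inj₁ p) (inj₂ (inj₂ q)) (inj₂ (inj₁ r)) = inj₂ (inj₁ (Mid-reverse (mid′ p r q)))
      locate (inj₂ (inj₂ p)) (inj₁ q) (inj₂ (inj₁ r)) = inj₂ (inj₁ (mid′ q r p))
      locate (inj₂ (inj₁ p)) (inj₁ q) (inj₂ (inj₂ r)) = inj₂ (inj₂ (Mid-reverse (mid′ q p r)))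
      locate (inj₂ (inj₁ p)) (inj₂ (inj₂ q)) (inj₁ r) = inj₂ (inj₂ (mid′ r p q))

    record Progression (x y z : Fin n) : Set where
      field
        start diff : Fin n
        good : GoodDiff n ⟦ diff ⟧
        first  : ⟦ x ⟧ ≡ ⟦ start ⟧ [mod n ]
        second : ⟦ y ⟧ ≡ ⟦ start ⟧ + ⟦ diff ⟧ [mod n ]
        third  : ⟦ z ⟧ ≡ ⟦ start ⟧ + + 2 * ⟦ diff ⟧ [mod n ]

      private
        flip : ∀ {a b} → a ≡ b [mod n ] → b ≡ a [mod n ]
        flip {a} {b} p = ∣⇒∣ᵤ (D-lin (- + 1) (∣ᵤ⇒∣ p) (lem a b))
          where
          lem : ∀ a b → b - a ≡ - + 1 * (a - b)
          lem = solve-∀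

      first′  = flip {⟦ x ⟧} {⟦ start ⟧} first
      second′ = flip {⟦ y ⟧} {⟦ start ⟧ + ⟦ diff ⟧} second
      third′  = flip {⟦ z ⟧} {⟦ start ⟧ + + 2 * ⟦ diff ⟧} third

    Mid⇒Progression : ∀ {x y z} → Mid x y z → Progression x y z
    Mid⇒Progression {x} {y} {z} (middle s g) = record
      { start  = x
      ; diff   = d
      ; good   = Good⇒GoodDiff {⟦ d ⟧} (Good-cong (D-lin (- + 1) dd (lem₀ E (⟦ y ⟧ - ⟦ x ⟧))) g)
      ; first  = ∣⇒∣ᵤ (subst D (lem₁ ⟦ x ⟧) D-0)
      ; second = ∣⇒∣ᵤ (D-lin (- + 1) dd (lem₂ ⟦ x ⟧ ⟦ y ⟧ E))
      ; third  = ∣⇒∣ᵤ (D-lin₂ (- + 2) (+ 1) dd s (lem₃ ⟦ x ⟧ ⟦ y ⟧ ⟦ z ⟧ E))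
      }
      where
      d = ρ (⟦ y ⟧ - ⟦ x ⟧)
      E = ⟦ d ⟧
      dd : D (E - (⟦ y ⟧ - ⟦ x ⟧))
      dd = ⟦ρ⟧ (⟦ y ⟧ - ⟦ x ⟧)
      lem₀ : ∀ e d → d - e ≡ - + 1 * (e - d)
      lem₀ = solve-∀
      lem₁ : ∀ x → + 0 ≡ x - x
      lem₁ = solve-∀
      lem₂ : ∀ x y e → y - (x + e) ≡ - + 1 * (e - (y - x))
      lem₂ = solve-∀
      lem₃ : ∀ x y z e → z - (x + + 2 * e) ≡ - + 2 * (e - (y - x)) + + 1 * (x + z - + 2 * y)
      lem₃ = solve-∀

    AP3⇒IsAP : ∀ {i j k} → AP3 i j k → IsAP n i j k
    AP3⇒IsAP (inj₁ p) = start , diff , good ,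
      (inj₁ first , inj₂ (inj₁ second) , inj₂ (inj₂ third)) ,
      (inj₁ first′ , inj₂ (inj₁ second′) , inj₂ (inj₂ third′))
      where open Progression (Mid⇒Progression p)
    AP3⇒IsAP (inj₂ (inj₁ p)) = start , diff , good ,
      (inj₂ (inj₂ third) , inj₁ first , inj₂ (inj₁ second)) ,
      (inj₂ (inj₁ first′) , inj₂ (inj₂ second′) , inj₁ third′)
      where open Progression (Mid⇒Progression p)
    AP3⇒IsAP (inj₂ (inj₂ p)) = start , diff , good ,
      (inj₂ (inj₁ second) , inj₂ (inj₂ third) , inj₁ first) ,
      (inj₂ (inj₂ first′) , inj₁ second′ , inj₂ (inj₁ third′))
      where open Progression (Mid⇒Progression p)

    IsFace⇒AP3 : ∀ {i j k} → IsFace n (i , j , k) → AP3 i j k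
    IsFace⇒AP3 (i<j , j<k , ap) =
      IsAP⇒AP3 (Fin.<⇒≢ i<j) (Fin.<⇒≢ j<k) (Fin.<⇒≢ (Fin.<-trans i<j j<k)) ap

  -- Chains supported on progressions and their boundary

  module ProgressionChains (m : ℕ) (pr : Prime (suc (suc m))) (3<n : 3 ℕ.< suc (suc m)) where

    open Residues m pr 3<n
    open Progressions m pr 3<n
    open Chains n

    -- F b d is the coefficient of the oriented face (b - d , b , b + d).
    record ProgressionFunction (F : ℤ → ℤ → ℚ) : Set where
      field
        periodic : ∀ {b b′ d d′} → D (b - b′) → D (d - d′) → F b d ≡ F b′ d′
        odd-in-d : ∀ b d → F b (- d) ≡ ℚ.- F b d

    shape : Fin n → Fin n → Fin n → ℤ
    shape x y z = ⟦ x ⟧ + ⟦ z ⟧ - + 2 * ⟦ y ⟧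

    middleTerm : (ℤ → ℤ → ℚ) → Function₃
    middleTerm F x y z = 𝟙 (D? (shape x y z)) ℚ.* F ⟦ y ⟧ (⟦ y ⟧ - ⟦ x ⟧)

    -- Summing over the three candidates for the middle term avoids choosing one, and makes
    -- invariance under rotation immediate. On distinct vertices at most one summand is nonzero, by
    -- `unique-middle`.
    chain : (ℤ → ℤ → ℚ) → Function₃
    chain F x y z = middleTerm F x y z ℚ.+ middleTerm F y z x ℚ.+ middleTerm F z x y

    module _ {F} (pf : ProgressionFunction F) where

      open ProgressionFunction pf

      middleTerm-yes : ∀ x y z → D (shape x y z) → middleTerm F x y z ≡ F ⟦ y ⟧ (⟦ y ⟧ - ⟦ x ⟧)
      middleTerm-yes x y z d = trans
        (cong (ℚ._* F ⟦ y ⟧ (⟦ y ⟧ - ⟦ x ⟧)) (𝟙-yes (D? (shape x y z)) d))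
        (ℚ.*-identityˡ (F ⟦ y ⟧ (⟦ y ⟧ - ⟦ x ⟧)))

      middleTerm-no : ∀ x y z → ¬ D (shape x y z) → middleTerm F x y z ≡ 0ℚ
      middleTerm-no x y z ¬d = trans
        (cong (ℚ._* F ⟦ y ⟧ (⟦ y ⟧ - ⟦ x ⟧)) (𝟙-no (D? (shape x y z)) ¬d))
        (ℚ.*-zeroˡ (F ⟦ y ⟧ (⟦ y ⟧ - ⟦ x ⟧)))

      shape-reverse : ∀ x y z → shape z y x ≡ shape x y z
      shape-reverse x y z = cong (_- + 2 * ⟦ y ⟧) (ℤ.+-comm ⟦ z ⟧ ⟦ x ⟧)

      middleTerm-reverse : ∀ x y z → middleTerm F z y x ≡ ℚ.- middleTerm F x y z
      middleTerm-reverse x y z with D? (shape x y z)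
      ... | yes d = begin
          middleTerm F z y x
            ≡⟨ middleTerm-yes z y x (subst D (sym (shape-reverse x y z)) d) ⟩
          F ⟦ y ⟧ (⟦ y ⟧ - ⟦ z ⟧)
            ≡⟨ periodic (subst D (sym (ℤ.+-inverseʳ ⟦ y ⟧)) D-0) (D-lin (- + 1) d (lem ⟦ x ⟧ ⟦ y ⟧ ⟦ z ⟧)) ⟩
          F ⟦ y ⟧ (- (⟦ y ⟧ - ⟦ x ⟧))
            ≡⟨ odd-in-d ⟦ y ⟧ (⟦ y ⟧ - ⟦ x ⟧) ⟩
          ℚ.- F ⟦ y ⟧ (⟦ y ⟧ - ⟦ x ⟧)
            ≡⟨ cong ℚ.-_ (sym (ℚ.*-identityˡ (F ⟦ y ⟧ (⟦ y ⟧ - ⟦ x ⟧)))) ⟩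
          ℚ.- (1ℚ ℚ.* F ⟦ y ⟧ (⟦ y ⟧ - ⟦ x ⟧)) ∎
        where
        lem : ∀ x y z → y - z - - (y - x) ≡ - + 1 * (x + z - + 2 * y)
        lem = solve-∀
      ... | no ¬d = trans (middleTerm-no z y x (λ d → ¬d (subst D (shape-reverse x y z) d)))
                          (cong ℚ.-_ (sym (ℚ.*-zeroˡ (F ⟦ y ⟧ (⟦ y ⟧ - ⟦ x ⟧)))))

      chain-alternating : Alternating (chain F)
      chain-alternating = record
        { rotate = λ x y z → solve 3 (λ a b c → b :+ c :+ a := a :+ b :+ c) refl
                     (middleTerm F x y z) (middleTerm F y z x) (middleTerm F z x y)
        ; swap = λ x y z → trans
            (cong₂ ℚ._+_ (cong₂ ℚ._+_ (middleTerm-reverse z x y) (middleTerm-reverse y z x))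
                         (middleTerm-reverse x y z))
            (solve 3 (λ a b c → :- c :+ :- b :+ :- a := :- (a :+ b :+ c)) refl
              (middleTerm F x y z) (middleTerm F y z x) (middleTerm F z x y))
        }

      -- The three progressions through u = y - d and v = y + d have middle terms v, y and u.
      chain-sum : ∀ u v y d → D (⟦ u ⟧ - (y - d)) → D (⟦ v ⟧ - (y + d)) →
        Σ[ chain F u v ] ≡ F (y + d) (+ 2 * d) ℚ.- F y d ℚ.+ F (y - d) (+ 2 * d)
      chain-sum u v y d du dv = begin
        Σ[ chain F u v ]
          ≡⟨ trans (sum-+ (λ w → middleTerm F u v w ℚ.+ middleTerm F v w u) (λ w → middleTerm F w u v) vertices)
               (cong (ℚ._+ Σ[ (λ w → middleTerm F w u v) ])
                 (sum-+ (λ w → middleTerm F u v w) (λ w → middleTerm F v w u) vertices)) ⟩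
        Σ[ (λ w → middleTerm F u v w) ] ℚ.+ Σ[ (λ w → middleTerm F v w u) ] ℚ.+ Σ[ (λ w → middleTerm F w u v) ]
          ≡⟨ cong₂ ℚ._+_ (cong₂ ℚ._+_ first second) third ⟩
        F (y + d) (+ 2 * d) ℚ.- F y d ℚ.+ F (y - d) (+ 2 * d) ∎
        where
        U = ⟦ u ⟧
        V = ⟦ v ⟧
        v′ = ρ (+ 2 * V - U)
        y′ = ρ y
        u′ = ρ (+ 2 * U - V)
        dv′ = ⟦ρ⟧ (+ 2 * V - U)
        dy′ = ⟦ρ⟧ y
        du′ = ⟦ρ⟧ (+ 2 * U - V)

        first : Σ[ (λ w → middleTerm F u v w) ] ≡ F (y + d) (+ 2 * d)
        first = trans
          (Σ-single v′ λ w w≢ → middleTerm-no u v w λ s →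
            w≢ (⟦⟧-injective (D-lin₂ (+ 1) (- + 1) s dv′ (off U V ⟦ w ⟧ ⟦ v′ ⟧))))
          (trans (middleTerm-yes u v v′ (D-lin (+ 1) dv′ (on U V ⟦ v′ ⟧)))
                 (periodic dv (D-lin₂ (+ 1) (- + 1) dv du (arg U V y d))))
          where
          off : ∀ u v w v′ → w - v′ ≡ + 1 * (u + w - + 2 * v) + - + 1 * (v′ - (+ 2 * v - u))
          off = solve-∀
          on : ∀ u v v′ → u + v′ - + 2 * v ≡ + 1 * (v′ - (+ 2 * v - u))
          on = solve-∀
          arg : ∀ u v y d → v - u - + 2 * d ≡ + 1 * (v - (y + d)) + - + 1 * (u - (y - d))
          arg = solve-∀

        second : Σ[ (λ w → middleTerm F v w u) ] ≡ ℚ.- F y d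
        second = trans
          (Σ-single y′ λ w w≢ → middleTerm-no v w u λ s →
            w≢ (⟦⟧-injective (D-cancel (+ 2) ¬D-2
              (D-lin₂ (- + 1) (+ 1) s shape-y′ (off U V ⟦ w ⟧ ⟦ y′ ⟧)))))
          (trans (middleTerm-yes v y′ u shape-y′)
          -- This progression is met in the order `v`, `y′`, `u`, so its difference is `- d`; hence
          -- the minus sign.
          (trans (periodic {d′ = - d} dy′ (D-lin₂ (+ 1) (- + 1) dy′ dv (arg V ⟦ y′ ⟧ y d)))
                 (odd-in-d y d)))
          where
          shape-y′ : D (shape v y′ u)
          shape-y′ = D-lin₃ (+ 1) (+ 1) (- + 2) dv du dy′ (on U V ⟦ y′ ⟧ y d)
            where
            on : ∀ u v y′ y d → v + u - + 2 * y′ ≡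
              + 1 * (v - (y + d)) + + 1 * (u - (y - d)) + - + 2 * (y′ - y)
            on = solve-∀
          off : ∀ u v w y′ → + 2 * (w - y′) ≡
            - + 1 * (v + u - + 2 * w) + + 1 * (v + u - + 2 * y′)
          off = solve-∀
          arg : ∀ v y′ y d → y′ - v - - d ≡ + 1 * (y′ - y) + - + 1 * (v - (y + d))
          arg = solve-∀

        third : Σ[ (λ w → middleTerm F w u v) ] ≡ F (y - d) (+ 2 * d)
        third = trans
          (Σ-single u′ λ w w≢ → middleTerm-no w u v λ s →
            w≢ (⟦⟧-injective (D-lin₂ (+ 1) (- + 1) s du′ (off U V ⟦ w ⟧ ⟦ u′ ⟧))))
          (trans (middleTerm-yes u′ u v (D-lin (+ 1) du′ (on U V ⟦ u′ ⟧)))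
                 (periodic du (D-lin₃ (- + 1) (+ 1) (- + 1) du′ dv du (arg U V ⟦ u′ ⟧ y d))))
          where
          off : ∀ u v w u′ → w - u′ ≡ + 1 * (w + v - + 2 * u) + - + 1 * (u′ - (+ 2 * u - v))
          off = solve-∀
          on : ∀ u v u′ → u′ + v - + 2 * u ≡ + 1 * (u′ - (+ 2 * u - v))
          on = solve-∀
          arg : ∀ u v u′ y d → u - u′ - + 2 * d ≡
            - + 1 * (u′ - (+ 2 * u - v)) + + 1 * (v - (y + d)) + - + 1 * (u - (y - d))
          arg = solve-∀

      chain-middle : ∀ {x y z} → x ≢ y → y ≢ z → x ≢ z → D (shape x y z) →
                     chain F x y z ≡ F ⟦ y ⟧ (⟦ y ⟧ - ⟦ x ⟧)
      chain-middle {x} {y} {z} x≢y y≢z x≢z d = trans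
        (cong₂ ℚ._+_ (cong₂ ℚ._+_ (middleTerm-yes x y z d)
          (middleTerm-no y z x (unique-middle y≢z d)))
          (middleTerm-no z x y λ e → unique-middle (x≢y ∘ sym)
            (subst D (sym (shape-reverse x y z)) d) (subst D (sym (shape-reverse z x y)) e)))
        (solve 1 (λ a → a :+ con 0ℚ :+ con 0ℚ := a) refl (F ⟦ y ⟧ (⟦ y ⟧ - ⟦ x ⟧)))

      chain-none : ∀ {x y z} → ¬ D (shape x y z) → ¬ D (shape y z x) → ¬ D (shape z x y) →
                   chain F x y z ≡ 0ℚ
      chain-none {x} {y} {z} a b c =
        trans (cong₂ ℚ._+_ (cong₂ ℚ._+_ (middleTerm-no x y z a) (middleTerm-no y z x b))
                           (middleTerm-no z x y c)) refl

    -- Recovering a chain from its values on oriented progressions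

    profile : Function₃ → ℤ → ℤ → ℚ
    profile c b d = c (ρ (b - d)) (ρ b) (ρ (b + d))

    module _ {c : Function₃} (c-alt : Alternating c) where

      open Alternating c-alt

      profile-progression : ProgressionFunction (profile c)
      profile-progression = record
        { periodic = λ {b} {b′} {d} {d′} p q →
            cong₂ (λ x (y , z) → c x y z)
              (ρ-cong (D-lin₂ (+ 1) (- + 1) p q (lem₁ b b′ d d′)))
              (cong₂ _,_ (ρ-cong p) (ρ-cong (D-lin₂ (+ 1) (+ 1) p q (lem₂ b b′ d d′))))
        ; odd-in-d = λ b d → trans
            (cong₂ (λ x z → c x (ρ b) z) (cong (λ e → ρ (b + e)) (ℤ.neg-involutive d)) refl)
            (reverse (ρ (b - d)) (ρ b) (ρ (b + d)))
        }
        where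
        lem₁ : ∀ b b′ d d′ → b - d - (b′ - d′) ≡ + 1 * (b - b′) + - + 1 * (d - d′)
        lem₁ = solve-∀
        lem₂ : ∀ b b′ d d′ → b + d - (b′ + d′) ≡ + 1 * (b - b′) + + 1 * (d - d′)
        lem₂ = solve-∀

      profile-middle : ∀ x y z → D (shape x y z) → profile c ⟦ y ⟧ (⟦ y ⟧ - ⟦ x ⟧) ≡ c x y z
      profile-middle x y z d = cong₂ (λ x (y , z) → c x y z)
        (ρ-≡ (subst D (lem₁ ⟦ x ⟧ ⟦ y ⟧) D-0))
        (cong₂ _,_ (ρ-⟦⟧ y) (ρ-≡ (D-lin (- + 1) d (lem₂ ⟦ x ⟧ ⟦ y ⟧ ⟦ z ⟧))))
        where
        lem₁ : ∀ x y → + 0 ≡ y - (y - x) - x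
        lem₁ = solve-∀
        lem₂ : ∀ x y z → y + (y - x) - z ≡ - + 1 * (x + z - + 2 * y)
        lem₂ = solve-∀

      -- Both sides are alternating, so sorted triples suffice. If one of the three vertices is a
      -- middle term, both sides equal the value of `c` read from it; otherwise the left side is 0
      -- by assumption and the right side by construction.
      chain-profile :
        (∀ x y z → x < y → y < z →
          ¬ D (shape x y z) → ¬ D (shape y z x) → ¬ D (shape z x y) → c x y z ≡ 0ℚ) →
        ∀ x y z → c x y z ≡ chain (profile c) x y z
      chain-profile support = alternating-ext c-alt (chain-alternating pf) agree
        where
        pf = profile-progression
        F = profile c
        agree : ∀ x y z → x < y → y < z → c x y z ≡ chain F x y z
        agree x y z x<y y<z = go (D? (shape x y z)) (D? (shape y z x)) (D? (shape z x y))
          where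
          x≢y = Fin.<⇒≢ x<y
          y≢z = Fin.<⇒≢ y<z
          x≢z = Fin.<⇒≢ (Fin.<-trans x<y y<z)
          open Alternating (chain-alternating pf) using () renaming (rotate to rotate′)
          go : _ → _ → _ → c x y z ≡ chain F x y z
          go (yes d) _ _ = sym (trans (chain-middle pf x≢y y≢z x≢z d) (profile-middle x y z d))
          go (no _) (yes d) _ = trans (sym (rotate x y z)) (trans
            (sym (trans (chain-middle pf y≢z (x≢z ∘ sym) (x≢y ∘ sym) d) (profile-middle y z x d)))
            (rotate′ x y z))
          go (no _) (no _) (yes d) = trans (rotate z x y) (trans
            (sym (trans (chain-middle pf (x≢z ∘ sym) x≢y (y≢z ∘ sym) d) (profile-middle z x y d)))
            (sym (rotate′ z x y)))
          go (no a) (no b) (no e) = trans (support x y z x<y y<z a b e) (sym (chain-none pf {x} {y} {z} a b e))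

  -- The sawtooth function and its distribution relation

  fromℕ : ℕ → ℚ
  fromℕ zero    = 0ℚ
  fromℕ (suc k) = 1ℚ ℚ.+ fromℕ k

  fromℕ-+ : ∀ a b → fromℕ (a ℕ.+ b) ≡ fromℕ a ℚ.+ fromℕ b
  fromℕ-+ zero    b = sym (ℚ.+-identityˡ (fromℕ b))
  fromℕ-+ (suc a) b = trans (cong (1ℚ ℚ.+_) (fromℕ-+ a b)) (sym (ℚ.+-assoc 1ℚ (fromℕ a) (fromℕ b)))

  0≤fromℕ : ∀ k → 0ℚ ℚ.≤ fromℕ k
  0≤fromℕ zero    = ℚ.≤-refl
  0≤fromℕ (suc k) = ℚ.+-mono-≤ {0ℚ} {1ℚ} (ℚ.nonNegative⁻¹ 1ℚ) (0≤fromℕ k)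

  fromℕ-suc≢0 : ∀ k → fromℕ (suc k) ≢ 0ℚ
  fromℕ-suc≢0 k eq = ℚ.<⇒≢ (ℚ.+-mono-<-≤ {0ℚ} {1ℚ} (ℚ.positive⁻¹ 1ℚ) (0≤fromℕ k)) (sym eq)

  module Sawtooth (m : ℕ) (pr : Prime (suc (suc m))) (3<n : 3 ℕ.< suc (suc m)) where

    open Residues m pr 3<n

    N : ℚ
    N = fromℕ (suc m)

    residue : ℤ → ℕ
    residue e = toℕ (ρ e)

    residue-≡ : ∀ {e} r → r ℕ.< n → D (e - + r) → residue e ≡ r
    residue-≡ {e} r r<n d = trans
      (cong toℕ (ρ-≡ (subst (λ k → D (e - + k)) (sym (toℕ-fromℕ< r<n)) d)))
      (toℕ-fromℕ< r<n)

    D-residue : ∀ e → D (e - + residue e)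
    D-residue e = D-lin (- + 1) (⟦ρ⟧ e) (lem e (+ residue e))
      where
      lem : ∀ e r → e - r ≡ - + 1 * (r - e)
      lem = solve-∀

    D-n : D (+ n)
    D-n = divides (+ 1) (sym (ℤ.*-identityˡ (+ n)))

    -- Twice the representative of e + 1/2, with 1/2 taken modulo n, between - n / 2 and n / 2.
    sawtooth : ℤ → ℚ
    sawtooth e = fromℕ (residue e) ℚ.+ fromℕ (residue e) ℚ.- N

    sawtooth-cong : ∀ {e f} → D (e - f) → sawtooth e ≡ sawtooth f
    sawtooth-cong d = cong (λ x → fromℕ (toℕ x) ℚ.+ fromℕ (toℕ x) ℚ.- N) (ρ-cong d)

    private
      q : ℕ
      q = proj₁ odd

      n≡ : n ≡ suc (q ℕ.+ q)
      n≡ = proj₂ odd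

    half : ℤ
    half = + suc q

    D-half : D (+ 2 * half - + 1)
    D-half = subst D (trans (cong +_ n≡) (lem (+ q))) D-n
      where
      lem : ∀ a → + 1 + (a + a) ≡ + 2 * (+ 1 + a) - + 1
      lem = solve-∀

    N≡ : N ≡ fromℕ q ℚ.+ fromℕ q
    N≡ = trans (cong fromℕ (ℕ.suc-injective n≡)) (fromℕ-+ q q)

    -- Let `n = 2q + 1`, so that `half` is `q + 1`, and let `r` be the residue of `e`. If `r < q`,
    -- neither `r + half` nor `2r + 1` reaches `n`. If `r = q + s`, both pass `n` exactly once and
    -- leave `s` and `2s`. In each case the identity is linear in `r` or `s`.
    sawtooth-double : ∀ e → sawtooth e ℚ.+ sawtooth (e + half) ≡ sawtooth (+ 2 * e + + 1)
    sawtooth-double e = split (ℕ.<-≤-connex r q)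
      where
      r = residue e
      dr = D-residue e
      split : r ℕ.< q ⊎ q ℕ.≤ r → sawtooth e ℚ.+ sawtooth (e + half) ≡ sawtooth (+ 2 * e + + 1)
      split (inj₁ r<q) = begin
        sawtooth e ℚ.+ sawtooth (e + half)
          ≡⟨ cong₂ (λ x y → fromℕ r ℚ.+ fromℕ r ℚ.- x ℚ.+ (y ℚ.+ y ℚ.- x)) N≡
               (trans (cong fromℕ (residue-≡ (r ℕ.+ suc q) r+h<n (D-lin (+ 1) dr (lem₁ e (+ r) half))))
                      (fromℕ-+ r (suc q))) ⟩
        fromℕ r ℚ.+ fromℕ r ℚ.- (fromℕ q ℚ.+ fromℕ q)
          ℚ.+ ((fromℕ r ℚ.+ (1ℚ ℚ.+ fromℕ q)) ℚ.+ (fromℕ r ℚ.+ (1ℚ ℚ.+ fromℕ q)) ℚ.- (fromℕ q ℚ.+ fromℕ q))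
          ≡⟨ solve 2 (λ a b → a :+ a :- (b :+ b) :+ ((a :+ (con 1ℚ :+ b)) :+ (a :+ (con 1ℚ :+ b)) :- (b :+ b))
                := (con 1ℚ :+ (a :+ a)) :+ (con 1ℚ :+ (a :+ a)) :- (b :+ b)) refl (fromℕ r) (fromℕ q) ⟩
        (1ℚ ℚ.+ (fromℕ r ℚ.+ fromℕ r)) ℚ.+ (1ℚ ℚ.+ (fromℕ r ℚ.+ fromℕ r)) ℚ.- (fromℕ q ℚ.+ fromℕ q)
          ≡⟨ sym (cong₂ (λ x y → x ℚ.+ x ℚ.- y)
               (trans (cong fromℕ (residue-≡ (suc (r ℕ.+ r)) 2r+1<n (D-lin (+ 2) dr (lem₂ e (+ r)))))
                      (cong (1ℚ ℚ.+_) (fromℕ-+ r r))) N≡) ⟩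
        sawtooth (+ 2 * e + + 1) ∎
        where
        r+h<n : r ℕ.+ suc q ℕ.< n
        r+h<n = subst₂ ℕ._<_ (sym (ℕ.+-suc r q)) (sym n≡) (ℕ.s≤s (ℕ.+-monoˡ-< q r<q))
        2r+1<n : suc (r ℕ.+ r) ℕ.< n
        2r+1<n = subst (suc (r ℕ.+ r) ℕ.<_) (sym n≡) (ℕ.s≤s (ℕ.+-mono-< r<q r<q))
        lem₁ : ∀ e r h → e + h - (r + h) ≡ + 1 * (e - r)
        lem₁ = solve-∀
        lem₂ : ∀ e r → + 2 * e + + 1 - (+ 1 + (r + r)) ≡ + 2 * (e - r)
        lem₂ = solve-∀
      split (inj₂ q≤r) with ℕ.m≤n⇒∃[o]m+o≡n q≤r
      ... | s , q+s≡r = begin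
        sawtooth e ℚ.+ sawtooth (e + half)
          ≡⟨ cong₂ ℚ._+_ (cong₂ (λ x y → x ℚ.+ x ℚ.- y)
               (trans (cong fromℕ (sym q+s≡r)) (fromℕ-+ q s)) N≡)
               (cong₂ (λ x y → x ℚ.+ x ℚ.- y)
                 (cong fromℕ (residue-≡ s s<n (D-lin₂ (+ 1) (+ 1) dr D-n
                   (trans (lem₁ e (+ q) (+ s)) (cong₂ (λ x y → + 1 * (e - x) + + 1 * y) q+s (cong +_ (sym n≡))))))) N≡) ⟩
        (fromℕ q ℚ.+ fromℕ s) ℚ.+ (fromℕ q ℚ.+ fromℕ s) ℚ.- (fromℕ q ℚ.+ fromℕ q)
          ℚ.+ (fromℕ s ℚ.+ fromℕ s ℚ.- (fromℕ q ℚ.+ fromℕ q))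
          ≡⟨ solve 2 (λ b c → (b :+ c) :+ (b :+ c) :- (b :+ b) :+ (c :+ c :- (b :+ b))
                := (c :+ c) :+ (c :+ c) :- (b :+ b)) refl (fromℕ q) (fromℕ s) ⟩
        (fromℕ s ℚ.+ fromℕ s) ℚ.+ (fromℕ s ℚ.+ fromℕ s) ℚ.- (fromℕ q ℚ.+ fromℕ q)
          ≡⟨ sym (cong₂ (λ x y → x ℚ.+ x ℚ.- y)
               (trans (cong fromℕ (residue-≡ (s ℕ.+ s) 2s<n (D-lin₂ (+ 2) (+ 1) dr D-n
                  (trans (lem₂ e (+ q) (+ s)) (cong₂ (λ x y → + 2 * (e - x) + + 1 * y) q+s (cong +_ (sym n≡)))))))
                 (fromℕ-+ s s)) N≡) ⟩
        sawtooth (+ 2 * e + + 1) ∎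
        where
        q+s : + q + + s ≡ + r
        q+s = cong +_ q+s≡r
        s≤q : s ℕ.≤ q
        s≤q = ℕ.+-cancelˡ-≤ q s q (ℕ.≤-pred (subst₂ ℕ._<_ (sym q+s≡r) n≡ (toℕ<n (ρ e))))
        2s<n : s ℕ.+ s ℕ.< n
        2s<n = subst (s ℕ.+ s ℕ.<_) (sym n≡) (ℕ.s≤s (ℕ.+-mono-≤ s≤q s≤q))
        s<n : s ℕ.< n
        s<n = ℕ.≤-<-trans (ℕ.m≤m+n s s) 2s<n
        lem₁ : ∀ e q s → e + (+ 1 + q) - s ≡ + 1 * (e - (q + s)) + + 1 * (+ 1 + (q + q))
        lem₁ = solve-∀
        lem₂ : ∀ e q s → + 2 * e + + 1 - (s + s) ≡ + 2 * (e - (q + s)) + + 1 * (+ 1 + (q + q))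
        lem₂ = solve-∀

    -- The map sends the residue `r` to `n - 1 - r`, a reflection in the point `(n - 1) / 2` about
    -- which `sawtooth` is odd.
    sawtooth-reflect : ∀ e → sawtooth (- + 1 - e) ≡ ℚ.- sawtooth e
    sawtooth-reflect e with ℕ.m≤n⇒∃[o]m+o≡n (ℕ.≤-pred (toℕ<n (ρ e)))
    ... | s , r+s≡ = begin
        sawtooth (- + 1 - e)
          ≡⟨ cong₂ (λ x y → x ℚ.+ x ℚ.- y)
               (cong fromℕ (residue-≡ s s<n (D-lin₂ (- + 1) (- + 1) (D-residue e) D-n
                 (trans (lem e (+ r) (+ s)) (cong (λ z → - + 1 * (e - + r) + - + 1 * z) (cong (λ k → + suc k) r+s≡))))))
               N′ ⟩
        fromℕ s ℚ.+ fromℕ s ℚ.- (fromℕ r ℚ.+ fromℕ s)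
          ≡⟨ solve 2 (λ a b → b :+ b :- (a :+ b) := :- (a :+ a :- (a :+ b))) refl (fromℕ r) (fromℕ s) ⟩
        ℚ.- (fromℕ r ℚ.+ fromℕ r ℚ.- (fromℕ r ℚ.+ fromℕ s))
          ≡⟨ cong (λ x → ℚ.- (fromℕ r ℚ.+ fromℕ r ℚ.- x)) (sym N′) ⟩
        ℚ.- sawtooth e ∎
      where
      r = residue e
      N′ : N ≡ fromℕ r ℚ.+ fromℕ s
      N′ = trans (cong fromℕ (sym r+s≡)) (fromℕ-+ r s)
      s<n : s ℕ.< n
      s<n = ℕ.s≤s (subst (s ℕ.≤_) r+s≡ (ℕ.m≤n+m s r))
      lem : ∀ e r s → - + 1 - e - s ≡ - + 1 * (e - r) + - + 1 * (+ 1 + (r + s))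
      lem = solve-∀

    sawtooth-step : ∀ e → ¬ D e → sawtooth e ℚ.- sawtooth (e - + 1) ≡ 1ℚ ℚ.+ 1ℚ
    sawtooth-step e ¬d with residue e in eq
    ... | zero  = contradiction (subst D (ℤ.+-identityʳ e) (subst (λ k → D (e - + k)) eq (D-residue e))) ¬d
    ... | suc r = trans (cong (λ x → fromℕ (suc r) ℚ.+ fromℕ (suc r) ℚ.- N ℚ.- (x ℚ.+ x ℚ.- N))
        (cong fromℕ (residue-≡ {e - + 1} r (ℕ.<-trans (ℕ.n<1+n r) (subst (ℕ._< n) eq (toℕ<n (ρ e))))
          (D-lin (+ 1) (subst (λ k → D (e - + k)) eq (D-residue e)) (lem e (+ r))))))
        (solve 2 (λ a N → (con 1ℚ :+ a) :+ (con 1ℚ :+ a) :- N :- (a :+ a :- N) := con 1ℚ :+ con 1ℚ)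
          refl (fromℕ r) N)
      where
      lem : ∀ e r → e - + 1 - r ≡ + 1 * (e - (+ 1 + r))
      lem = solve-∀

    sawtooth-jump : ∀ e → D e → sawtooth e ℚ.- sawtooth (e - + 1) ≡ ℚ.- (N ℚ.+ N)
    sawtooth-jump e d = trans
      (cong₂ (λ x y → x ℚ.+ x ℚ.- N ℚ.- (y ℚ.+ y ℚ.- N))
        (cong fromℕ (residue-≡ {e} 0 (ℕ.s≤s ℕ.z≤n) (subst D (sym (ℤ.+-identityʳ e)) d)))
        (cong fromℕ (residue-≡ {e - + 1} (suc m) ℕ.≤-refl (D-lin₂ (+ 1) (- + 1) d D-n (lem e (+ suc m))))))
      (solve 1 (λ N → con 0ℚ :+ con 0ℚ :- N :- (N :+ N :- N) := :- (N :+ N)) refl N)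
      where
      lem : ∀ e k → e - + 1 - k ≡ + 1 * e + - + 1 * (+ 1 + k)
      lem = solve-∀

    abstract
      inv : ℤ → ℤ
      inv e with D? e
      ... | yes _ = + 0
      ... | no ¬d = proj₁ (inverse e ¬d)

      inv-spec : ∀ e → ¬ D e → D (e * inv e - + 1)
      inv-spec e ¬d with D? e
      ... | yes d  = contradiction d ¬d
      ... | no ¬d′ = proj₂ (inverse e ¬d′)

    ¬D-double : ∀ {e} → ¬ D e → ¬ D (+ 2 * e)
    ¬D-double ¬d d = ¬d (D-cancel (+ 2) ¬D-2 d)

    abstract
      -- Twice the solution f, of total 0, of f (x + e) - f (x - e) = 1 - n · [x = 0].
      wave : ℤ → ℤ → ℚ
      wave e x = sawtooth (inv (+ 2 * e) * (x - e))

      -- Inverses modulo `n` are unique up to congruence, so a wave may be evaluated with whichever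
      -- inverse `t` of `2 * e` suits the calculation.
      wave-≡ : ∀ {e arg} t x → ¬ D e → D (+ 2 * e * t - + 1) → D (arg - t * (x - e)) →
               wave e x ≡ sawtooth arg
      wave-≡ {e} {arg} t x ¬d dt da = sawtooth-cong
        (D-lin₃ (- i * (x - e)) (t * (x - e)) (- + 1) dt (inv-spec (+ 2 * e) (¬D-double ¬d)) da
          (lem e x arg t i))
        where
        i : ℤ
        i = inv (+ 2 * e)
        lem : ∀ e x a t i → i * (x - e) - a ≡ - i * (x - e) * (+ 2 * e * t - + 1)
          + t * (x - e) * (+ 2 * e * i - + 1) + - + 1 * (a - t * (x - e))
        lem = solve-∀

    wave-cong : ∀ {e e′ x x′} → ¬ D e → D (e - e′) → D (x - x′) → wave e x ≡ wave e′ x′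
    wave-cong {e} {e′} {x} {x′} ¬d de dx = trans
      (wave-≡ {arg = t * (x′ - e′)} t x ¬d
        (D-lin₂ (+ 1) (+ 2 * t) dt de (lem₁ e e′ t))
        (D-lin₂ (- t) t dx de (lem₂ e e′ x x′ t)))
      (sym (wave-≡ t x′ ¬d′ dt (subst D (sym (ℤ.+-inverseʳ (t * (x′ - e′)))) D-0)))
      where
      t = inv (+ 2 * e′)
      ¬d′ : ¬ D e′
      ¬d′ d = ¬d (D-lin₂ (+ 1) (+ 1) de d (lem₀ e e′))
        where
        lem₀ : ∀ e e′ → e ≡ + 1 * (e - e′) + + 1 * e′
        lem₀ = solve-∀
      dt = inv-spec (+ 2 * e′) (¬D-double ¬d′)
      lem₁ : ∀ e e′ t → + 2 * e * t - + 1 ≡ + 1 * (+ 2 * e′ * t - + 1) + + 2 * t * (e - e′)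
      lem₁ = solve-∀
      lem₂ : ∀ e e′ x x′ t → t * (x′ - e′) - t * (x - e) ≡ - t * (x - x′) + t * (e - e′)
      lem₂ = solve-∀

    wave-neg : ∀ {e} x → ¬ D e → wave (- e) x ≡ ℚ.- wave e x
    wave-neg {e} x ¬d = trans
      (wave-≡ (- t) x (λ d → ¬d (D-lin (- + 1) d (lem₀ e)))
        (subst D (lem₁ e t) dt) (D-lin (+ 1) dt (lem₂ e x t)))
      (trans (sawtooth-reflect (t * (x - e))) (cong ℚ.-_ (sym
        (wave-≡ t x ¬d dt (subst D (sym (ℤ.+-inverseʳ (t * (x - e)))) D-0)))))
      where
      t = inv (+ 2 * e)
      dt = inv-spec (+ 2 * e) (¬D-double ¬d)
      lem₀ : ∀ e → e ≡ - + 1 * - e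
      lem₀ = solve-∀
      lem₁ : ∀ e t → + 2 * e * t - + 1 ≡ + 2 * - e * - t - + 1
      lem₁ = solve-∀
      lem₂ : ∀ e x t → - + 1 - t * (x - e) - - t * (x - - e) ≡ + 1 * (+ 2 * e * t - + 1)
      lem₂ = solve-∀

    -- Put `μ = (x - 3e) / 4e` modulo `n`. The two waves on the right have arguments `μ` and
    -- `(x - e) / 4e = μ + 1/2`, and the wave on the left has argument `(x - e) / 2e = 2μ + 1`, so
    -- this is `sawtooth-double` at `μ`.
    wave-double : ∀ {e} x → ¬ D e →
      wave e x ≡ wave (+ 2 * e) (x - e) ℚ.+ wave (+ 2 * e) (x + e)
    wave-double {e} x ¬d = begin
      wave e x
        ≡⟨ wave-≡ (+ 2 * τ) x ¬d (subst D (lem₁ e τ) dτ) (D-lin (- + 1) dτ (lem₂ e x τ)) ⟩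
      sawtooth (+ 2 * μ + + 1)
        ≡⟨ sym (sawtooth-double μ) ⟩
      sawtooth μ ℚ.+ sawtooth (μ + half)
        ≡⟨ sym (cong₂ ℚ._+_
             (wave-≡ τ (x - e) ¬2d dτ (subst D (lem₃ e x τ) D-0))
             (wave-≡ τ (x + e) ¬2d dτ (D-lin₂ (- half) (+ 2 * e * τ) dτ D-half (lem₄ e x τ half)))) ⟩
      wave (+ 2 * e) (x - e) ℚ.+ wave (+ 2 * e) (x + e) ∎
      where
      τ = inv (+ 2 * (+ 2 * e))
      ¬2d = ¬D-double ¬d
      dτ = inv-spec (+ 2 * (+ 2 * e)) (¬D-double ¬2d)
      μ = τ * (x - + 3 * e)
      lem₁ : ∀ e τ → + 2 * (+ 2 * e) * τ - + 1 ≡ + 2 * e * (+ 2 * τ) - + 1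
      lem₁ = solve-∀
      lem₂ : ∀ e x τ → + 2 * (τ * (x - + 3 * e)) + + 1 - + 2 * τ * (x - e) ≡
        - + 1 * (+ 2 * (+ 2 * e) * τ - + 1)
      lem₂ = solve-∀
      lem₃ : ∀ e x τ → + 0 ≡ τ * (x - + 3 * e) - τ * (x - e - + 2 * e)
      lem₃ = solve-∀
      lem₄ : ∀ e x τ h → τ * (x - + 3 * e) + h - τ * (x + e - + 2 * e) ≡
        - h * (+ 2 * (+ 2 * e) * τ - + 1) + + 2 * e * τ * (+ 2 * h - + 1)
      lem₄ = solve-∀

    private
      -- A shift of `x` by `2e` moves the argument of the sawtooth by 1. The difference is therefore
      -- one increment of the sawtooth, taken at `x / 2e`, which is 0 modulo `n` exactly when `x`
      -- is.
      wave-difference : ∀ {e} x → ¬ D e → let i = inv (+ 2 * e) * x in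
        wave e (x + e) ℚ.- wave e (x - e) ≡ sawtooth i ℚ.- sawtooth (i - + 1)
      wave-difference {e} x ¬d = cong₂ ℚ._-_
        (wave-≡ t (x + e) ¬d dt (subst D (lem₁ e x t) D-0))
        (wave-≡ t (x - e) ¬d dt (D-lin (+ 1) dt (lem₂ e x t)))
        where
        t = inv (+ 2 * e)
        dt = inv-spec (+ 2 * e) (¬D-double ¬d)
        lem₁ : ∀ e x t → + 0 ≡ t * x - t * (x + e - e)
        lem₁ = solve-∀
        lem₂ : ∀ e x t → t * x - + 1 - t * (x - e - e) ≡ + 1 * (+ 2 * e * t - + 1)
        lem₂ = solve-∀

    wave-step : ∀ {e} x → ¬ D e → ¬ D x → wave e (x + e) ℚ.- wave e (x - e) ≡ 1ℚ ℚ.+ 1ℚ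
    wave-step {e} x ¬d ¬x = trans (wave-difference x ¬d)
      (sawtooth-step (t * x) λ d → ¬x (D-lin₂ (- x) (+ 2 * e) dt d (lem e x t)))
      where
      t = inv (+ 2 * e)
      dt = inv-spec (+ 2 * e) (¬D-double ¬d)
      lem : ∀ e x t → x ≡ - x * (+ 2 * e * t - + 1) + + 2 * e * (t * x)
      lem = solve-∀

    wave-jump : ∀ {e} x → ¬ D e → D x → wave e (x + e) ℚ.- wave e (x - e) ≡ ℚ.- (N ℚ.+ N)
    wave-jump {e} x ¬d dx = trans (wave-difference x ¬d)
      (sawtooth-jump (inv (+ 2 * e) * x) (D-lin (inv (+ 2 * e)) dx refl))

  -- Coset representatives

  module Representatives (m : ℕ) (pr : Prime (suc (suc m))) (3<n : 3 ℕ.< suc (suc m)) where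

    open Residues m pr 3<n

    one : Fin n
    one = Fin.suc Fin.zero

    MinRep-unit : ∀ {d} → MinRep n d → ¬ D ⟦ d ⟧
    MinRep-unit (u , _) = nonzero-D u

    MinRep-≮ : ∀ {x y} → MinRep n x → MinRep n y → ⟦ x ⟧ ~ ⟦ y ⟧ → ¬ (y < x)
    MinRep-≮ (_ , x-min) (uy , _) x~y y<x = x-min _ y<x uy (~⇒SameCoset x~y)

    MinRep-unique : ∀ {x y} → MinRep n x → MinRep n y → ⟦ x ⟧ ~ ⟦ y ⟧ → x ≡ y
    MinRep-unique {x} {y} mx my x~y with Fin.<-cmp x y
    ... | tri< x<y _ _ = contradiction x<y (MinRep-≮ my mx (~-sym x~y))
    ... | tri≈ _ x≡y _ = x≡y
    ... | tri> _ _ y<x = contradiction y<x (MinRep-≮ mx my x~y)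

    MinRep-one : MinRep n one
    MinRep-one = (λ ()) , λ { Fin.zero _ u _ → u refl ; (Fin.suc _) (ℕ.s≤s ()) }

    representative : ∀ x → IsUnit n x → ∃ λ d → MinRep n d × ⟦ x ⟧ ~ ⟦ d ⟧
    representative x = go x (<-wellFounded x)
      where
      go : ∀ x → Acc _<_ x → IsUnit n x → ∃ λ d → MinRep n d × ⟦ x ⟧ ~ ⟦ d ⟧
      go x (acc rs) u with Fin.any? (λ y → (toℕ y ℕ.<? toℕ x) ×-dec (isUnit? n y ×-dec sameCoset? n x y))
      ... | no none = x , (u , λ y y<x uy s → none (y , y<x , uy , s)) , ~-refl
      ... | yes (y , y<x , uy , s) with go y (rs y<x) uy
      ...   | d , md , y~d = d , md , ~-trans (SameCoset⇒~ s) y~d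

    representative-ℤ : ∀ e → ¬ D e → ∃ λ d → MinRep n d × e ~ ⟦ d ⟧
    representative-ℤ e ¬d with representative (ρ e) (D-nonzero λ d → ¬d (D-lin₂ (+ 1) (- + 1) d (⟦ρ⟧ e) (lem e ⟦ ρ e ⟧)))
      where
      lem : ∀ e r → e ≡ + 1 * r + - + 1 * (r - e)
      lem = solve-∀
    ... | d , md , r~d = d , md , ~-trans (~-reflexive (⟦ρ⟧ e)) r~d

    record NontrivialRep (d : Fin n) : Set where
      constructor nontrivial
      field
        minRep : MinRep n d
        d≢one  : d ≢ one

      unit : ¬ D ⟦ d ⟧
      unit = MinRep-unit minRep

      ≁1 : ¬ (⟦ d ⟧ ~ + 1)
      ≁1 d~1 = d≢one (MinRep-unique minRep MinRep-one d~1)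

  -- Explicit cycles

  module Cycles (m : ℕ) (pr : Prime (suc (suc m))) (3<n : 3 ℕ.< suc (suc m)) where

    open Residues m pr 3<n
    open Progressions m pr 3<n
    open Chains n
    open ProgressionChains m pr 3<n
    open Sawtooth m pr 3<n
    open Representatives m pr 3<n

    -- A coset of units other than that of 1 contains none of 0, 1 and -1. Every difference in it
    -- therefore belongs to genuine faces, and a cycle may be spread over the whole coset.
    ~-Good : ∀ {d e} → NontrivialRep d → ⟦ d ⟧ ~ e → Good e
    ~-Good {d} {e} nt d~e =
        (λ e₀ → unit (~-D d~e e₀))
      , (λ e₁ → ≁1 (~-trans d~e (~-reflexive (D-lin (- + 1) e₁ (lem₁ e)))))
      , (λ e₂ → ≁1 (~-trans d~e (~-trans (~-neg e) (~-reflexive (D-lin (+ 1) e₂ (lem₂ e))))))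
      where
      open NontrivialRep nt
      lem₁ : ∀ e → + 1 - e ≡ - + 1 * (e - + 1)
      lem₁ = solve-∀
      lem₂ : ∀ e → + 1 - - e ≡ + 1 * (e + + 1)
      lem₂ = solve-∀

    AP3⇒IsFace : ∀ {i j k} → Sorted (i , j , k) → AP3 i j k → IsFace n (i , j , k)
    AP3⇒IsFace (i<j , j<k) ap = i<j , j<k , AP3⇒IsAP ap

    IsFace⇒Sorted : ∀ {t} → IsFace n t → Sorted t
    IsFace⇒Sorted (i<j , j<k , _) = i<j , j<k

    ↝-AP3 : ∀ {x y z x′ y′ z′} → (x , y , z) ↝ (x′ , y′ , z′) → AP3 x y z → AP3 x′ y′ z′
    ↝-AP3 done    = λ ap → ap
    ↝-AP3 (rot p) = AP3-rotate ∘ ↝-AP3 p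
    ↝-AP3 (swp p) = AP3-swap ∘ ↝-AP3 p

    record FaceAt (b d : Fin n) (t : Triple n) : Set where
      constructor faceAt
      field
        isFace : IsFace n t
        permutes : (ρ (⟦ b ⟧ - ⟦ d ⟧) , b , ρ (⟦ b ⟧ + ⟦ d ⟧)) ↝ t

    module _ (b d : Fin n) (nt : NontrivialRep d) where

      open NontrivialRep nt

      private
        B = ⟦ b ⟧
        E = ⟦ d ⟧
        x = ρ (B - E)
        z = ρ (B + E)
        dx = ⟦ρ⟧ (B - E)
        dz = ⟦ρ⟧ (B + E)

        lem-shape : ∀ b e x z → x + z - + 2 * b ≡ + 1 * (x - (b - e)) + + 1 * (z - (b + e))
        lem-shape = solve-∀
        lem-diff : ∀ b e x → b - x - e ≡ - + 1 * (x - (b - e))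
        lem-diff = solve-∀

      face-shape : D (shape x b z)
      face-shape = D-lin₂ (+ 1) (+ 1) dx dz (lem-shape B E ⟦ x ⟧ ⟦ z ⟧)

      face-diff : D (B - ⟦ x ⟧ - E)
      face-diff = D-lin (- + 1) dx (lem-diff B E ⟦ x ⟧)

      face-x≢b : x ≢ b
      face-x≢b x≡b = unit (D-lin (- + 1) (ρ-D {B - E} {B} (trans x≡b (sym (ρ-⟦⟧ b)))) (lem B E))
        where
        lem : ∀ b e → e ≡ - + 1 * (b - e - b)
        lem = solve-∀

      face-b≢z : b ≢ z
      face-b≢z b≡z = unit (D-lin (- + 1) (ρ-D {B} {B + E} (trans (ρ-⟦⟧ b) b≡z)) (lem B E))
        where
        lem : ∀ b e → e ≡ - + 1 * (b - (b + e))
        lem = solve-∀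

      face-x≢z : x ≢ z
      face-x≢z x≡z = ¬D-double unit (D-lin (- + 1) (ρ-D {B - E} {B + E} x≡z) (lem B E))
        where
        lem : ∀ b e → + 2 * e ≡ - + 1 * (b - e - (b + e))
        lem = solve-∀

      face : ∃ (FaceAt b d)
      face = toFace (sort x b z face-x≢b face-b≢z face-x≢z)
        where
        b-middle : Mid x b z
        b-middle = middle face-shape (Good-cong (D-lin (- + 1) face-diff (lem B E ⟦ x ⟧)) (~-Good nt ~-refl))
          where
          lem : ∀ b e x → e - (b - x) ≡ - + 1 * (b - x - e)
          lem = solve-∀
        toFace : (∃ λ t → Sorted t × (x , b , z) ↝ t) → ∃ (FaceAt b d)
        toFace ((i , j , k) , sorted , p) =
          (i , j , k) , faceAt (AP3⇒IsFace sorted (↝-AP3 {x} {b} {z} {i} {j} {k} p (inj₁ b-middle))) p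

    module _ (b₀ d₀ : Fin n) (nt : NontrivialRep d₀) where

      open NontrivialRep nt

      private
        B = ⟦ b₀ ⟧
        E = ⟦ d₀ ⟧

      inCoset : ∀ e → Dec (SameCoset n d₀ (ρ e))
      inCoset e = sameCoset? n d₀ (ρ e)

      inCoset-from : ∀ {e} → SameCoset n d₀ (ρ e) → E ~ e
      inCoset-from {e} s = ~-trans (SameCoset⇒~ s) (~-reflexive (D-lin (- + 1) (⟦ρ⟧ e) (lem e ⟦ ρ e ⟧)))
        where
        lem : ∀ e r → e - r ≡ - + 1 * (r - e)
        lem = solve-∀

      inCoset-to : ∀ {e} → E ~ e → SameCoset n d₀ (ρ e)
      inCoset-to {e} E~e = ~⇒SameCoset (~-trans E~e (~-reflexive (⟦ρ⟧ e)))

      -- Each translate of `wave` satisfies the relation of cycles, hence so does this combination.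
      -- At `e = E` the first difference is `2 - 2n [x = 0]` and the second is the same at `x - B`.
      -- The constants cancel and leave `2n ([x = B] - [x = 0])`.
      waves : ℤ → ℤ → ℚ
      waves x e = wave e (x + E) ℚ.- wave e (x - E) ℚ.- (wave e (x - B + E) ℚ.- wave e (x - B - E))

      -- At difference d₀ this is a multiple of the indicator of b₀ minus that of 0.
      F : ℤ → ℤ → ℚ
      F x e = 𝟙 (inCoset e) ℚ.* waves x e

      F-in : ∀ x {e} → E ~ e → F x e ≡ waves x e
      F-in x {e} E~e = trans (cong (ℚ._* waves x e) (𝟙-yes (inCoset e) (inCoset-to E~e)))
                               (ℚ.*-identityˡ (waves x e))

      F-out : ∀ x {e} → ¬ (E ~ e) → F x e ≡ 0ℚ
      F-out x {e} E≁e = trans (cong (ℚ._* waves x e) (𝟙-no (inCoset e) (E≁e ∘ inCoset-from)))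
                                (ℚ.*-zeroˡ (waves x e))

      ~? : ∀ e → Dec (E ~ e)
      ~? e with inCoset e
      ... | yes s = yes (inCoset-from s)
      ... | no ¬s = no (¬s ∘ inCoset-to)

      ~-unit : ∀ {e} → E ~ e → ¬ D e
      ~-unit E~e = unit ∘ ~-D E~e

      F-progression : ProgressionFunction F
      F-progression = record { periodic = λ {x} {x′} {e} {e′} → periodic {x} {x′} {e} {e′} ; odd-in-d = odd-in-d }
        where
        lem : ∀ e e′ → e′ - e ≡ - + 1 * (e - e′)
        lem = solve-∀
        periodic : ∀ {x x′ e e′} → D (x - x′) → D (e - e′) → F x e ≡ F x′ e′
        periodic {x} {x′} {e} {e′} dx de with ~? e
        ... | no E≁e = trans (F-out x E≁e) (sym (F-out x′ λ E~e′ → E≁e (~-trans E~e′ (~-reflexive de))))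
        ... | yes E~e = trans (F-in x E~e) (trans
            (cong₂ ℚ._-_
              (cong₂ ℚ._-_ (shift E (lem₁ x x′ E)) (shift (- E) (lem₁ x x′ (- E))))
              (cong₂ ℚ._-_ (shift₂ E (lem₂ x x′ B E)) (shift₂ (- E) (lem₂ x x′ B (- E)))))
            (sym (F-in x′ (~-trans E~e (~-reflexive (D-lin (- + 1) de (lem e e′)))))))
          where
          shift : ∀ s → x + s - (x′ + s) ≡ + 1 * (x - x′) → wave e (x + s) ≡ wave e′ (x′ + s)
          shift s eq = wave-cong (~-unit E~e) de (D-lin (+ 1) dx eq)
          shift₂ : ∀ s → x - B + s - (x′ - B + s) ≡ + 1 * (x - x′) →
                   wave e (x - B + s) ≡ wave e′ (x′ - B + s)
          shift₂ s eq = wave-cong (~-unit E~e) de (D-lin (+ 1) dx eq)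
          lem₁ : ∀ x x′ s → x + s - (x′ + s) ≡ + 1 * (x - x′)
          lem₁ = solve-∀
          lem₂ : ∀ x x′ b s → x - b + s - (x′ - b + s) ≡ + 1 * (x - x′)
          lem₂ = solve-∀
        odd-in-d : ∀ x e → F x (- e) ≡ ℚ.- F x e
        odd-in-d x e with ~? e
        ... | no E≁e = trans (F-out x λ E~-e → E≁e (~-trans E~-e (subst (- e ~_) (ℤ.neg-involutive e) (~-neg (- e)))))
                             (cong ℚ.-_ (sym (F-out x E≁e)))
        ... | yes E~e = trans (F-in x (~-trans E~e (~-neg e))) (trans
            (cong₂ ℚ._-_
              (cong₂ ℚ._-_ (wave-neg (x + E) ¬e) (wave-neg (x - E) ¬e))
              (cong₂ ℚ._-_ (wave-neg (x - B + E) ¬e) (wave-neg (x - B - E) ¬e)))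
            (trans
              (solve 4 (λ a b c d → :- a :- :- b :- (:- c :- :- d) := :- (a :- b :- (c :- d))) refl
                (wave e (x + E)) (wave e (x - E)) (wave e (x - B + E)) (wave e (x - B - E)))
              (cong ℚ.-_ (sym (F-in x E~e)))))
          where
          ¬e = ~-unit E~e

      -- In the coset, `wave-double` splits each of the four waves of `F x e` into two translates,
      -- and these eight are precisely the waves of `F (x + e) (2e)` and `F (x - e) (2e)`. Outside
      -- the coset all three terms vanish, since `e` and `2e` lie in the same coset.
      F-relation : ∀ x e → F (x + e) (+ 2 * e) ℚ.- F x e ℚ.+ F (x - e) (+ 2 * e) ≡ 0ℚ
      F-relation x e with ~? e
      ... | no E≁e = trans
          (cong₂ ℚ._+_ (cong₂ ℚ._-_ (F-out (x + e) E≁2e) (F-out x E≁e)) (F-out (x - e) E≁2e)) refl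
        where
        E≁2e : ¬ (E ~ + 2 * e)
        E≁2e E~2e = E≁e (~-trans E~2e (~-sym (~-double e)))
      ... | yes E~e = trans
          (cong₂ ℚ._+_ (cong₂ ℚ._-_ (F-in (x + e) E~2e)
            (trans (F-in x E~e) (cong₂ ℚ._-_
              (cong₂ ℚ._-_ (double₁ E) (double₁ (- E)))
              (cong₂ ℚ._-_ (double₂ E) (double₂ (- E))))))
            (F-in (x - e) E~2e))
          (solve 8 (λ a a′ b b′ c c′ d d′ →
              a :- b :- (c :- d) :- ((a′ :+ a) :- (b′ :+ b) :- ((c′ :+ c) :- (d′ :+ d)))
                :+ (a′ :- b′ :- (c′ :- d′)) := con 0ℚ) refl
            (w (x + e + E)) (w (x - e + E)) (w (x + e - E)) (w (x - e - E))
            (w (x + e - B + E)) (w (x - e - B + E)) (w (x + e - B - E)) (w (x - e - B - E)))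
        where
        E~2e = ~-trans E~e (~-double e)
        w = wave (+ 2 * e)
        double₁ : ∀ s → wave e (x + s) ≡ w (x - e + s) ℚ.+ w (x + e + s)
        double₁ s = trans (wave-double (x + s) (~-unit E~e))
          (cong₂ (λ p q → w p ℚ.+ w q) (lem₁ x e s) (lem₂ x e s))
          where
          lem₁ : ∀ x e s → x + s - e ≡ x - e + s
          lem₁ = solve-∀
          lem₂ : ∀ x e s → x + s + e ≡ x + e + s
          lem₂ = solve-∀
        double₂ : ∀ s → wave e (x - B + s) ≡ w (x - e - B + s) ℚ.+ w (x + e - B + s)
        double₂ s = trans (wave-double (x - B + s) (~-unit E~e))
          (cong₂ (λ p q → w p ℚ.+ w q) (lem₁ x B e s) (lem₂ x B e s))
          where
          lem₁ : ∀ x b e s → x - b + s - e ≡ x - e - b + s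
          lem₁ = solve-∀
          lem₂ : ∀ x b e s → x - b + s + e ≡ x + e - b + s
          lem₂ = solve-∀

      cycleAt : Triple n → ℚ
      cycleAt (i , j , k) = chain F i j k

      middleTerm-F : ∀ x y z → ¬ Mid x y z → middleTerm F x y z ≡ 0ℚ
      middleTerm-F x y z ¬mid with D? (shape x y z) | ~? (⟦ y ⟧ - ⟦ x ⟧)
      ... | no  _ | _ = ℚ.*-zeroˡ (F ⟦ y ⟧ (⟦ y ⟧ - ⟦ x ⟧))
      ... | yes _ | no E≁ = trans (cong (1ℚ ℚ.*_) (F-out ⟦ y ⟧ E≁)) refl
      ... | yes s | yes E~ = contradiction (middle s (~-Good nt E~)) ¬mid

      chain-nonface : ∀ {i j k} → ¬ AP3 i j k → chain F i j k ≡ 0ℚ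
      chain-nonface {i} {j} {k} ¬ap = trans
        (cong₂ ℚ._+_ (cong₂ ℚ._+_ (middleTerm-F i j k (¬ap ∘ inj₁))
          (middleTerm-F j k i (¬ap ∘ inj₂ ∘ inj₁))) (middleTerm-F k i j (¬ap ∘ inj₂ ∘ inj₂))) refl

      chain-closed : ∀ u v → Σ[ chain F u v ] ≡ 0ℚ
      chain-closed u v = trans
        (chain-sum F-progression u v y e
          (D-lin (- U) D-half (lem₁ U V half)) (D-lin (- V) D-half (lem₂ U V half)))
        (F-relation y e)
        where
        U = ⟦ u ⟧
        V = ⟦ v ⟧
        -- Midpoint and half-difference modulo `n`, which write the edge as `(y - e , y + e)`.
        y = half * (U + V)
        e = half * (V - U)
        lem₁ : ∀ u v h → u - (h * (u + v) - h * (v - u)) ≡ - u * (+ 2 * h - + 1)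
        lem₁ = solve-∀
        lem₂ : ∀ u v h → v - (h * (u + v) + h * (v - u)) ≡ - v * (+ 2 * h - + 1)
        lem₂ = solve-∀

      -- `chain F` is 0 on sorted triples that are not faces, so cutting it down to a complete list
      -- of faces changes nothing on sorted triples. Antisymmetrizing the result gives `chain F`
      -- back, whose sums over the third vertex are 0.
      cycleAt-closed : ∀ {S} → Unique S → All (IsFace n) S → (∀ {t} → IsFace n t → t ∈ S) →
                ∀ u v → boundary S cycleAt u v ≡ 0ℚ
      cycleAt-closed {S} S-unique S-faces S-complete = cycle sorted cycleAt λ u v →
        trans (sum-cong vertices λ {w} _ → alt≡chain u v w) (chain-closed u v)
        where
        sorted : All Sorted S
        sorted = All.map IsFace⇒Sorted S-faces
        agree : ∀ i j k → i < j → j < k → alt (coef S cycleAt) i j k ≡ chain F i j k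
        agree i j k i<j j<k = trans
          (alt-sorted (coef S cycleAt) (coef-unsorted sorted cycleAt) i<j j<k) (on-faces (isFace? n (i , j , k)))
          where
          on-faces : Dec (IsFace n (i , j , k)) → coef S cycleAt (i , j , k) ≡ chain F i j k
          on-faces (yes f) = coef-∈ {c = cycleAt} S-unique (S-complete f)
          on-faces (no ¬f) = trans
            (coef-∉ {c = cycleAt} (λ t∈ → ¬f (All.lookup S-faces t∈)))
            (sym (chain-nonface {i} {j} {k} λ ap → ¬f (AP3⇒IsFace (i<j , j<k) ap)))
        alt≡chain : ∀ u v w → alt (coef S cycleAt) u v w ≡ chain F u v w
        alt≡chain = alternating-ext (alt-alternating (coef S cycleAt)) (chain-alternating F-progression) agree

      module _ {b d : Fin n} (nt′ : NontrivialRep d) where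

        private
          x = ρ (⟦ b ⟧ - ⟦ d ⟧)
          y = ρ (⟦ b ⟧ + ⟦ d ⟧)

        chain-at : chain F x b y ≡ F ⟦ b ⟧ ⟦ d ⟧
        chain-at = trans
          (chain-middle F-progression {x} {b} {y} (face-x≢b b d nt′) (face-b≢z b d nt′) (face-x≢z b d nt′) (face-shape b d nt′))
          (ProgressionFunction.periodic F-progression {⟦ b ⟧} {⟦ b ⟧} {⟦ b ⟧ - ⟦ x ⟧} {⟦ d ⟧}
            (subst D (sym (ℤ.+-inverseʳ ⟦ b ⟧)) D-0) (face-diff b d nt′))

        cycleAt-face : ∀ {t} → FaceAt b d t → F ⟦ b ⟧ ⟦ d ⟧ ≡ 0ℚ → cycleAt t ≡ 0ℚ
        cycleAt-face {i , j , k} (faceAt _ p) eq =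
          [ (λ f → trans (f {chain F} chain-alt) (trans chain-at eq))
          , (λ f → trans (f {chain F} chain-alt) (cong ℚ.-_ (trans chain-at eq))) ]′
          (↝-sign {x} {b} {y} {i} {j} {k} p)
          where
          chain-alt = chain-alternating F-progression

        cycleAt-face⁻¹ : ∀ {t} → FaceAt b d t → cycleAt t ≡ 0ℚ → F ⟦ b ⟧ ⟦ d ⟧ ≡ 0ℚ
        cycleAt-face⁻¹ {i , j , k} (faceAt _ p) eq =
          trans (sym chain-at) (↝-zero {x} {b} {y} {i} {j} {k} {chain F} (chain-alternating F-progression) p eq)

      -- The value is `2 + 2(n - 1) = 2n`, presented as `fromℕ` of a successor.
      F-diagonal : IsUnit n b₀ → F B E ≢ 0ℚ
      F-diagonal u eq = fromℕ-suc≢0 (suc m ℕ.+ suc (suc m)) (begin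
        fromℕ (suc (suc m ℕ.+ suc (suc m)))
          ≡⟨ trans (cong (1ℚ ℚ.+_) (trans (fromℕ-+ (suc m) (suc (suc m))) refl)) refl ⟩
        1ℚ ℚ.+ (N ℚ.+ (1ℚ ℚ.+ N))
          ≡⟨ solve 1 (λ N → con 1ℚ :+ (N :+ (con 1ℚ :+ N)) := con 1ℚ :+ con 1ℚ :- :- (N :+ N)) refl N ⟩
        1ℚ ℚ.+ 1ℚ ℚ.- ℚ.- (N ℚ.+ N)
          ≡⟨ sym (cong₂ ℚ._-_ (wave-step B unit (nonzero-D u))
               (wave-jump (B - B) unit (subst D (sym (ℤ.+-inverseʳ B)) D-0))) ⟩
        waves B E
          ≡⟨ sym (F-in B ~-refl) ⟩
        F B E
          ≡⟨ eq ⟩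
        0ℚ ∎)

      -- If `d` lies in another coset, `F` is 0 by definition. Otherwise `d = d₀` by minimality, so
      -- `b` differs from `b₀` and also from 0, the only two places where a jump of the wave enters.
      -- The two ordinary increments cancel.
      F-off-diagonal : ∀ {b d} → NontrivialRep d → IsUnit n b → (b , d) ≢ (b₀ , d₀) → F ⟦ b ⟧ ⟦ d ⟧ ≡ 0ℚ
      F-off-diagonal {b} {d} nt′ u ne with ~? ⟦ d ⟧
      ... | no E≁d = F-out ⟦ b ⟧ E≁d
      ... | yes E~d with MinRep-unique minRep (NontrivialRep.minRep nt′) E~d
      ...   | refl = trans (F-in ⟦ b ⟧ E~d) (trans
          (cong₂ ℚ._-_ (wave-step ⟦ b ⟧ unit (nonzero-D u))
            (wave-step (⟦ b ⟧ - B) unit λ db → ne (cong (_, d₀) (⟦⟧-injective db))))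
          refl)

  -- Vanishing of cycles that avoid the pivot faces

  module Vanishing (m : ℕ) (pr : Prime (suc (suc m))) (3<n : 3 ℕ.< suc (suc m)) where

    open Residues m pr 3<n
    open Progressions m pr 3<n
    open Chains n
    open ProgressionChains m pr 3<n
    open Representatives m pr 3<n
    open Cycles m pr 3<n

    -- The indicator of the graph `w = y + a`, weighted by `f w`, is summed in both orders; each row
    -- and each column meets the graph exactly once.
    Σ-shift : ∀ (f : Fin n → ℚ) a → Σ[ (λ y → f (ρ (⟦ y ⟧ + a))) ] ≡ Σ[ f ]
    Σ-shift f a = begin
      Σ[ (λ y → f (ρ (⟦ y ⟧ + a))) ]
        ≡⟨ sum-cong vertices (λ {y} _ → sym (trans
             (Σ-single {λ w → 𝟙 (w Fin.≟ s y) ℚ.* f w} (s y) λ w ne →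
               trans (cong (ℚ._* f w) (𝟙-no (w Fin.≟ s y) ne)) (ℚ.*-zeroˡ (f w)))
             (trans (cong (ℚ._* f (s y)) (𝟙-yes (s y Fin.≟ s y) refl)) (ℚ.*-identityˡ (f (s y)))))) ⟩
      Σ[ (λ y → Σ[ (λ w → 𝟙 (w Fin.≟ s y) ℚ.* f w) ]) ]
        ≡⟨ sum-swap (λ y w → 𝟙 (w Fin.≟ s y) ℚ.* f w) vertices vertices ⟩
      Σ[ (λ w → Σ[ (λ y → 𝟙 (w Fin.≟ s y) ℚ.* f w) ]) ]
        ≡⟨ sum-cong vertices (λ {w} _ → trans
             (Σ-single {λ y → 𝟙 (w Fin.≟ s y) ℚ.* f w} (r w) λ y ne →
               trans (cong (ℚ._* f w) (𝟙-no (w Fin.≟ s y) λ { refl → ne (sym (r∘s y)) })) (ℚ.*-zeroˡ (f w)))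
             (trans (cong (ℚ._* f w) (𝟙-yes (w Fin.≟ s (r w)) (sym (s∘r w)))) (ℚ.*-identityˡ (f w)))) ⟩
      Σ[ f ] ∎
      where
      s r : Fin n → Fin n
      s y = ρ (⟦ y ⟧ + a)
      r w = ρ (⟦ w ⟧ - a)
      r∘s : ∀ y → r (s y) ≡ y
      r∘s y = ρ-≡ (D-lin (+ 1) (⟦ρ⟧ (⟦ y ⟧ + a)) (lem ⟦ s y ⟧ ⟦ y ⟧ a))
        where
        lem : ∀ w y a → w - a - y ≡ + 1 * (w - (y + a))
        lem = solve-∀
      s∘r : ∀ w → s (r w) ≡ w
      s∘r w = ρ-≡ (D-lin (+ 1) (⟦ρ⟧ (⟦ w ⟧ - a)) (lem ⟦ r w ⟧ ⟦ w ⟧ a))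
        where
        lem : ∀ y w a → y + a - w ≡ + 1 * (y - (w - a))
        lem = solve-∀

    ↝-AP3⁻¹ : ∀ {x y z x′ y′ z′} → (x , y , z) ↝ (x′ , y′ , z′) → AP3 x′ y′ z′ → AP3 x y z
    ↝-AP3⁻¹ done    = λ ap → ap
    ↝-AP3⁻¹ (rot p) = ↝-AP3⁻¹ p ∘ AP3-rotate ∘ AP3-rotate
    ↝-AP3⁻¹ (swp p) = ↝-AP3⁻¹ p ∘ AP3-swap

    record Relation (F : ℤ → ℤ → ℚ) : Set where
      field
        progression : ProgressionFunction F
        relation    : ∀ y e → F (y + e) (+ 2 * e) ℚ.- F y e ℚ.+ F (y - e) (+ 2 * e) ≡ 0ℚ

      open ProgressionFunction progression

      relation′ : ∀ y e → F y e ≡ F (y + e) (+ 2 * e) ℚ.+ F (y - e) (+ 2 * e)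
      relation′ y e = begin
        F y e
          ≡⟨ solve 3 (λ a b c → b := (a :+ c) :- (a :- b :+ c)) refl
               (F (y + e) (+ 2 * e)) (F y e) (F (y - e) (+ 2 * e)) ⟩
        F (y + e) (+ 2 * e) ℚ.+ F (y - e) (+ 2 * e) ℚ.- (F (y + e) (+ 2 * e) ℚ.- F y e ℚ.+ F (y - e) (+ 2 * e))
          ≡⟨ cong (λ q → F (y + e) (+ 2 * e) ℚ.+ F (y - e) (+ 2 * e) ℚ.- q) (relation y e) ⟩
        F (y + e) (+ 2 * e) ℚ.+ F (y - e) (+ 2 * e) ℚ.- 0ℚ
          ≡⟨ ℚ.+-identityʳ _ ⟩
        F (y + e) (+ 2 * e) ℚ.+ F (y - e) (+ 2 * e) ∎

      D-≡ : ∀ {a b} → a ≡ b → D (a - b)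
      D-≡ {a} refl = subst D (sym (ℤ.+-inverseʳ a)) D-0

      F-ρ : ∀ b e → F b e ≡ F ⟦ ρ b ⟧ e
      F-ρ b e = periodic (D-lin (- + 1) (⟦ρ⟧ b) (lem b ⟦ ρ b ⟧)) (D-≡ {e} refl)
        where
        lem : ∀ b r → b - r ≡ - + 1 * (r - b)
        lem = solve-∀

      total : ℤ → ℚ
      total e = Σ[ (λ y → F ⟦ y ⟧ e) ]

      total-shift : ∀ a e → Σ[ (λ y → F (⟦ y ⟧ + a) e) ] ≡ total e
      total-shift a e = trans (sum-cong vertices λ {y} _ → F-ρ (⟦ y ⟧ + a) e)
                              (Σ-shift (λ y → F ⟦ y ⟧ e) a)

      total-double : ∀ e → total e ≡ fromℕ 2 ℚ.* total (+ 2 * e)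
      total-double e = begin
        total e
          ≡⟨ sum-cong vertices (λ {y} _ → relation′ ⟦ y ⟧ e) ⟩
        Σ[ (λ y → F (⟦ y ⟧ + e) (+ 2 * e) ℚ.+ F (⟦ y ⟧ - e) (+ 2 * e)) ]
          ≡⟨ sum-+ (λ y → F (⟦ y ⟧ + e) (+ 2 * e)) (λ y → F (⟦ y ⟧ - e) (+ 2 * e)) vertices ⟩
        Σ[ (λ y → F (⟦ y ⟧ + e) (+ 2 * e)) ] ℚ.+ Σ[ (λ y → F (⟦ y ⟧ - e) (+ 2 * e)) ]
          ≡⟨ cong₂ ℚ._+_ (total-shift e (+ 2 * e)) (total-shift (- e) (+ 2 * e)) ⟩
        total (+ 2 * e) ℚ.+ total (+ 2 * e)
          ≡⟨ solve 1 (λ t → t :+ t := (con 1ℚ :+ (con 1ℚ :+ con 0ℚ)) :* t) refl (total (+ 2 * e)) ⟩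
        fromℕ 2 ℚ.* total (+ 2 * e) ∎

      total-pow : ∀ k e → total e ≡ fromℕ (2 ℕ.^ k) ℚ.* total (pow k * e)
      total-pow zero e = sym (trans (cong (λ q → q ℚ.* total (pow 0 * e)) (ℚ.+-identityʳ 1ℚ))
        (trans (ℚ.*-identityˡ _) (cong total (ℤ.*-identityˡ e))))
      total-pow (suc k) e = begin
        total e
          ≡⟨ total-pow k e ⟩
        fromℕ (2 ℕ.^ k) ℚ.* total (pow k * e)
          ≡⟨ cong (fromℕ (2 ℕ.^ k) ℚ.*_) (total-double (pow k * e)) ⟩
        fromℕ (2 ℕ.^ k) ℚ.* (fromℕ 2 ℚ.* total (+ 2 * (pow k * e)))
          ≡⟨ cong (λ x → fromℕ (2 ℕ.^ k) ℚ.* (fromℕ 2 ℚ.* total x))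
               (trans (sym (ℤ.*-assoc (+ 2) (pow k) e)) (cong (_* e) (sym (pow-suc k)))) ⟩
        fromℕ (2 ℕ.^ k) ℚ.* (fromℕ 2 ℚ.* total (pow (suc k) * e))
          ≡⟨ solve 2 (λ a t → a :* ((con 1ℚ :+ (con 1ℚ :+ con 0ℚ)) :* t) := (a :+ (a :+ con 0ℚ)) :* t) refl
               (fromℕ (2 ℕ.^ k)) (total (pow (suc k) * e)) ⟩
        (fromℕ (2 ℕ.^ k) ℚ.+ (fromℕ (2 ℕ.^ k) ℚ.+ 0ℚ)) ℚ.* total (pow (suc k) * e)
          ≡⟨ cong (ℚ._* total (pow (suc k) * e)) (sym (trans (fromℕ-+ (2 ℕ.^ k) (2 ℕ.^ k ℕ.+ 0))
               (cong (fromℕ (2 ℕ.^ k) ℚ.+_) (fromℕ-+ (2 ℕ.^ k) 0)))) ⟩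
        fromℕ (2 ℕ.^ suc k) ℚ.* total (pow (suc k) * e) ∎

      -- The total is invariant under e ↦ 2^k e for k the order of 2, and scaled by 2^k.
      total-zero : ∀ e → total e ≡ 0ℚ
      total-zero e = x*y≡0⇒y≡0 (fromℕ-suc≢0 (r ℕ.+ r)) (begin
          fromℕ (suc (r ℕ.+ r)) ℚ.* t
            ≡⟨ solve 2 (λ a t → a :* t := (con 1ℚ :+ a) :* t :- t) refl (fromℕ (suc (r ℕ.+ r))) t ⟩
          (1ℚ ℚ.+ fromℕ (suc (r ℕ.+ r))) ℚ.* t ℚ.- t
            ≡⟨ cong (λ k → fromℕ k ℚ.* t ℚ.- t) 2^ ⟩
          fromℕ (2 ℕ.^ suc p) ℚ.* t ℚ.- t
            ≡⟨ cong (ℚ._- t) (sym fixed) ⟩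
          t ℚ.- t
            ≡⟨ ℚ.+-inverseʳ t ⟩
          0ℚ ∎)
        where
        p = proj₁ order
        -- Here `r = 2^p - 1`, so the factor `2^(p + 1) - 1` to be cancelled is the successor
        -- `suc (r + r)`.
        r = proj₁ (ℕ.m≤n⇒∃[o]m+o≡n (ℕ.m^n>0 2 p))
        1+r≡ = proj₂ (ℕ.m≤n⇒∃[o]m+o≡n (ℕ.m^n>0 2 p))
        t = total e
        lem : ∀ q e → q * e - e ≡ e * (q - + 1)
        lem = solve-∀
        fixed : t ≡ fromℕ (2 ℕ.^ suc p) ℚ.* t
        fixed = trans (total-pow (suc p) e) (cong (fromℕ (2 ℕ.^ suc p) ℚ.*_)
          (sum-cong vertices λ {y} _ → periodic (D-≡ {⟦ y ⟧} refl) (D-lin e (proj₂ (proj₂ order)) (lem (pow (suc p)) e))))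
        2^ : suc (suc (r ℕ.+ r)) ≡ 2 ℕ.^ suc p
        2^ = trans (cong suc (trans (sym (ℕ.+-suc r r)) (cong (r ℕ.+_) (sym (ℕ.+-identityʳ (suc r))))))
                   (cong (λ k → k ℕ.+ (k ℕ.+ 0)) 1+r≡)

      halve : ∀ e → (∀ b → F b (+ 2 * e) ≡ 0ℚ) → ∀ b → F b e ≡ 0ℚ
      halve e eq b = trans (relation′ b e) (cong₂ ℚ._+_ (eq (b + e)) (eq (b - e)))

      halve-pow : ∀ k e → (∀ b → F b (e * pow k) ≡ 0ℚ) → ∀ b → F b e ≡ 0ℚ
      halve-pow zero    e eq b = trans (cong (F b) (sym (ℤ.*-identityʳ e))) (eq b)
      halve-pow (suc k) e eq = halve e (halve-pow k (+ 2 * e) λ b → trans (cong (F b) (begin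
        + 2 * e * pow k   ≡⟨ lem (+ 2) e (pow k) ⟩
        e * (+ 2 * pow k) ≡⟨ cong (e *_) (sym (pow-suc k)) ⟩
        e * pow (suc k)   ∎)) (eq b))
        where
        lem : ∀ t e p → t * e * p ≡ e * (t * p)
        lem = solve-∀

      -- The relation carries vanishing from `2e` back to `e`. This is the direction at hand:
      -- `e ~ d` leads from `e` by `k` doublings to `d` up to sign, and oddness absorbs the sign.
      ~-vanishing : ∀ {e d} → e ~ d → (∀ b → F b d ≡ 0ℚ) → ∀ b → F b e ≡ 0ℚ
      ~-vanishing {e} {d} (via k (inj₁ p)) eq = halve-pow k e λ b →
        trans (periodic (D-≡ {b} refl) (D-lin (- + 1) p (lem (e * pow k) d))) (eq b)
        where
        lem : ∀ x d → x - d ≡ - + 1 * (d - x)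
        lem = solve-∀
      ~-vanishing {e} {d} (via k (inj₂ p)) eq = halve-pow k e λ b →
        trans (periodic {b} {b} {e * pow k} { - d} (D-≡ {b} refl) (D-lin (+ 1) p (lem (e * pow k) d)))
              (trans (odd-in-d b d) (cong ℚ.-_ (eq b)))
        where
        lem : ∀ x d → x - - d ≡ + 1 * (d - - x)
        lem = solve-∀

      vanishing : (∀ b → F b (+ 1) ≡ 0ℚ) →
        (∀ {d} → NontrivialRep d → ∀ b → IsUnit n b → F ⟦ b ⟧ ⟦ d ⟧ ≡ 0ℚ) →
        ∀ e → ¬ D e → ∀ b → F b e ≡ 0ℚ
      vanishing at-one at-reps e ¬de = fromRep (representative-ℤ e ¬de)
        where
        at-rep : ∀ {d} → NontrivialRep d → ∀ b → F ⟦ b ⟧ ⟦ d ⟧ ≡ 0ℚ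
        at-rep nt b@(Fin.suc _) = at-reps nt b (λ ())
        -- The values at all other vertices vanish, so the value at 0 is the whole total.
        at-rep {d} nt Fin.zero = trans
          (sym (Σ-single {λ y → F ⟦ y ⟧ ⟦ d ⟧} Fin.zero λ
            { Fin.zero ne → contradiction refl ne ; y@(Fin.suc _) _ → at-reps nt y (λ ()) }))
          (total-zero ⟦ d ⟧)
        fromRep : (∃ λ d → MinRep n d × e ~ ⟦ d ⟧) → ∀ b → F b e ≡ 0ℚ
        fromRep (d , md , e~d) = case-one (d Fin.≟ one)
          where
          case-one : Dec (d ≡ one) → ∀ b → F b e ≡ 0ℚ
          case-one (yes refl) = ~-vanishing e~d at-one
          case-one (no d≢1)   = ~-vanishing e~d λ b →
            trans (F-ρ b ⟦ d ⟧) (at-rep (nontrivial md d≢1) (ρ b))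

    -- Independence of a list of faces that avoids the pivots

    module _ {S : List (Triple n)} (S-unique : Unique S) (S-faces : All (IsFace n) S)
      (avoids : ∀ {b d} → NontrivialRep d → IsUnit n b → ∃ λ t → FaceAt b d t × t ∉ S)
      (c : Triple n → ℚ) (closed : ∀ u v → boundary S c u v ≡ 0ℚ) where

      private
        sorted : All Sorted S
        sorted = All.map IsFace⇒Sorted S-faces

        g : Triple n → ℚ
        g = coef S c

        a : Function₃
        a = alt g

        a-alternating : Alternating a
        a-alternating = alt-alternating g

        a-sorted : ∀ {i j k} → Sorted (i , j , k) → a i j k ≡ g (i , j , k)
        a-sorted (i<j , j<k) = alt-sorted g (coef-unsorted sorted c) i<j j<k

        a-∉ : ∀ {i j k} → Sorted (i , j , k) → (i , j , k) ∉ S → a i j k ≡ 0ℚ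
        a-∉ s t∉ = trans (a-sorted s) (coef-∉ {S} {c} t∉)

        G : ℤ → ℤ → ℚ
        G = profile a

        a≡chain : ∀ x y z → a x y z ≡ chain G x y z
        a≡chain = chain-profile a-alternating λ x y z x<y y<z ¬p ¬q ¬r →
          a-∉ (x<y , y<z) λ t∈ → no-progression ¬p ¬q ¬r (IsFace⇒AP3 (All.lookup S-faces t∈))
          where
          no-progression : ∀ {x y z} → ¬ D (shape x y z) → ¬ D (shape y z x) → ¬ D (shape z x y) → ¬ AP3 x y z
          no-progression ¬p _ _ (inj₁ (middle p _))        = ¬p p
          no-progression _ ¬q _ (inj₂ (inj₁ (middle q _))) = ¬q q
          no-progression _ _ ¬r (inj₂ (inj₂ (middle r _))) = ¬r r

        G-relation : Relation G
        G-relation = record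
          { progression = profile-progression a-alternating
          ; relation = λ y e → begin
              G (y + e) (+ 2 * e) ℚ.- G y e ℚ.+ G (y - e) (+ 2 * e)
                ≡⟨ sym (chain-sum (profile-progression a-alternating) (ρ (y - e)) (ρ (y + e)) y e
                     (⟦ρ⟧ (y - e)) (⟦ρ⟧ (y + e))) ⟩
              Σ[ chain G (ρ (y - e)) (ρ (y + e)) ]
                ≡⟨ sum-cong vertices (λ {w} _ → sym (a≡chain (ρ (y - e)) (ρ (y + e)) w)) ⟩
              Σ[ a (ρ (y - e)) (ρ (y + e)) ]
                ≡⟨ cycle⁻¹ sorted c closed (ρ (y - e)) (ρ (y + e)) ⟩
              0ℚ ∎
          }

        a-nonprogression : ∀ {x y z} → x ≢ y → y ≢ z → x ≢ z → ¬ AP3 x y z → a x y z ≡ 0ℚ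
        a-nonprogression {x} {y} {z} x≢y y≢z x≢z ¬ap = fromSorted (sort x y z x≢y y≢z x≢z)
          where
          fromSorted : (∃ λ t → Sorted t × (x , y , z) ↝ t) → a x y z ≡ 0ℚ
          fromSorted ((i , j , k) , s , p) = ↝-zero {x} {y} {z} {i} {j} {k} {a} a-alternating p
            (a-∉ s λ t∈ → ¬ap (↝-AP3⁻¹ {x} {y} {z} {i} {j} {k} p (IsFace⇒AP3 (All.lookup S-faces t∈))))

        -- The vertices `b - 1`, `b`, `b + 1` do form a progression around `b`, but with the
        -- excluded difference 1, and `unique-middle` forbids a progression around another of them.
        -- Hence they span no face.
        G-one : ∀ b → G b (+ 1) ≡ 0ℚ
        G-one b = a-nonprogression x≢y y≢z x≢z not-AP3
          where
          x = ρ (b - + 1)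
          y = ρ b
          z = ρ (b + + 1)
          dx = ⟦ρ⟧ (b - + 1)
          dy = ⟦ρ⟧ b
          dz = ⟦ρ⟧ (b + + 1)
          x≢y : x ≢ y
          x≢y eq = ¬D-1 (D-lin (- + 1) (ρ-D {b - + 1} {b} eq) (lem b))
            where
            lem : ∀ b → + 1 ≡ - + 1 * (b - + 1 - b)
            lem = solve-∀
          y≢z : y ≢ z
          y≢z eq = ¬D-1 (D-lin (- + 1) (ρ-D {b} {b + + 1} eq) (lem b))
            where
            lem : ∀ b → + 1 ≡ - + 1 * (b - (b + + 1))
            lem = solve-∀
          x≢z : x ≢ z
          x≢z eq = ¬D-2 (D-lin (- + 1) (ρ-D {b - + 1} {b + + 1} eq) (lem b))
            where
            lem : ∀ b → + 2 ≡ - + 1 * (b - + 1 - (b + + 1))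
            lem = solve-∀
          y-middle : D (⟦ x ⟧ + ⟦ z ⟧ - + 2 * ⟦ y ⟧)
          y-middle = D-lin₃ (+ 1) (+ 1) (- + 2) dx dz dy (lem ⟦ x ⟧ ⟦ y ⟧ ⟦ z ⟧ b)
            where
            lem : ∀ x y z b → x + z - + 2 * y ≡ + 1 * (x - (b - + 1)) + + 1 * (z - (b + + 1)) + - + 2 * (y - b)
            lem = solve-∀
          not-AP3 : ¬ AP3 x y z
          not-AP3 (inj₁ (middle _ (_ , ¬d₁ , _))) =
            ¬d₁ (D-lin₂ (+ 1) (- + 1) dy dx (lem ⟦ x ⟧ ⟦ y ⟧ b))
            where
            lem : ∀ x y b → y - x - + 1 ≡ + 1 * (y - b) + - + 1 * (x - (b - + 1))
            lem = solve-∀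
          not-AP3 (inj₂ (inj₁ (middle s _))) = unique-middle {x} {y} {z} y≢z y-middle s
          not-AP3 (inj₂ (inj₂ (middle s _))) = unique-middle {z} {x} {y} x≢y s y-middle

        G-reps : ∀ {d} → NontrivialRep d → ∀ b → IsUnit n b → G ⟦ b ⟧ ⟦ d ⟧ ≡ 0ℚ
        G-reps {d} nt b u = trans (cong (λ y → a x y z) (ρ-⟦⟧ b)) (at-face (avoids nt u))
          where
          x = ρ (⟦ b ⟧ - ⟦ d ⟧)
          z = ρ (⟦ b ⟧ + ⟦ d ⟧)
          at-face : (∃ λ t → FaceAt b d t × t ∉ S) → a x b z ≡ 0ℚ
          at-face ((i , j , k) , faceAt isFace p , t∉) =
            ↝-zero {x} {b} {z} {i} {j} {k} {a} a-alternating p (a-∉ (IsFace⇒Sorted isFace) t∉)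

        G-zero : ∀ e → ¬ D e → ∀ b → G b e ≡ 0ℚ
        G-zero = Relation.vanishing G-relation G-one G-reps

        a-middle : ∀ {x y z} → Mid x y z → a x y z ≡ 0ℚ
        a-middle {x} {y} {z} (middle s (¬d , _)) = trans
          (sym (profile-middle a-alternating x y z s)) (G-zero (⟦ y ⟧ - ⟦ x ⟧) ¬d ⟦ y ⟧)

        a-AP3 : ∀ {x y z} → AP3 x y z → a x y z ≡ 0ℚ
        a-AP3 (inj₁ p) = a-middle p
        a-AP3 {x} {y} {z} (inj₂ (inj₁ p)) = trans (sym (Alternating.rotate a-alternating x y z)) (a-middle p)
        a-AP3 {x} {y} {z} (inj₂ (inj₂ p)) = trans (Alternating.rotate a-alternating z x y) (a-middle p)

      -- Applied to two lists: the faces that are not pivots, which gives the lower bound on the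
      -- rank, and all faces when -1 and 2 generate the units, where `avoids` is vacuous for want of
      -- nontrivial representatives.
      cycle-vanishes : All (λ t → c t ≡ 0ℚ) S
      cycle-vanishes = All.tabulate λ {t} t∈ → on-face t t∈ (All.lookup S-faces t∈)
        where
        on-face : ∀ t → t ∈ S → IsFace n t → c t ≡ 0ℚ
        on-face (i , j , k) t∈ f = trans (sym (coef-∈ {c = c} S-unique t∈))
          (trans (sym (a-sorted (IsFace⇒Sorted f))) (a-AP3 (IsFace⇒AP3 f)))

  -- The rank of X_n

  faces-unique : ∀ n → Unique (faces n)
  faces-unique n = Unique.filter⁺ (isFace? n) (Unique.cartesianProduct⁺ (Unique.allFin⁺ n)
    (Unique.cartesianProduct⁺ (Unique.allFin⁺ n) (Unique.allFin⁺ n)))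

  ∈-faces : ∀ n {t} → IsFace n t → t ∈ faces n
  ∈-faces n {i , j , k} = ∈-filter⁺ (isFace? n)
    (∈-cartesianProduct⁺ (∈-allFin i) (∈-cartesianProduct⁺ (∈-allFin j) (∈-allFin k)))

  faces-IsFace : ∀ n → All (IsFace n) (faces n)
  faces-IsFace n = All.tabulate λ t∈ → proj₂ (∈-filter⁻ (isFace? n) {xs = allTriples n} t∈)

  module Rank (m : ℕ) (pr : Prime (suc (suc m))) (3<n : 3 ℕ.< suc (suc m)) where

    open Residues m pr 3<n
    open Chains n
    open Representatives m pr 3<n
    open Cycles m pr 3<n
    open Vanishing m pr 3<n

    abstract
      nontrivialRep? : ∀ d → Dec (NontrivialRep d)
      nontrivialRep? d = map′ (λ (md , ne) → nontrivial md ne)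
        (λ nt → NontrivialRep.minRep nt , NontrivialRep.d≢one nt)
        (minRep? n d ×-dec ¬? (d Fin.≟ one))

    Q : Set
    Q = Fin n × Fin n

    nonzero : List (Fin n)
    nonzero = tabulate Fin.suc

    large : List (Fin n)
    large = tabulate λ i → Fin.suc (Fin.suc i)

    reps : List (Fin n)
    reps = filter (minRep? n) large

    params : List Q
    params = cartesianProduct nonzero reps

    index≡ : index n ≡ suc (length reps)
    index≡ = cong length (trans
      (filter-reject (minRep? n) {Fin.zero} {one ∷ large} λ (u , _) → u refl)
      (filter-accept (minRep? n) {one} {large} MinRep-one))

    params-length : length params ≡ (n ℕ.∸ 1) ℕ.* (index n ℕ.∸ 1)
    params-length = trans (length-cartesianProduct nonzero reps)
      (cong₂ ℕ._*_ (length-tabulate {n = suc m} (Fin.suc {n = suc m})) (cong (ℕ._∸ 1) (sym index≡)))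

    params-unique : Unique params
    params-unique = Unique.cartesianProduct⁺ (Unique.tabulate⁺ {f = Fin.suc} Fin.suc-injective)
      (Unique.filter⁺ (minRep? n) (Unique.tabulate⁺ {f = λ i → Fin.suc (Fin.suc i)} (Fin.suc-injective ∘ Fin.suc-injective)))

    ∈-params⁺ : ∀ {b d} → IsUnit n b → NontrivialRep d → (b , d) ∈ params
    ∈-params⁺ u nt = ∈-cartesianProduct⁺ (∈-nonzero u)
      (∈-filter⁺ (minRep? n) (∈-large (NontrivialRep.minRep nt) (NontrivialRep.d≢one nt)) (NontrivialRep.minRep nt))
      where
      ∈-nonzero : ∀ {b} → IsUnit n b → b ∈ nonzero
      ∈-nonzero {Fin.zero}  u = contradiction refl u
      ∈-nonzero {Fin.suc i} _ = ∈-tabulate⁺ {f = Fin.suc} i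
      ∈-large : ∀ {d} → MinRep n d → d ≢ one → d ∈ large
      ∈-large {Fin.zero} (u , _) _ = contradiction refl u
      ∈-large {Fin.suc Fin.zero} _ ne = contradiction refl ne
      ∈-large {Fin.suc (Fin.suc i)} _ _ = ∈-tabulate⁺ {f = λ i → Fin.suc (Fin.suc i)} i

    ∈-params⁻ : ∀ {b d} → (b , d) ∈ params → IsUnit n b × NontrivialRep d
    ∈-params⁻ {b} {d} p = isUnit (proj₁ split) , isRep (∈-filter⁻ (minRep? n) {xs = large} (proj₂ split))
      where
      split = ∈-cartesianProduct⁻ nonzero reps p
      isUnit : ∀ {b} → b ∈ nonzero → IsUnit n b
      isUnit b∈ with ∈-tabulate⁻ {f = Fin.suc} b∈
      ... | _ , refl = λ ()
      isRep : ∀ {d} → d ∈ large × MinRep n d → NontrivialRep d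
      isRep (d∈ , md) with ∈-tabulate⁻ {f = λ i → Fin.suc (Fin.suc i)} d∈
      ... | _ , refl = nontrivial md λ ()

    module _ (b d : Fin n) where

      -- Parameters are bare pairs, so that equality on them is decidable and free of proofs; the
      -- pivot and the cycle then need default values at the other pairs. The decision is an
      -- argument so that each property is proved by splitting on it.
      pivotFrom : Dec (NontrivialRep d) → Triple n
      pivotFrom (yes nt) = proj₁ (face b d nt)
      pivotFrom (no _)   = b , b , b

      cycleFrom : Dec (NontrivialRep d) → Triple n → ℚ
      cycleFrom (yes nt) = cycleAt b d nt
      cycleFrom (no _) _ = 0ℚ

      pivotFrom-face : ∀ nt? → NontrivialRep d → FaceAt b d (pivotFrom nt?)
      pivotFrom-face (yes nt) _ = proj₂ (face b d nt)
      pivotFrom-face (no ¬nt) nt = contradiction nt ¬nt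

      cycleFrom-closed : ∀ {S} → Unique S → All (IsFace n) S → (∀ {t} → IsFace n t → t ∈ S) →
        ∀ nt? → NontrivialRep d → ∀ u v → boundary S (cycleFrom nt?) u v ≡ 0ℚ
      cycleFrom-closed a f c (yes nt) _ = cycleAt-closed b d nt a f c
      cycleFrom-closed a f c (no ¬nt) nt = contradiction nt ¬nt

      cycleFrom-diagonal : ∀ {t} nt? → NontrivialRep d → IsUnit n b → FaceAt b d t → cycleFrom nt? t ≢ 0ℚ
      cycleFrom-diagonal (yes nt) _ u f eq = F-diagonal b d nt u (cycleAt-face⁻¹ b d nt nt f eq)
      cycleFrom-diagonal (no ¬nt) nt _ _ _ = ¬nt nt

      cycleFrom-off-diagonal : ∀ {b′ d′ t} nt? → NontrivialRep d′ → IsUnit n b′ → FaceAt b′ d′ t →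
        (b′ , d′) ≢ (b , d) → cycleFrom nt? t ≡ 0ℚ
      cycleFrom-off-diagonal (yes nt) nt′ u f ne = cycleAt-face b d nt nt′ f (F-off-diagonal b d nt nt′ u ne)
      cycleFrom-off-diagonal (no _)   _ _ _ _ = refl

    pivotOf : Q → Triple n
    pivotOf (b , d) = pivotFrom b d (nontrivialRep? d)

    ζ : Q → Triple n → ℚ
    ζ (b , d) = cycleFrom b d (nontrivialRep? d)

    pivot-face : ∀ {b d} → NontrivialRep d → FaceAt b d (pivotOf (b , d))
    pivot-face {b} {d} = pivotFrom-face b d (nontrivialRep? d)

    ζ-diagonal : ∀ {p} → p ∈ params → ζ p (pivotOf p) ≢ 0ℚ
    ζ-diagonal {b , d} p∈ with u , nt ← ∈-params⁻ p∈ =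
      cycleFrom-diagonal b d (nontrivialRep? d) nt u (pivot-face nt)

    ζ-off-diagonal : ∀ {p p′} → p ∈ params → p′ ∈ params → p ≢ p′ → ζ p (pivotOf p′) ≡ 0ℚ
    ζ-off-diagonal {b , d} {b′ , d′} _ p′∈ p≢p′ with u′ , nt′ ← ∈-params⁻ p′∈ =
      cycleFrom-off-diagonal b d (nontrivialRep? d) nt′ u′ (pivot-face nt′) (p≢p′ ∘ sym)

    module _ {Fs : List (Triple n)} (Fs-unique : Unique Fs) (Fs-faces : All (IsFace n) Fs)
             (Fs-complete : ∀ {t} → IsFace n t → t ∈ Fs) where

      pivot∈ : ∀ {p} → p ∈ params → pivotOf p ∈ Fs
      pivot∈ {b , d} p∈ = Fs-complete (FaceAt.isFace (pivot-face {b} {d} (proj₂ (∈-params⁻ p∈))))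

      ζ-cycle : ∀ {p} → p ∈ params → ∀ (e : Fin n × Fin n) →
                sumList Fs (λ s → ζ p s ℚ.* ∂₂ s (proj₁ e) (proj₂ e)) ≡ 0ℚ
      ζ-cycle {b , d} p∈ (u , v) =
        cycleFrom-closed b d Fs-unique Fs-faces Fs-complete (nontrivialRep? d) (proj₂ (∈-params⁻ p∈)) u v

      open Triangular _≟ₜ_ (≡-dec Fin._≟_ Fin._≟_) (λ t (u , v) → ∂₂ t u v) Fs-unique params-unique
        pivotOf pivot∈ ζ ζ-cycle ζ-diagonal ζ-off-diagonal
        renaming (nonpivots to basis; nonpivots-length to basis-length)

      upper-bound : ∀ {S} → Acyclic n S → length S ℕ.+ length params ℕ.≤ length Fs
      upper-bound (S-unique , S-faces , independent) = independent-length S-unique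
        (λ t∈ → Fs-complete (All.lookup S-faces t∈))
        (λ c eq → independent c λ u v → eq (u , v))

      basis-acyclic : Acyclic n basis
      basis-acyclic = nonpivots-unique , isFace , cycle-vanishes nonpivots-unique isFace avoids
        where
        isFace : All (IsFace n) basis
        isFace = All.tabulate λ t∈ → All.lookup Fs-faces (nonpivots⊆ t∈)
        avoids : ∀ {b d} → NontrivialRep d → IsUnit n b → ∃ λ t → FaceAt b d t × t ∉ basis
        avoids {b} {d} nt u = pivotOf (b , d) , pivot-face nt , λ t∈ →
          nonpivots-∉ t∈ (∈-map⁺ pivotOf (∈-params⁺ u nt))

      rank : RankIs n (length basis)
      rank = (basis , basis-acyclic , refl) , λ S acyclic →
        ℕ.+-cancelʳ-≤ (length params) (length S) (length basis)
          (subst (length S ℕ.+ length params ℕ.≤_) (sym basis-length) (upper-bound acyclic))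

      -- If all faces are independent, the upper bound leaves no room for parameters. A
      -- representative `d` other than 1 would supply the parameter `(1 , d)`, so every unit lies in
      -- the coset of 1.
      acyclic⇒generated : Acyclic n Fs → GeneratedByPM1And2 n
      acyclic⇒generated acyclic x u = fromRep (representative x u)
        where
        no-params : length params ≡ 0
        no-params = ℕ.n≤0⇒n≡0 (ℕ.+-cancelˡ-≤ (length Fs) (length params) 0
          (subst (length Fs ℕ.+ length params ℕ.≤_) (sym (ℕ.+-identityʳ (length Fs))) (upper-bound acyclic)))
        empty : ∀ {A : Set} {a : A} {xs} → length xs ≡ 0 → ¬ (a ∈ xs)
        empty {xs = []} _ ()
        only-one : ∀ {d} → MinRep n d → d ≡ one
        only-one {d} md = case-one (d Fin.≟ one)
          where
          case-one : Dec (d ≡ one) → d ≡ one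
          case-one (yes eq) = eq
          case-one (no ne)  = contradiction (∈-params⁺ {one} (λ ()) (nontrivial md ne)) (empty no-params)
        power : ∀ {x} → + 1 ~ ⟦ x ⟧ → ∃ λ k → (⟦ x ⟧ ≡ + (2 ℕ.^ k) [mod n ]) ⊎ (⟦ x ⟧ ≡ - (+ (2 ℕ.^ k)) [mod n ])
        power {x} (via k (inj₁ d)) = k , inj₁ (∣⇒∣ᵤ (subst (λ z → D (⟦ x ⟧ - z)) (ℤ.*-identityˡ (pow k)) d))
        power {x} (via k (inj₂ d)) = k , inj₂ (∣⇒∣ᵤ (subst (λ z → D (⟦ x ⟧ - - z)) (ℤ.*-identityˡ (pow k)) d))
        fromRep : (∃ λ d → MinRep n d × ⟦ x ⟧ ~ ⟦ d ⟧) →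
          ∃ λ k → (⟦ x ⟧ ≡ + (2 ℕ.^ k) [mod n ]) ⊎ (⟦ x ⟧ ≡ - (+ (2 ℕ.^ k)) [mod n ])
        fromRep (d , md , x~d) = power (~-sym (subst (λ y → ⟦ x ⟧ ~ ⟦ y ⟧) (only-one md) x~d))

      generated⇒acyclic : GeneratedByPM1And2 n → Acyclic n Fs
      generated⇒acyclic gen = Fs-unique , Fs-faces , cycle-vanishes Fs-unique Fs-faces
        λ nt _ → contradiction nt trivial
        where
        trivial : ∀ {d} → ¬ NontrivialRep d
        trivial {d} nt = NontrivialRep.≁1 nt (~-sym (from (gen d (proj₁ (NontrivialRep.minRep nt)))))
          where
          from : (∃ λ k → (⟦ d ⟧ ≡ + (2 ℕ.^ k) [mod n ]) ⊎ (⟦ d ⟧ ≡ - (+ (2 ℕ.^ k)) [mod n ])) → + 1 ~ ⟦ d ⟧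
          from (k , inj₁ e) = via k (inj₁ (subst (λ z → D (⟦ d ⟧ - z)) (sym (ℤ.*-identityˡ (pow k))) (∣ᵤ⇒∣ e)))
          from (k , inj₂ e) = via k (inj₂ (subst (λ z → D (⟦ d ⟧ - - z)) (sym (ℤ.*-identityˡ (pow k))) (∣ᵤ⇒∣ e)))

      rank-theorem :
        (Σ ℕ λ r → RankIs n r × r ℕ.+ (n ℕ.∸ 1) ℕ.* (index n ℕ.∸ 1) ≡ length Fs) ×
        (Acyclic n Fs ⇔ GeneratedByPM1And2 n)
      rank-theorem =
        (length basis , rank , trans (cong (length basis ℕ.+_) (sym params-length)) basis-length) ,
        mk⇔ acyclic⇒generated generated⇒acyclic

  -- Meant for `n = 2` and `n = 3`, where every residue is 0, 1 or -1 and no difference is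
  -- admissible. The complex then has no 2-faces and the only coset is that of 1, so both claims are
  -- about the empty list.
  no-faces : ∀ n → faces n ≡ [] → index n ≡ 1 → GeneratedByPM1And2 n →
    (Σ ℕ λ r → RankIs n r × r ℕ.+ (n ℕ.∸ 1) ℕ.* (index n ℕ.∸ 1) ≡ numFaces n) ×
    (Acyclic n (faces n) ⇔ GeneratedByPM1And2 n)
  no-faces n none ind gen =
    (0 , (([] , empty-acyclic , refl) , bound) ,
      trans (cong (λ k → (n ℕ.∸ 1) ℕ.* (k ℕ.∸ 1)) ind) (trans (ℕ.*-zeroʳ (n ℕ.∸ 1)) (sym (cong length none)))) ,
    mk⇔ (λ _ → gen) (λ _ → subst (Acyclic n) (sym none) empty-acyclic)
    where
    empty-acyclic : Acyclic n []
    empty-acyclic = [] , [] , λ _ _ → []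
    bound : ∀ S → Acyclic n S → length S ℕ.≤ 0
    bound []      _ = ℕ.z≤n
    bound (t ∷ S) (_ , f ∷ _ , _) = contradiction (subst (t ∈_) none (∈-faces n f)) λ ()

open import Data.Nat using (_+_; _*_; _∸_)

theorem2 : (n : ℕ) → Prime n →
    (Σ ℕ λ r → RankIs n r × r + (n ∸ 1) * (index n ∸ 1) ≡ numFaces n) ×
    (Acyclic n (faces n) ⇔ GeneratedByPM1And2 n)
theorem2 0 pr = contradiction pr ¬prime[0]
theorem2 1 pr = contradiction pr ¬prime[1]
theorem2 2 pr = no-faces 2 refl refl λ
  { Fin.zero u → contradiction refl u
  ; (Fin.suc Fin.zero) _ → 0 , inj₁ (2 ℕ.∣0) }
theorem2 3 pr = no-faces 3 refl refl λ
  { Fin.zero u → contradiction refl u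
  ; (Fin.suc Fin.zero) _ → 0 , inj₁ (3 ℕ.∣0)
  ; (Fin.suc (Fin.suc Fin.zero)) _ → 0 , inj₂ ℕ.∣-refl }
theorem2 n@(suc (suc (suc (suc k)))) pr = Rank.rank-theorem (suc (suc k)) pr
  (ℕ.s≤s (ℕ.s≤s (ℕ.s≤s (ℕ.s≤s ℕ.z≤n)))) (faces-unique n) (faces-IsFace n) (∈-faces n)
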